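{- There is an algorithm which, given a temporal graph $\mathcal{G}=(G,\lambda)$ with $n$ vertices, $m$ edges and $k$ monolabel triangles, decides whether $\mathcal{G}$ is a comparability temporal graph and, if the answer is YES, constructs a TTO (temporal transitive orientation) of $\mathcal{G}$, in time $O(nm+\min\{kn,m^2\})$.
   Context: A (simple) temporal graph $\mathcal{G}=(G,\lambda)$ consists of a finite simple undirected graph $G=(V,E)$ and a function $\lambda:E\to\mathbb{N}$ (time-labels). An orientation $O$ of $\mathcal{G}$ is the choice of exactly one of $(a,b)$, $(b,a)$ for each edge $ab\in E$. An orientation $O$ is a temporal transitive orientation (TTO) if whenever $(a,b)\in O$ and $(b,c)\in O$ with $\lambda(ab)\le\lambda(bc)$, then $(a,c)\in O$ and $\lambda(ac)\ge\lambda(bc)$. A comparability temporal graph is a temporal graph that admits a TTO. A monolabel triangle is a triangle of $G$ whose three edges have the same time-label. -}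

module Defs where

open import Data.Bool using (Bool; T; T?)
open import Data.Bool.Properties using (T-irrelevant)
open import Data.Fin as Fin using (Fin; toℕ)
import Data.Fin.Properties as Fin
open import Data.List using (List; []; _∷_; _++_; length; filter; concatMap; allFin; cartesianProduct)
open import Data.List.Relation.Unary.Any using (Any)
open import Data.List.Relation.Unary.Unique.Propositional using (Unique)
open import Data.Maybe using (Maybe; just; nothing)
open import Data.Nat using (ℕ; zero; suc; _+_; _∸_; _≤_; _≟_)
open import Data.Product using (Σ-syntax; _×_; _,_)
open import Data.Sum using (_⊎_)
open import Level using (0ℓ)
open import Relation.Binary using (Rel)
open import Relation.Binary.PropositionalEquality using (_≡_)
open import Relation.Nullary using (¬_; Dec; yes; no)
open import Relation.Nullary.Decidable using (map′; _×-dec_)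

record SimpleGraph (n : ℕ) : Set where
  field
    adj : Fin n → Fin n → Bool

  infix 4 _~_
  _~_ : Rel (Fin n) 0ℓ
  a ~ b = T (adj a b)

  field
    ~-sym    : ∀ {a b} → a ~ b → b ~ a
    ~-irrefl : ∀ {a} → ¬ (a ~ a)

record TemporalGraph (n : ℕ) : Set where
  field
    graph : SimpleGraph n
  open SimpleGraph graph public
  -- T (adj a b) has at most one element, so together with label-sym this is
  -- exactly a function on undirected edges.
  field
    label     : ∀ {a b} → a ~ b → ℕ
    label-sym : ∀ {a b} (p : a ~ b) (q : b ~ a) → label p ≡ label q

module _ {n : ℕ} (G : TemporalGraph n) where
  open TemporalGraph G

  record IsOrientation (O : Rel (Fin n) 0ℓ) : Set where
    field
      sound : ∀ {a b} → O a b → a ~ b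
      total : ∀ {a b} → a ~ b → O a b ⊎ O b a
      asym  : ∀ {a b} → O a b → ¬ O b a

  record IsTTO (O : Rel (Fin n) 0ℓ) : Set where
    field
      isOrientation : IsOrientation O
      transitive    : ∀ {a b c} (p : a ~ b) (q : b ~ c) →
                      O a b → O b c → label p ≤ label q →
                      Σ[ r ∈ a ~ c ] (O a c × label q ≤ label r)

  IsComparability : Set₁
  IsComparability = Σ[ O ∈ Rel (Fin n) 0ℓ ] IsTTO O

  Monolabel : Fin n → Fin n → Fin n → Set
  Monolabel a b c =
    Σ[ p ∈ a ~ b ] Σ[ q ∈ b ~ c ] Σ[ r ∈ a ~ c ]
      (label p ≡ label q × label q ≡ label r)

  monolabel? : ∀ a b c → Dec (Monolabel a b c)
  monolabel? a b c with T? (adj a b) | T? (adj b c) | T? (adj a c)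
  ... | no ¬p | _     | _     = no λ (p , _) → ¬p p
  ... | yes _ | no ¬q | _     = no λ (_ , q , _) → ¬q q
  ... | yes _ | yes _ | no ¬r = no λ (_ , _ , r , _) → ¬r r
  ... | yes p | yes q | yes r =
    map′ (λ e → p , q , r , e) back
         ((label p ≟ label q) ×-dec (label q ≟ label r))
    where
    back : Monolabel a b c → label p ≡ label q × label q ≡ label r
    back (p′ , q′ , r′ , e)
      rewrite T-irrelevant p p′ | T-irrelevant q q′ | T-irrelevant r r′ = e

  -- Each triangle is counted once, through its increasing triple of vertices.
  #monolabelTriangles : ℕ
  #monolabelTriangles =
    length (filter (λ (a , b , c) →
                     (a Fin.<? b) ×-dec (b Fin.<? c) ×-dec monolabel? a b c)
                   (cartesianProduct (allFin n)
                     (cartesianProduct (allFin n) (allFin n))))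

  record Arc : Set where
    constructor arc
    field
      src tgt : Fin n
      edge    : src ~ tgt
  open Arc

  ⟦_⟧ : List Arc → Rel (Fin n) 0ℓ
  ⟦ as ⟧ a b = Any (λ e → src e ≡ a × tgt e ≡ b) as

  -- Every edge of the graph is listed exactly once, written in either
  -- direction; hence the length of the list is the number of edges.
  IsEdgeList : List Arc → Set
  IsEdgeList as = Unique as × IsOrientation ⟦ as ⟧

  encodeInput : List Arc → List ℕ
  encodeInput es =
    n ∷ length es ∷ concatMap (λ (arc a b p) → toℕ a ∷ toℕ b ∷ label p ∷ []) es

  encodeOrientation : List Arc → List ℕ
  encodeOrientation = concatMap (λ (arc a b _) → toℕ a ∷ toℕ b ∷ [])

  data CorrectOutput : List ℕ → Set₁ where
    YES : ∀ as → IsEdgeList as → IsTTO ⟦ as ⟧ →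
          CorrectOutput (1 ∷ encodeOrientation as)
    NO  : ¬ IsComparability → CorrectOutput (0 ∷ [])

-- The unit-cost random access machine of Cook and Reckhow, over ℕ with
-- truncated subtraction.  There is no multiplication.

data Instr : Set where
  const : (i c : ℕ)   → Instr  -- Xᵢ ← c
  add   : (i j k : ℕ) → Instr  -- Xᵢ ← Xⱼ + Xₖ
  sub   : (i j k : ℕ) → Instr  -- Xᵢ ← Xⱼ ∸ Xₖ
  load  : (i j : ℕ)   → Instr  -- Xᵢ ← X at address Xⱼ
  store : (i j : ℕ)   → Instr  -- X at address Xᵢ ← Xⱼ
  jpos  : (l j : ℕ)   → Instr  -- go to instruction l if Xⱼ > 0
  read  : (i : ℕ)     → Instr  -- Xᵢ ← next input number
  print : (i : ℕ)     → Instr  -- append Xᵢ to the output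

Program : Set
Program = List Instr

Memory : Set
Memory = ℕ → ℕ

infixl 10 _[_↦_]
_[_↦_] : Memory → ℕ → ℕ → Memory
(X [ i ↦ v ]) j with i ≟ j
... | yes _ = v
... | no  _ = X j

record State : Set where
  constructor state
  field
    pc     : ℕ
    mem    : Memory
    input  : List ℕ
    output : List ℕ
open State public

start : List ℕ → State
start xs = state 0 (λ _ → 0) xs []

fetch : Program → ℕ → Maybe Instr
fetch []       _       = nothing
fetch (I ∷ _)  zero    = just I
fetch (_ ∷ Is) (suc l) = fetch Is l

jump : ℕ → ℕ → ℕ → ℕ
jump l pc zero    = suc pc
jump l pc (suc _) = l

-- Reading past the end of the input yields 0.
exec : Instr → State → State
exec (const i c) (state pc X xs o)       = state (suc pc) (X [ i ↦ c ]) xs o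
exec (add i j k) (state pc X xs o)       = state (suc pc) (X [ i ↦ X j + X k ]) xs o
exec (sub i j k) (state pc X xs o)       = state (suc pc) (X [ i ↦ X j ∸ X k ]) xs o
exec (load i j)  (state pc X xs o)       = state (suc pc) (X [ i ↦ X (X j) ]) xs o
exec (store i j) (state pc X xs o)       = state (suc pc) (X [ X i ↦ X j ]) xs o
exec (jpos l j)  (state pc X xs o)       = state (jump l pc (X j)) X xs o
exec (read i)    (state pc X [] o)       = state (suc pc) (X [ i ↦ 0 ]) [] o
exec (read i)    (state pc X (x ∷ xs) o) = state (suc pc) (X [ i ↦ x ]) xs o
exec (print i)   (state pc X xs o)       = state (suc pc) X xs (o ++ X i ∷ [])

-- P ⊢ s ⇓⟨ t ⟩ o: from s, program P halts after exactly t instructions with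
-- output o.  It halts when the program counter points at no instruction.
infix 4 _⊢_⇓⟨_⟩_
data _⊢_⇓⟨_⟩_ (P : Program) : State → ℕ → List ℕ → Set where
  halt : ∀ {s} → fetch P (pc s) ≡ nothing → P ⊢ s ⇓⟨ 0 ⟩ output s
  next : ∀ {s I t o} → fetch P (pc s) ≡ just I →
         P ⊢ exec I s ⇓⟨ t ⟩ o → P ⊢ s ⇓⟨ suc t ⟩ o

{-# OPTIONS --safe #-}

module Submission where

-- Shift the labels by one, so that λ(ac) = 0 can stand for a nonedge.  Apart
-- from the triangles with three equal labels, the conditions for a TTO are
-- binary: if λ(ab) ≤ λ(bc) and λ(ac) < λ(bc), then a → b forces c → b, and
-- b → c forces b → a.  A triangle with equal labels only must not be cyclic, so
-- two of its arcs in a row force the third.  Call a set X of arcs closed if it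
-- is antisymmetric and stable under these forcing rules.
--
-- If any TTO T exists, then every closed X extends to a TTO: orient each edge
-- left undecided by X through the lexicographic comparison, with respect to T,
-- of the sets of X-successors of its two ends.  Hence no choice ever has to be
-- undone.  For every edge still undecided, the closures of X with either
-- orientation are grown in lockstep, and the first to be completed without
-- conflict is adopted; if both run into a conflict there is no TTO.  The time
-- spent on an abandoned closure is bounded by that spent on the adopted one,
-- and each arc of a closure is treated in O(n) steps, so O(nm) steps suffice.

open import Defs
open import Data.List using (List; length)
open import Data.Nat using (ℕ; _+_; _*_; _^_; _⊓_; _≤_)
open import Data.Product using (Σ-syntax; ∃-syntax; _×_)

open import Data.Bool using (Bool; true; false; T; T?; not; if_then_else_; _∧_; _∨_)
open import Data.Bool.Properties using (T-irrelevant)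
open import Data.Empty using (⊥; ⊥-elim)
open import Data.Fin using (Fin; toℕ; fromℕ<)
import Data.Fin.Properties as Fin
open import Data.List using ([]; _∷_; _++_; map; concatMap; lookup; allFin; _∷ʳ_; _∷ʳ′_; initLast)
open import Data.List.Membership.DecPropositional using () renaming (_∈?_ to member?)
open import Data.List.Membership.Propositional using (_∈_; _∉_)
open import Data.List.Membership.Propositional.Properties using (∈-allFin; ∈-++⁺ˡ; ∈-++⁺ʳ; ∈-++⁻; ∈-lookup; ∈-map⁺; ∈-map⁻)
open import Data.List.Properties using (length-++; ++-assoc; ++-identityʳ; length-map)
open import Data.List.Relation.Binary.Permutation.Propositional using (_↭_; ↭-sym)
open import Data.List.Relation.Binary.Permutation.Propositional.Properties using (shift; ∈-resp-↭; All-resp-↭)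
open import Data.List.Relation.Unary.All using (All; []; _∷_)
import Data.List.Relation.Unary.All as All
open import Data.List.Relation.Unary.AllPairs using (AllPairs; []; _∷_)
open import Data.List.Relation.Unary.Any using (here; there)
import Data.List.Relation.Unary.Any as Any
open import Data.List.Relation.Unary.Any.Properties using (map⁺; lookup-index)
open import Data.List.Relation.Unary.Unique.Propositional using (Unique)
open import Data.Maybe using (just; nothing)
open import Data.Nat using (zero; suc; pred; _∸_; _<_; _≡ᵇ_; _≟_; _<?_; z≤n; s≤s; >-nonZero)
open import Data.Nat.Properties
open import Data.Nat.Solver using (module +-*-Solver)
open import Data.Product using (Σ; _,_; proj₁; proj₂; swap)
open import Data.Product.Properties using (≡-dec)
open import Data.Sum using (_⊎_; inj₁; inj₂; [_,_]′)
open import Function using (case_of_)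
open import Level using (Level; 0ℓ)
open import Relation.Binary using (Rel; Decidable; tri<; tri≈; tri>)
open import Relation.Binary.PropositionalEquality
open import Relation.Nullary using (¬_; Dec; yes; no)
open import Relation.Nullary.Decidable using (_×-dec_)

-- In the extension argument `T` need not contain `X`: it only breaks ties. The delicate point is
-- that the comparison must not close a cyclic triangle with three equal labels. The running time is
-- made syntactic. The search, whose loops depend on the data, is flattened into a state machine; a
-- single step costs O(n), since it contains only loops over the vertices, and it is repeated a
-- fixed number of times. What remains is a potential argument. Every adopted arc pays for two
-- steps, one lockstep round and its transfer into the committed set; every edge pays for at most
-- three, the launch of its two closures, the adoption of one and the return to the search.
-- Committed and pending arcs together lie on distinct edges, so at most 2m + 3m = 5m steps are
-- busy, and 6m repetitions leave nothing to do when there is an edge at all. An abandoned closure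
-- adds nothing, because it advances in the same rounds as the adopted one.

module Arithmetic where
  open +-*-Solver using (solve; con; _:+_; _:*_; _:=_)

  commit-arith : ∀ a i l → suc (2 * a + 3 * i + (2 + suc l)) ≡ 2 * suc a + 3 * i + (2 + l)
  commit-arith = solve 3 (λ a i l → con 1 :+ (con 2 :* a :+ con 3 :* i :+ (con 2 :+ (con 1 :+ l))) :=
                                    con 2 :* (con 1 :+ a) :+ con 3 :* i :+ (con 2 :+ l)) refl

  leave-arith : ∀ a i → suc (2 * a + 3 * i + 2) ≡ 2 * a + 3 * suc i
  leave-arith = solve 2 (λ a i → con 1 :+ (con 2 :* a :+ con 3 :* i :+ con 2) := con 2 :* a :+ con 3 :* (con 1 :+ i)) refl

  skip-arith : ∀ w i → w + 3 * suc i ≡ 2 + suc (w + 3 * i)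
  skip-arith = solve 2 (λ w i → w :+ con 3 :* (con 1 :+ i) := con 2 :+ (con 1 :+ (w :+ con 3 :* i))) refl

  budget-arith : ∀ m → 2 * m + 3 * m ≡ 5 * m
  budget-arith = solve 1 (λ m → con 2 :* m :+ con 3 :* m := con 5 :* m) refl

  double-arith : ∀ a b → 2 * a + b ≤ 2 * (b + a)
  double-arith a b = ≤-trans (m≤n+m (2 * a + b) b) (≤-reflexive
    (solve 2 (λ a b → b :+ (con 2 :* a :+ b) := con 2 :* (b :+ a)) refl a b))

  overtime-arith : ∀ w i x → 2 * w + 3 * i + (2 + x) ≡ 2 * w + x + (2 + 3 * i)
  overtime-arith = solve 3 (λ w i x → con 2 :* w :+ con 3 :* i :+ (con 2 :+ x) := con 2 :* w :+ x :+ (con 2 :+ con 3 :* i)) refl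

open Arithmetic

-- Closed sets of arcs and their extension

module Orient {n : ℕ} (lab : Fin n → Fin n → ℕ) (lab-sym : ∀ a b → lab a b ≡ lab b a) where

  record Closed (X : Rel (Fin n) 0ℓ) : Set where
    field
      sound : ∀ {a b} → X a b → 0 < lab a b
      asym  : ∀ {a b} → X a b → ¬ X b a
      head  : ∀ {a b c} → X a b → lab a b ≤ lab b c → lab a c < lab b c → X c b
      tail  : ∀ {a b c} → X a b → 0 < lab a c → lab a c ≤ lab a b → lab c b < lab a b → X a c
      mono  : ∀ {a b c} → X a b → X b c → lab a b ≡ lab b c → lab b c ≡ lab a c → X a c

  Total : Rel (Fin n) 0ℓ → Set
  Total X = ∀ {a b} → 0 < lab a b → X a b ⊎ X b a

  LTransitive : Rel (Fin n) 0ℓ → Set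
  LTransitive X = ∀ {a b c} → X a b → X b c → lab a b ≤ lab b c → X a c × lab b c ≤ lab a c

  -- `head` rules out λ(ac) < λ(bc). An arc from c to a with λ(ab) < λ(ac) would by `tail` force c →
  -- b. The only case left has three equal labels, and there `mono` applies.
  closed⇒transitive : ∀ {X} → Closed X → Total X → LTransitive X
  closed⇒transitive {X} cl tot {a} {b} {c} ab bc le = goal , ac≥
    where
    open Closed cl
    ac≥ : lab b c ≤ lab a c
    ac≥ = ≮⇒≥ λ lt → asym bc (head ab le lt)
    goal : X a c
    goal with tot (≤-trans (sound bc) ac≥)
    ... | inj₁ ac = ac
    ... | inj₂ ca with lab a b <? lab a c
    ...   | yes lt = ⊥-elim (asym bc (tail ca (subst (0 <_) (lab-sym b c) (sound bc))
                       (subst₂ _≤_ (lab-sym b c) (lab-sym a c) ac≥)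
                       (subst₂ _<_ (lab-sym a b) (lab-sym a c) lt)))
    ...   | no ¬lt = mono ab bc (≤-antisym le (≤-trans ac≥ (≮⇒≥ ¬lt)))
                                (≤-antisym ac≥ (≤-trans (≮⇒≥ ¬lt) le))

  -- The binary rules are transitivity read backwards: if the forced edge had the opposite
  -- orientation, it would form a path with the given arc whose third edge has too small a label.
  transitive⇒closed : ∀ {X} → (∀ {a b} → X a b → 0 < lab a b) → (∀ {a b} → X a b → ¬ X b a) →
                      Total X → LTransitive X → Closed X
  transitive⇒closed {X} snd asy tot tr = record
    { sound = snd ; asym = asy
    ; head = λ {a} {b} {c} ab le lt → case₁ ab le lt (tot (≤-<-trans z≤n lt))
    ; tail = λ {a} {b} {c} ab pos le lt → case₂ ab pos le lt (tot pos)
    ; mono = λ ab bc e _ → proj₁ (tr ab bc (≤-reflexive e)) }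
    where
    case₁ : ∀ {a b c} → X a b → lab a b ≤ lab b c → lab a c < lab b c → X b c ⊎ X c b → X c b
    case₁ ab le lt (inj₁ bc) = ⊥-elim (<⇒≱ lt (proj₂ (tr ab bc le)))
    case₁ ab le lt (inj₂ cb) = cb
    case₂ : ∀ {a b c} → X a b → 0 < lab a c → lab a c ≤ lab a b → lab c b < lab a b → X a c ⊎ X c a → X a c
    case₂ ab _ le lt (inj₁ ac) = ac
    case₂ {a} {b} {c} ab _ le lt (inj₂ ca) =
      ⊥-elim (<⇒≱ lt (proj₂ (tr ca ab (subst (_≤ lab a b) (lab-sym a c) le))))

  module Extend {X T : Rel (Fin n) 0ℓ} (X? : Decidable X) (T? : Decidable T)
                (clX : Closed X) (clT : Closed T) (totT : Total T) where
    open Closed clX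
    module T = Closed clT

    data U (a b : Fin n) : Set where
      und : 0 < lab a b → ¬ X a b → ¬ X b a → U a b

    U-sym : ∀ {a b} → U a b → U b a
    U-sym {a} {b} (und p q r) = und (subst (0 <_) (lab-sym a b) p) r q

    U-pos : ∀ {a b} → U a b → 0 < lab a b
    U-pos (und p _ _) = p

    U-out : ∀ {a b} → U a b → ¬ X a b
    U-out (und _ p _) = p

    U-in : ∀ {a b} → U a b → ¬ X b a
    U-in (und _ _ p) = p

    U? : Decidable U
    U? a b with 0 <? lab a b | X? a b | X? b a
    ... | no p | _ | _ = no λ { (und p′ _ _) → p p′ }
    ... | yes _ | yes q | _ = no λ { (und _ q′ _) → q′ q }
    ... | yes _ | no _ | yes r = no λ { (und _ _ r′) → r′ r }
    ... | yes p | no q | no r = yes (und p q r)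

    -- B a c is the set of X-successors of a (a included) that X does not
    -- compare with c; for a clique, a ▷ c says that the T-least element of the
    -- symmetric difference of the two sets of successors belongs to a.
    data B (a c : Fin n) : Fin n → Set where
      self : B a c a
      succ : ∀ {x} → X a x → U x c → lab a x ≡ lab a c → lab x c ≡ lab a c → B a c x

    B? : ∀ a c x → Dec (B a c x)
    B? a c x with x Fin.≟ a
    ... | yes refl = yes self
    ... | no x≢a with X? a x | U? x c | lab a x ≟ lab a c | lab x c ≟ lab a c
    ...   | yes p | yes q | yes r | yes s = yes (succ p q r s)
    ...   | no p | _ | _ | _ = no λ { self → x≢a refl ; (succ p′ _ _ _) → p p′ }
    ...   | _ | no p | _ | _ = no λ { self → x≢a refl ; (succ _ p′ _ _) → p p′ }
    ...   | _ | _ | no p | _ = no λ { self → x≢a refl ; (succ _ _ p′ _) → p p′ }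
    ...   | _ | _ | _ | no p = no λ { self → x≢a refl ; (succ _ _ _ p′) → p p′ }

    infix 4 _▷_
    _▷_ : Rel (Fin n) 0ℓ
    a ▷ c = Σ[ x ∈ Fin n ] (B a c x × (∀ {y} → B c a y → T x y))

    ≢⇒⊎ : ∀ {i j : ℕ} → (i < j → ⊥) → (j < i → ⊥) → i ≡ j
    ≢⇒⊎ p q = ≤-antisym (≮⇒≥ q) (≮⇒≥ p)

    -- With a smaller label on bc, `tail` would decide ac at once; with a larger one, `head` gives c
    -- → b and then `tail` gives c → a. So an undecided edge next to a decided one of equal label
    -- lies in a monolabel triangle.
    apex : ∀ {a b c} → X a b → U a c → lab a b ≡ lab a c → lab b c ≡ lab a c
    apex {a} {b} {c} ab (und pos ¬ac ¬ca) e = ≢⇒⊎ lo hi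
      where
      lo : lab b c < lab a c → ⊥
      lo lt = ¬ac (tail ab pos (≤-reflexive (sym e)) (subst₂ _<_ (lab-sym b c) (sym e) lt))
      hi : lab a c < lab b c → ⊥
      hi lt = ¬ca (tail cb (subst (0 <_) (lab-sym a c) pos)
                     (<⇒≤ (subst₂ _<_ (lab-sym a c) (lab-sym b c) lt))
                     (subst₂ _<_ (sym e) (lab-sym b c) lt))
        where cb = head ab (<⇒≤ (subst (_< lab b c) (sym e) lt)) lt

    -- This makes the comparison meaningful: any element of one set is joined to any element of the
    -- other, so `T` orients the edge between them.
    cross : ∀ {a c x y} → U a c → B a c x → B c a y → lab x y ≡ lab a c
    cross u self self = refl
    cross {a} {c} u self (succ cy ya e f) = trans (trans (lab-sym a _) f) (lab-sym c a)
    cross u (succ ax xc e f) self = f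
    cross {a} {c} {x} {y} u (succ ax xc e f) (succ cy ya e′ f′) =
      trans (trans (lab-sym x y) (apex cy (U-sym xc) e″)) (trans (lab-sym c x) f)
      where
      e″ : lab c y ≡ lab c x
      e″ = trans e′ (trans (lab-sym c a) (trans (sym f) (lab-sym x c)))

    ▷-asym : ∀ {a c} → a ▷ c → c ▷ a → ⊥
    ▷-asym (x , bx , f) (y , by , g) = T.asym (f by) (g bx)

    -- Two elements of the same set `B c a` need not be adjacent, so a least element cannot simply
    -- be chosen. The search goes through `B a c` and keeps an element of `B c a` that precedes
    -- everything met so far; if some `x₀` defeats it and no other element of `B c a` precedes `x₀`,
    -- then `x₀` wins.
    ▷-total : ∀ {a c} → U a c → a ▷ c ⊎ c ▷ a
    ▷-total {a} {c} u with search (allFin n)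
      where
      search : (xs : List (Fin n)) →
               (Σ[ x ∈ Fin n ] (B a c x × (∀ {y} → B c a y → T x y))) ⊎
               (Σ[ y ∈ Fin n ] (B c a y × (∀ {x} → x ∈ xs → B a c x → T y x)))
      search [] = inj₂ (c , self , λ ())
      search (x₀ ∷ xs) with search xs
      ... | inj₁ p = inj₁ p
      ... | inj₂ (y⋆ , b⋆ , dom) with B? a c x₀
      ...   | no ¬b = inj₂ (y⋆ , b⋆ , λ { (here refl) b → ⊥-elim (¬b b) ; (there i) b → dom i b })
      ...   | yes b₀ with T? y⋆ x₀
      ...     | yes t = inj₂ (y⋆ , b⋆ , λ { (here refl) b → t ; (there i) b → dom i b })
      ...     | no ¬t with Fin.any? (λ y → B? c a y ×-dec T? y x₀)
      ...       | no none = inj₁ (x₀ , b₀ , λ {y} by →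
                    [ (λ t → t) , (λ t → ⊥-elim (none (y , by , t))) ]′
                      (totT (subst (0 <_) (sym (cross u b₀ by)) pos)))
        where pos = U-pos u
      ...       | yes (y₁ , b₁ , t₁) = inj₂ (y₁ , b₁ , dom₁)
        where
        pos = U-pos u
        sy : ∀ {x y} → B a c x → B c a y → lab y x ≡ lab a c
        sy bx by = trans (lab-sym _ _) (cross u bx by)
        t⋆ : T x₀ y⋆
        t⋆ with totT (subst (0 <_) (sym (cross u b₀ b⋆)) pos)
        ... | inj₁ t = t
        ... | inj₂ t = ⊥-elim (¬t t)
        tr : LTransitive T
        tr = closed⇒transitive clT totT
        -- The path `y₁` → `x₀` → `y⋆` makes the two candidates adjacent after all, and `y₁`
        -- inherits whatever `y⋆` preceded through triangles with three equal labels.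
        y₁y⋆ : T y₁ y⋆ × lab x₀ y⋆ ≤ lab y₁ y⋆
        y₁y⋆ = tr t₁ t⋆ (≤-reflexive (trans (sy b₀ b₁) (sym (cross u b₀ b⋆))))
        same : lab y₁ y⋆ ≡ lab a c
        same = ≤-antisym (≮⇒≥ (hi b₁ b⋆ (proj₁ y₁y⋆))) (subst (_≤ lab y₁ y⋆) (cross u b₀ b⋆) (proj₂ y₁y⋆))
          where
          ac≡ca : lab c a ≡ lab a c
          ac≡ca = lab-sym c a
          -- If the edge between two successors of c had a larger label than their arcs from c,
          -- `head` would force it in both directions.
          hi : ∀ {y z} → B c a y → B c a z → T y z → lab a c < lab y z → ⊥
          hi self self t _ = T.asym t t
          hi self (succ _ _ e _) _ lt = <-irrefl (sym (trans e ac≡ca)) lt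
          hi (succ {y} _ _ e _) self _ lt = <-irrefl (sym (trans (lab-sym y c) (trans e ac≡ca))) lt
          hi (succ {y} cy _ e _) (succ {z} cz _ e′ _) _ lt =
            asym (spoke cz cy (trans e′ ac≡ca) (trans e ac≡ca) (subst (lab a c <_) (lab-sym y z) lt))
                 (spoke cy cz (trans e ac≡ca) (trans e′ ac≡ca) lt)
            where
            spoke : ∀ {y z} → X c y → X c z → lab c y ≡ lab a c → lab c z ≡ lab a c →
                    lab a c < lab y z → X z y
            spoke {y} {z} cy cz e e′ lt = head cy (<⇒≤ (subst (_< lab y z) (sym e) lt)) (subst (_< lab y z) (sym e′) lt)
        dom₁ : ∀ {x} → x ∈ x₀ ∷ xs → B a c x → T y₁ x
        dom₁ (here refl) _ = t₁
        dom₁ {x} (there i) bx =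
          T.mono (proj₁ y₁y⋆) (dom i bx) (trans same (sym (sy bx b⋆))) (trans (sy bx b⋆) (sym (sy bx b₁)))
    ... | inj₁ p = inj₁ p
    ... | inj₂ (y , by , dom) = inj₂ (y , by , λ bx → dom (∈-allFin _) bx)

    data X′ (a b : Fin n) : Set where
      old : X a b → X′ a b
      new : U a b → a ▷ b → X′ a b

    X′-total : Total X′
    X′-total {a} {b} p with X? a b | X? b a
    ... | yes q | _ = inj₁ (old q)
    ... | no _ | yes q = inj₂ (old q)
    ... | no q | no r with ▷-total (und p q r)
    ...   | inj₁ s = inj₁ (new (und p q r) s)
    ...   | inj₂ s = inj₂ (new (U-sym (und p q r)) s)

    X′-asym : ∀ {a b} → X′ a b → ¬ X′ b a
    X′-asym (old p) (old q) = asym p q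
    X′-asym (old p) (new (und _ _ ¬p) _) = ¬p p
    X′-asym (new (und _ _ ¬p) _) (old p) = ¬p p
    X′-asym (new _ p) (new _ q) = ▷-asym p q

    X′-sound : ∀ {a b} → X′ a b → 0 < lab a b
    X′-sound (old p) = sound p
    X′-sound (new u _) = U-pos u

    -- Going from p to r, the set to be beaten gains no element, and the witness b either belongs to
    -- r as well or is joined to r by a label below λ(qr), possibly as a nonedge. In the second case
    -- r itself becomes the witness.
    ▷-head : ∀ {p q r} → U p q → U r q → lab p q ≤ lab q r → lab p r < lab q r → p ▷ q → r ▷ q
    ▷-head {p} {q} {r} upq@(und pos ¬pq ¬qp) urq le lt (b , pb , dom) = conclude (B-pq pb)
      where
      rq : lab q r ≡ lab r q
      rq = lab-sym q r
      -- Any deviation from equal labels, and any decision on the edge ap, would let the rules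
      -- decide pq or ar, which are both undecided.
      B-qr : ∀ {a} → B q r a → a ≡ q ⊎ (B q p a × lab a r ≡ lab q r × lab p q ≡ lab q r)
      B-qr self = inj₁ refl
      B-qr {a} (succ qa uar e f) = inj₂ (succ qa (und ap-pos ¬ap ¬pa) e₁ e₂ , f , s≡s′)
        where
        s≤qa : lab q p ≤ lab q a
        s≤qa = subst₂ _≤_ (lab-sym p q) (sym e) le
        lo : lab a p < lab q r → ⊥
        lo l = ¬qp (tail qa (subst (0 <_) (lab-sym p q) pos) s≤qa
                      (subst₂ _<_ (lab-sym a p) (sym e) l))
        hi : lab q r < lab a p → ⊥
        hi l = ¬pq (tail (head qa (<⇒≤ (subst (_< lab a p) (sym e) l)) (≤-<-trans (subst (lab q p ≤_) e s≤qa) l))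
                      pos (<⇒≤ (subst₂ _<_ (lab-sym q p) (lab-sym a p) (≤-<-trans (subst (lab q p ≤_) e s≤qa) l)))
                      (subst₂ _<_ (sym e) (lab-sym a p) l))
        ap : lab a p ≡ lab q r
        ap = ≢⇒⊎ lo hi
        head-pa : X p a → ⊥
        head-pa pa = U-in uar (head pa (≤-reflexive (trans (lab-sym p a) (trans ap (sym f)))) (subst (lab p r <_) (sym f) lt))
        s≡s′ : lab p q ≡ lab q r
        s≡s′ = ≢⇒⊎ (λ l → head-pa (head qa (≤-reflexive (trans e (sym ap)))
                                     (subst₂ _<_ (lab-sym p q) (sym ap) l)))
                   (λ l → <⇒≱ l le)
        ap-pos : 0 < lab a p
        ap-pos = subst (0 <_) (trans s≡s′ (sym ap)) pos
        ¬pa : ¬ X p a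
        ¬pa = head-pa
        ¬ap : ¬ X a p
        ¬ap ap′ = U-out uar (tail ap′ (U-pos uar) (≤-reflexive (trans f (sym ap))) (subst₂ _<_ (lab-sym p r) (sym ap) lt))
        e₁ : lab q a ≡ lab q p
        e₁ = trans e (trans (sym s≡s′) (lab-sym p q))
        e₂ : lab a p ≡ lab q p
        e₂ = trans ap (trans (sym s≡s′) (lab-sym p q))
      -- Unless λ(br) is small, p → b forces r → b; a label of br above λ(pq) would then decide rq.
      B-pq : ∀ {b} → B p q b → (B r q b × lab p q ≡ lab q r) ⊎ lab b r < lab q r
      B-pq self = inj₂ lt
      B-pq {b} (succ pb ubq e f) with lab b r <? lab q r
      ... | yes l = inj₂ l
      ... | no l = inj₁ (succ rb ubq (trans (lab-sym r b) (trans br≡ rq)) (trans f (trans s≡s′ rq)) , s≡s′)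
        where
        qr≤br : lab q r ≤ lab b r
        qr≤br = ≮⇒≥ l
        rb : X r b
        rb = head pb (≤-trans (≤-reflexive e) (≤-trans le qr≤br)) (<-≤-trans lt qr≤br)
        no-lt : lab p q < lab b r → ⊥
        no-lt l′ = U-out urq (tail rb (U-pos urq) (subst₂ _≤_ rq (lab-sym b r) qr≤br)
                          (subst₂ _<_ (trans (sym f) (lab-sym b q)) (lab-sym b r) l′))
        br≤ : lab b r ≤ lab p q
        br≤ = ≮⇒≥ no-lt
        br≡ : lab b r ≡ lab q r
        br≡ = ≤-antisym (≤-trans br≤ le) qr≤br
        s≡s′ : lab p q ≡ lab q r
        s≡s′ = ≤-antisym le (≤-trans qr≤br br≤)
      bq : lab b q ≡ lab p q
      bq = cross upq pb self
      conclude : (B r q b × lab p q ≡ lab q r) ⊎ lab b r < lab q r → r ▷ q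
      conclude (inj₁ (rb , _)) = b , rb , λ qa → dom′ (B-qr qa)
        where
        dom′ : ∀ {a} → a ≡ q ⊎ (B q p a × lab a r ≡ lab q r × lab p q ≡ lab q r) → T b a
        dom′ (inj₁ refl) = dom self
        dom′ (inj₂ (qa , _)) = dom qa
      -- Each arc of `T` from b to an element of `B q r` forces, by `head` for `T`, the arc from r
      -- to that element.
      conclude (inj₂ l) = r , self , λ qa → dom′ (B-qr qa)
        where
        dom′ : ∀ {a} → a ≡ q ⊎ (B q p a × lab a r ≡ lab q r × lab p q ≡ lab q r) → T r a
        dom′ (inj₁ refl) = T.head (dom self) (subst (_≤ lab q r) (sym bq) le) l
        dom′ (inj₂ (qa , ar , s≡s′)) =
          T.head (dom qa) (≤-reflexive (trans (cross upq pb qa) (trans s≡s′ (sym ar)))) (subst (lab b r <_) (sym ar) l)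

    X′-head : ∀ {a b c} → X′ a b → lab a b ≤ lab b c → lab a c < lab b c → X′ c b
    X′-head (old ab) le lt = old (head ab le lt)
    X′-head {a} {b} {c} (new u@(und _ _ ¬ba) w) le lt with X? c b | X? b c
    ... | yes cb | _ = old cb
    ... | no _ | yes bc = ⊥-elim (¬ba (tail bc (subst (0 <_) (lab-sym a b) (U-pos u))
                             (subst (_≤ lab b c) (lab-sym a b) le) lt))
    ... | no ¬cb | no ¬bc = new u′ (▷-head u u′ le lt w)
      where u′ = und (subst (0 <_) (lab-sym b c) (≤-<-trans z≤n lt)) ¬cb ¬bc

    X′-tail : ∀ {a b c} → X′ a b → 0 < lab a c → lab a c ≤ lab a b → lab c b < lab a b → X′ a c
    X′-tail {a} {b} {c} ab pos le lt with X′-total pos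
    ... | inj₁ ac = ac
    ... | inj₂ ca = ⊥-elim (X′-asym ab (X′-head ca (subst (_≤ lab a b) (lab-sym a c) le) lt))

    -- Passing from b to its predecessor a enlarges the set of successors and shrinks the set to be
    -- beaten: `B b c` lies in `B a c`, and `B c a` lies in `B c b`. The witness can therefore stay
    -- the same.
    dec : ∀ {a b c} → X a b → U a c → U b c → lab a b ≡ lab b c → lab b c ≡ lab a c → b ▷ c → a ▷ c
    dec {a} {b} {c} ab uac ubc e e′ (x , bx , dom) = x , up bx , λ cy → dom (down cy)
      where
      ab≡ac : lab a b ≡ lab a c
      ab≡ac = trans e e′
      up : ∀ {x} → B b c x → B a c x
      up self = succ ab ubc ab≡ac e′
      up {x} (succ bx uxc f g) = succ (mono ab bx (trans e (sym f)) (trans f (trans e′ (sym ax)))) uxc ax (trans g e′)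
        where
        bx≡ab : lab b x ≡ lab a b
        bx≡ab = trans f (sym e)
        lo : lab a x < lab a c → ⊥
        lo l = asym bx (head ab (≤-reflexive (sym bx≡ab)) (subst (lab a x <_) (trans (sym e′) (sym f)) l))
        hi : lab a c < lab a x → ⊥
        hi l = U-out uac (tail ax′ (U-pos uac) (<⇒≤ l)
                            (subst (_< lab a x) (trans (sym e′) (trans (sym g) (lab-sym x c))) l))
          where
          ax′ : X a x
          ax′ = head bx (<⇒≤ (subst₂ _<_ (trans (sym e′) (sym f)) (lab-sym a x) l))
                        (subst₂ _<_ (trans (sym ab≡ac) (lab-sym a b)) (lab-sym a x) l)
        ax : lab a x ≡ lab a c
        ax = ≢⇒⊎ lo hi
      down : ∀ {y} → B c a y → B c b y
      down self = self
      down {y} (succ cy uya f g) = succ cy (und (subst (0 <_) (sym yb) (U-pos ucb)) ¬yb ¬by)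
                                     (trans f (sym cb≡ca)) yb
        where
        ucb : U c b
        ucb = U-sym ubc
        cb≡ca : lab c b ≡ lab c a
        cb≡ca = trans (lab-sym c b) (trans e′ (lab-sym a c))
        yb : lab y b ≡ lab c b
        yb = apex cy ucb (trans f (sym cb≡ca))
        ¬by : ¬ X b y
        ¬by by = U-in uya (mono ab by (trans ab≡ac (trans (lab-sym a c) (trans (sym cb≡ca) (trans (sym yb) (lab-sym y b)))))
                       (trans (lab-sym b y) (trans yb (trans cb≡ca (trans (sym g) (lab-sym y a))))))
        ¬yb : ¬ X y b
        ¬yb yb′ = U-out ucb (mono cy yb′ (trans f (trans (sym cb≡ca) (sym yb))) yb)

    -- The point of ▷-acyclic: a successor of a undecided against b is either
    -- undecided against c as well or a successor of c.
    transfer : ∀ {a b c x} → U a c → U c b → B a b x → lab a b ≡ lab a c → lab b c ≡ lab a c →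
           B a c x ⊎ B c b x
    transfer _ _ self _ _ = inj₁ self
    transfer {a} {b} {c} {x} uac ucb (succ ax uxb e f) g h with X? c x
    ... | yes cx = inj₂ (succ cx uxb (trans (lab-sym c x) (trans xc (trans (sym h) (lab-sym b c))))
                                     (trans f (trans g (trans (sym h) (lab-sym b c)))))
      where xc : lab x c ≡ lab a c
            xc = apex ax uac (trans e g)
    ... | no ¬cx = inj₁ (succ ax (und (subst (0 <_) (sym xc) (U-pos uac)) ¬xc ¬cx) (trans e g) xc)
      where
      xc : lab x c ≡ lab a c
      xc = apex ax uac (trans e g)
      ¬xc : ¬ X x c
      ¬xc p = U-out uac (mono ax p (trans e (trans g (sym xc))) xc)

    -- By `transfer` each of the three witnesses belongs to a set that one of the other two beats.
    -- So each has a `T`-predecessor among the others, which yields a cycle of length two or three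
    -- in `T`, in the latter case with equal labels.
    ▷-acyclic : ∀ {a b c} → U a b → U b c → U c a → lab a b ≡ lab b c → lab b c ≡ lab c a →
                a ▷ b → b ▷ c → c ▷ a → ⊥
    ▷-acyclic {a} {b} {c} uab ubc uca e f (x , bx , dx) (y , by , dy) (z , bz , dz) =
      cyc into-x into-y into-z
      where
      sw : ∀ {p q} → lab p q ≡ lab q p
      sw = lab-sym _ _
      ca≡ab : lab c a ≡ lab a b
      ca≡ab = trans (sym f) (sym e)
      R : Rel (Fin n) 0ℓ
      R p q = T p q × lab p q ≡ lab a b
      into-x : R z x ⊎ R y x
      into-x with transfer (U-sym uca) (U-sym ubc) bx (trans e (trans f sw)) (trans f sw)
      ... | inj₁ p = inj₁ (dz p , trans (cross uca bz p) ca≡ab)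
      ... | inj₂ p = inj₂ (dy p , trans (cross ubc by p) (sym e))
      into-y : R x y ⊎ R z y
      into-y with transfer (U-sym uab) (U-sym uca) by (trans (sym e) sw) (trans (sym f) (trans (sym e) sw))
      ... | inj₁ p = inj₁ (dx p , cross uab bx p)
      ... | inj₂ p = inj₂ (dz p , trans (cross uca bz p) ca≡ab)
      into-z : R y z ⊎ R x z
      into-z with transfer (U-sym ubc) (U-sym uab) bz (trans (sym f) sw) (trans e sw)
      ... | inj₁ p = inj₁ (dy p , trans (cross ubc by p) (sym e))
      ... | inj₂ p = inj₂ (dx p , cross uab bx p)
      loop : ∀ {p q r} → R p q → R q r → R r p → ⊥
      loop (pq , g) (qr , h) (rp , k) = T.asym (T.mono pq qr (trans g (sym h)) (trans h (trans (sym k) sw))) rp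
      cyc : R z x ⊎ R y x → R x y ⊎ R z y → R y z ⊎ R x z → ⊥
      cyc (inj₁ (zx , _)) _ (inj₂ (xz , _)) = T.asym zx xz
      cyc (inj₁ zx) (inj₁ xy) (inj₁ yz) = loop zx xy yz
      cyc (inj₁ _) (inj₂ (zy , _)) (inj₁ (yz , _)) = T.asym zy yz
      cyc (inj₂ (yx , _)) (inj₁ (xy , _)) _ = T.asym xy yx
      cyc (inj₂ _) (inj₂ (zy , _)) (inj₁ (yz , _)) = T.asym zy yz
      cyc (inj₂ yx) (inj₂ zy) (inj₂ xz) = loop yx xz zy

    X′-mono : ∀ {a b c} → X′ a b → X′ b c → lab a b ≡ lab b c → lab b c ≡ lab a c → X′ a c
    X′-mono {a} {b} {c} ab bc e f with X′-total (subst (0 <_) (trans e f) (X′-sound ab))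
    ... | inj₁ ac = ac
    ... | inj₂ ca = ⊥-elim (acyclic ab bc ca)
      where
      g : lab b c ≡ lab c a
      g = trans f (lab-sym a c)
      -- The cases go by the number of old arcs in the cycle: two or three force a contradiction by
      -- `mono`, a single one by `dec`, and none is `▷-acyclic`.
      acyclic : X′ a b → X′ b c → X′ c a → ⊥
      acyclic (old p) (old q) ca = X′-asym ca (old (mono p q e f))
      acyclic (old p) (new u w) (old q) = X′-asym (new u w) (old (mono q p (trans (sym g) (sym e)) (trans e (lab-sym b c))))
      acyclic (new u w) (old p) (old q) = X′-asym (new u w) (old (mono p q g (trans (sym g) (trans (sym e) (lab-sym a b)))))
      acyclic (old p) (new u w) (new v _) = X′-asym ca (new (U-sym v) (dec p (U-sym v) u e f w))
      acyclic (new u _) (old p) (new v w) =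
        X′-asym ab (new (U-sym u) (dec p (U-sym u) v g (trans (sym g) (trans (sym e) (lab-sym a b))) w))
      acyclic (new u w) (new v _) (old p) =
        X′-asym bc (new (U-sym v) (dec p (U-sym v) u (trans (sym g) (sym e)) (trans e (lab-sym b c)) w))
      acyclic (new u w) (new v w′) (new t w″) = ▷-acyclic u v t e g w w′ w″

    X′-closed : Closed X′
    X′-closed = record { sound = X′-sound ; asym = X′-asym ; head = X′-head ; tail = X′-tail ; mono = X′-mono }

-- A structured language and its compilation

-- Array cell (t, k, i) lives at address 2^(1 + code t k) (2 i + 1); the odd
-- addresses hold the two sizes, the loop counters and intermediate values.

opaque
  hid : ℕ → ℕ
  hid j = suc (j + j)

scale : ℕ → ℕ → ℕ
scale zero    x = x
scale (suc r) x = scale r (x + x)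

code : ℕ → Bool → ℕ
code t false = t + t
code t true  = suc (t + t)

cell : ℕ → Bool → ℕ → ℕ
cell t k i = scale (suc (code t k)) (hid i)

opaque
  unfolding hid

  double-injective : ∀ i j → i + i ≡ j + j → i ≡ j
  double-injective zero    zero    _ = refl
  double-injective (suc i) (suc j) e =
    cong suc (double-injective i j (suc-injective (trans (sym (+-suc i i)) (trans (suc-injective e) (+-suc j j)))))

  odd≢even : ∀ i j → suc (i + i) ≢ j + j
  odd≢even zero    (suc j) e = case trans e (cong suc (+-suc j j)) of λ ()
  odd≢even (suc i) (suc j) e = odd≢even i j (suc-injective (trans (cong suc (sym (+-suc i i)))
                                 (trans (suc-injective e) (+-suc j j))))

  scale-double : ∀ r x → scale r (x + x) ≡ scale r x + scale r x
  scale-double zero    x = refl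
  scale-double (suc r) x = scale-double r (x + x)

  -- A positive number determines its power of two and its odd part. Hence distinct arrays occupy
  -- disjoint sets of addresses, each of them unbounded, and no array size has to be known in
  -- advance.
  scale-injective : ∀ r r′ i i′ → scale r (hid i) ≡ scale r′ (hid i′) → r ≡ r′ × i ≡ i′
  scale-injective zero zero i i′ e = refl , double-injective i i′ (suc-injective e)
  scale-injective zero (suc r′) i i′ e = ⊥-elim (odd≢even i (scale r′ (hid i′)) (trans e (scale-double r′ (hid i′))))
  scale-injective (suc r) zero i i′ e = ⊥-elim (odd≢even i′ (scale r (hid i)) (trans (sym e) (scale-double r (hid i))))
  scale-injective (suc r) (suc r′) i i′ e
    with scale-injective r r′ i i′ (double-injective (scale r (hid i)) (scale r′ (hid i′))
           (trans (sym (scale-double r (hid i))) (trans e (scale-double r′ (hid i′)))))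
  ... | refl , e′ = refl , e′

  code-injective : ∀ t k t′ k′ → code t k ≡ code t′ k′ → t ≡ t′ × k ≡ k′
  code-injective t false t′ false e = double-injective t t′ e , refl
  code-injective t false t′ true  e = ⊥-elim (odd≢even t′ t (sym e))
  code-injective t true  t′ false e = ⊥-elim (odd≢even t t′ e)
  code-injective t true  t′ true  e = double-injective t t′ (suc-injective e) , refl

  cell-injective : ∀ {t k i t′ k′ i′} → cell t k i ≡ cell t′ k′ i′ → t ≡ t′ × k ≡ k′ × i ≡ i′
  cell-injective {t} {k} {i} {t′} {k′} {i′} e
    with scale-injective (suc (code t k)) (suc (code t′ k′)) i i′ e
  ... | p , q with code-injective t k t′ k′ (suc-injective p)
  ...   | r , s = r , s , q

  cell≢hid : ∀ {t k i j} → cell t k i ≢ hid j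
  cell≢hid {t} {k} {i} {j} e = odd≢even j (scale (code t k) (hid i)) (trans (sym e) (scale-double (code t k) (hid i)))

  hid-injective : ∀ {i j} → hid i ≡ hid j → i ≡ j
  hid-injective {i} {j} e = double-injective i j (suc-injective e)

  hid-def : ∀ j → hid j ≡ j + j + 1
  hid-def j = +-comm 1 (j + j)

upd-same : ∀ (X : Memory) i v → (X [ i ↦ v ]) i ≡ v
upd-same X i v with i ≟ i
... | yes _ = refl
... | no ¬p = ⊥-elim (¬p refl)

upd-diff : ∀ (X : Memory) i v j → i ≢ j → (X [ i ↦ v ]) j ≡ X j
upd-diff X i v j p with i ≟ j
... | yes e = ⊥-elim (p e)
... | no _ = refl

data Exp : Set where
  con     : ℕ → Exp
  N M     : Exp
  rd      : ℕ → Bool → Exp → Exp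
  _⊕_ _⊖_ : Exp → Exp → Exp

infixl 6 _⊕_ _⊖_

data Size : Set where
  byN byM : Size

infixr 4 _⨾_
data Stmt : Set where
  _⨾_  : Stmt → Stmt → Stmt
  skip : Stmt
  put  : ℕ → Bool → Exp → Exp → Stmt
  cond : Exp → Stmt → Stmt → Stmt
  loop : Size → Stmt → Stmt
  scan : ℕ → Stmt
  emit : Exp → Stmt

Arrays : Set
Arrays = ℕ → Bool → ℕ → ℕ

record Store : Set where
  constructor store′
  field
    arr : Arrays
    inp : List ℕ
    out : List ℕ
open Store public

_==_ : Bool → Bool → Bool
false == false = true
true  == true  = true
_     == _     = false

write : (ℕ → ℕ) → ℕ → ℕ → ℕ → ℕ
write g i v j = if i ≡ᵇ j then v else g j

update : Arrays → ℕ → Bool → ℕ → ℕ → Arrays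
update a t k i v t′ k′ = if (t ≡ᵇ t′) ∧ (k == k′) then write (a t′ k′) i v else a t′ k′

next-input : List ℕ → ℕ
next-input []      = 0
next-input (x ∷ _) = x

rest-input : List ℕ → List ℕ
rest-input []       = []
rest-input (_ ∷ xs) = xs

branch : {A : Set} → ℕ → A → A → A
branch zero    x y = y
branch (suc _) x y = x

iter : ℕ → (Store → Store) → Store → Store
iter zero    f σ = σ
iter (suc k) f σ = iter k f (f σ)

timeE : Exp → ℕ
timeE (con _) = 1
timeE N = 2
timeE M = 2
timeE (rd t k e) = timeE e + (3 + (suc (code t k) + 1))
timeE (e ⊕ f) = timeE e + (timeE f + 1)
timeE (e ⊖ f) = timeE e + (timeE f + 1)

module Semantics (n m : ℕ) where

  sz : Size → ℕ
  sz byN = n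
  sz byM = m

  ⟦_⟧e : Exp → Arrays → ℕ
  ⟦ con c ⟧e a = c
  ⟦ N ⟧e a = n
  ⟦ M ⟧e a = m
  ⟦ rd t k e ⟧e a = a t k (⟦ e ⟧e a)
  ⟦ e ⊕ f ⟧e a = ⟦ e ⟧e a + ⟦ f ⟧e a
  ⟦ e ⊖ f ⟧e a = ⟦ e ⟧e a ∸ ⟦ f ⟧e a

  run : Stmt → Store → Store
  run (s ⨾ s′) σ = run s′ (run s σ)
  run skip σ = σ
  run (put t k e f) (store′ a i o) = store′ (update a t k (⟦ e ⟧e a) (⟦ f ⟧e a)) i o
  run (cond e s s′) σ = branch (⟦ e ⟧e (arr σ)) (run s σ) (run s′ σ)
  run (loop z s) σ = iter (sz z) (run s) σ
  run (scan t) (store′ a i o) = store′ (update a t false 0 (next-input i)) (rest-input i) o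
  run (emit e) (store′ a i o) = store′ a i (o ++ ⟦ e ⟧e a ∷ [])

  -- An upper bound that charges both branches of a conditional. It depends only on the text and on
  -- the two sizes, so no reasoning about data enters the time analysis of the language.
  time : Stmt → ℕ
  time (s ⨾ s′) = time s + time s′
  time skip = 0
  time (put t k e f) = timeE f + (timeE e + (3 + (suc (code t k) + 1)))
  time (cond e s s′) = timeE e + (1 + (time s + time s′ + 2))
  time (loop z s) = 2 + (sz z * (3 + (time s + 2)) + 3)
  time (scan _) = 1
  time (emit e) = timeE e + 1

-- Code for an expression leaves its value in hid d and changes no hid j, j < d.

doublings : ℕ → ℕ → List Instr
doublings d zero    = []
doublings d (suc r) = add (hid d) (hid d) (hid d) ∷ doublings d r

-- The machine cannot multiply, but the exponent of two depends on the array alone, so a fixed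
-- number of doublings of 2 i + 1 yields the address.
address : ℕ → ℕ → Bool → List Instr
address d t k =
  add (hid d) (hid d) (hid d) ∷ const (hid (suc d)) 1 ∷ add (hid d) (hid d) (hid (suc d)) ∷
  doublings d (suc (code t k))

compE : ℕ → Exp → List Instr
compE d (con c) = const (hid d) c ∷ []
compE d N = const (hid d) 0 ∷ add (hid d) (hid 0) (hid d) ∷ []
compE d M = const (hid d) 0 ∷ add (hid d) (hid 1) (hid d) ∷ []
compE d (rd t k e) = compE d e ++ (address d t k ++ load (hid d) (hid d) ∷ [])
compE d (e ⊕ f) = compE d e ++ (compE (suc d) f ++ add (hid d) (hid d) (hid (suc d)) ∷ [])
compE d (e ⊖ f) = compE d e ++ (compE (suc d) f ++ sub (hid d) (hid d) (hid (suc d)) ∷ [])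

sizeExp : Size → Exp
sizeExp byN = N
sizeExp byM = M

-- Jump targets are absolute, hence the start address `p`. A loop counts down in `hid d`, and its
-- body is compiled at depth `suc d` so that the counter survives; `hid (suc d)` holds the 1 used
-- for decrementing and for unconditional jumps. The jump to `3 + top` skips the two instructions
-- that leave the loop.
comp : ℕ → ℕ → Stmt → List Instr
comp d p (s ⨾ s′) = c ++ comp d (p + length c) s′
  where c = comp d p s
comp d p skip = []
comp d p (put t k e f) =
  compE d f ++ (compE (suc d) e ++ (address (suc d) t k ++ store (hid (suc d)) (hid d) ∷ []))
comp d p (cond e s s′) =
  c ++ (jpos yes-branch (hid d) ∷ (c′ ++ (const (hid d) 1 ∷ jpos (yes-branch + length c″) (hid d) ∷ c″)))
  where
  c = compE d e
  c′ = comp d (suc (p + length c)) s′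
  yes-branch = 2 + (suc (p + length c) + length c′)
  c″ = comp d yes-branch s
comp d p (loop z s) =
  compE d (sizeExp z) ++
  (jpos (3 + top) (hid d) ∷ const (hid (suc d)) 1 ∷ jpos (2 + (5 + top + length c)) (hid (suc d)) ∷
   const (hid (suc d)) 1 ∷ sub (hid d) (hid d) (hid (suc d)) ∷
   (c ++ (const (hid (suc d)) 1 ∷ jpos top (hid (suc d)) ∷ [])))
  where
  top = p + length (compE d (sizeExp z))
  c = comp (suc d) (5 + top) s
comp d p (scan t) = read (cell t false 0) ∷ []
comp d p (emit e) = compE d e ++ print (hid d) ∷ []

-- Correctness and cost of the compiled code.

module Correct (P : Program) (n m : ℕ) where
  open Semantics n m

  -- A bound in place of an exact count, because the two branches of a conditional take different
  -- times but are charged the same.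
  data Within : ℕ → State → State → Set where
    done : ∀ {b s} → Within b s s
    step : ∀ {b s s′ I} → fetch P (pc s) ≡ just I → Within b (exec I s) s′ → Within (suc b) s s′

  weaken : ∀ {b c s s′} → b ≤ c → Within b s s′ → Within c s s′
  weaken le done = done
  weaken (s≤s le) (step f w) = step f (weaken le w)

  infixr 5 _▸_
  _▸_ : ∀ {b c s s′ s″} → Within b s s′ → Within c s′ s″ → Within (b + c) s s″
  _▸_ {b} {c} done w = weaken (m≤n+m c b) w
  step f v ▸ w = step f (v ▸ w)

  halts : ∀ {b s s′} → Within b s s′ → fetch P (pc s′) ≡ nothing →
          ∃[ t ] (P ⊢ s ⇓⟨ t ⟩ output s′ × t ≤ b)
  halts done f = 0 , halt f , z≤n
  halts (step g w) f with halts w f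
  ... | t , r , le = suc t , next g r , s≤s le

  Seg : ℕ → List Instr → ℕ → Set
  Seg p []       q = p ≡ q
  Seg p (I ∷ Is) q = fetch P p ≡ just I × Seg (suc p) Is q

  seg-split : ∀ p c {c′ q} → Seg p (c ++ c′) q → Seg p c (p + length c) × Seg (p + length c) c′ q
  seg-split p [] {c′} {q} s = sym (+-identityʳ p) , subst (λ p → Seg p c′ q) (sym (+-identityʳ p)) s
  seg-split p (I ∷ c) {c′} {q} (f , s) with seg-split (suc p) c s
  ... | u , v = (f , subst (Seg (suc p) c) (sym (+-suc p (length c))) u)
              , subst (λ p → Seg p c′ q) (sym (+-suc p (length c))) v

  record Sim (a : Arrays) (X : Memory) : Set where
    field
      cells : ∀ t k i → X (cell t k i) ≡ a t k i
      sizeN : X (hid 0) ≡ n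
      sizeM : X (hid 1) ≡ m
  open Sim

  record Keep (d : ℕ) (X Y : Memory) : Set where
    constructor keeps
    field kept : ∀ j → j < d → Y (hid j) ≡ X (hid j)
  open Keep

  keep-refl : ∀ {d X} → Keep d X X
  keep-refl = keeps λ _ _ → refl

  keep-trans : ∀ {d X Y Z} → Keep d X Y → Keep d Y Z → Keep d X Z
  keep-trans p q = keeps λ j l → trans (kept q j l) (kept p j l)

  keep-weaken : ∀ {d X Y} → Keep (suc d) X Y → Keep d X Y
  keep-weaken p = keeps λ j l → kept p j (m≤n⇒m≤1+n l)

  sim-hid : ∀ {a X d v} → 2 ≤ d → Sim a X → Sim a (X [ hid d ↦ v ])
  sim-hid {a} {X} {d} {v} le s = record
    { cells = λ t k i → trans (upd-diff X (hid d) v _ (λ e → cell≢hid {t} {k} {i} (sym e))) (cells s t k i)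
    ; sizeN = trans (upd-diff X (hid d) v _ (λ e → <⇒≢ (≤-trans (s≤s z≤n) le) (sym (hid-injective {d} {0} e)))) (sizeN s)
    ; sizeM = trans (upd-diff X (hid d) v _ (λ e → <⇒≢ le (sym (hid-injective {d} {1} e)))) (sizeM s) }

  keep-hid : ∀ {X d e v} → d ≤ e → Keep d X (X [ hid e ↦ v ])
  keep-hid {X} {d} {e} {v} le = keeps λ j l → upd-diff X (hid e) v _ (λ q → <⇒≢ (<-≤-trans l le) (sym (hid-injective {e} {j} q)))

  ≡ᵇ-true : ∀ i j → (i ≡ᵇ j) ≡ true → i ≡ j
  ≡ᵇ-true zero zero _ = refl
  ≡ᵇ-true (suc i) (suc j) e = cong suc (≡ᵇ-true i j e)

  ≡ᵇ-refl : ∀ i → (i ≡ᵇ i) ≡ true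
  ≡ᵇ-refl zero = refl
  ≡ᵇ-refl (suc i) = ≡ᵇ-refl i

  ==-true : ∀ j k → (j == k) ≡ true → j ≡ k
  ==-true false false _ = refl
  ==-true true true _ = refl

  ==-refl : ∀ k → (k == k) ≡ true
  ==-refl false = refl
  ==-refl true = refl

  sim-cell : ∀ {a X t k i v} → Sim a X → Sim (update a t k i v) (X [ cell t k i ↦ v ])
  sim-cell {a} {X} {t} {k} {i} {v} s = record
    { cells = go
    ; sizeN = trans (upd-diff X _ v _ (cell≢hid {t} {k} {i})) (sizeN s)
    ; sizeM = trans (upd-diff X _ v _ (cell≢hid {t} {k} {i})) (sizeM s) }
    where
    go : ∀ t′ k′ i′ → (X [ cell t k i ↦ v ]) (cell t′ k′ i′) ≡ update a t k i v t′ k′ i′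
    go t′ k′ i′ with cell t k i ≟ cell t′ k′ i′
    ... | yes e with cell-injective {t} {k} {i} {t′} {k′} {i′} e
    ...   | refl , refl , refl rewrite ≡ᵇ-refl t | ==-refl k | ≡ᵇ-refl i = refl
    go t′ k′ i′ | no ne with (t ≡ᵇ t′) in e₁ | (k == k′) in e₂
    ... | false | _ = cells s t′ k′ i′
    ... | true | false = cells s t′ k′ i′
    ... | true | true with (i ≡ᵇ i′) in e₃
    ...   | false = cells s t′ k′ i′
    ...   | true rewrite ≡ᵇ-true t t′ e₁ | ==-true k k′ e₂ | ≡ᵇ-true i i′ e₃ = ⊥-elim (ne refl)

  keep-cell : ∀ {X d t k i v} → Keep d X (X [ cell t k i ↦ v ])
  keep-cell {X} {d} {t} {k} {i} {v} = keeps λ j _ → upd-diff X _ v _ (cell≢hid {t} {k} {i} {j})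

  record ResultE (b p q d : ℕ) (a : Arrays) (v : ℕ) (X : Memory) (is os : List ℕ) : Set where
    constructor resultE
    field
      {mem′} : Memory
      runs   : Within b (state p X is os) (state q mem′ is os)
      sim    : Sim a mem′
      keep   : Keep d X mem′
      value  : mem′ (hid d) ≡ v

  doublings-correct : ∀ r {d p q a X is os} → 2 ≤ d → Seg p (doublings d r) q → Sim a X →
                      ResultE r p q d a (scale r (X (hid d))) X is os
  doublings-correct zero le refl s = resultE done s keep-refl refl
  doublings-correct (suc r) {d} {X = X} le (f , g) s
    with doublings-correct r le g (sim-hid {v = X (hid d) + X (hid d)} le s)
  ... | resultE w s′ k v = resultE (step f w) s′ (keep-trans (keep-hid ≤-refl) k)
                             (trans v (cong (scale r) (upd-same X (hid d) _)))

  address-correct : ∀ t k {d p q a X is os} → 2 ≤ d → Seg p (address d t k) q → Sim a X →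
                    ResultE (3 + suc (code t k)) p q d a (cell t k (X (hid d))) X is os
  address-correct t k {d} {a = a} {X = X} le (f , g , h , r) s
    with doublings-correct (suc (code t k)) le r (sim-hid le (sim-hid {d = suc d} {v = 1} (m≤n⇒m≤1+n le) (sim-hid le s)))
  ... | resultE w s′ kp v = resultE (step f (step g (step h w))) s′
      (keep-trans (keep-hid ≤-refl) (keep-trans (keep-hid (n≤1+n d)) (keep-trans (keep-hid ≤-refl) kp)))
      (trans v (cong (scale (suc (code t k))) eq))
    where
    x = X (hid d)
    X₁ = X [ hid d ↦ x + x ]
    X₂ = X₁ [ hid (suc d) ↦ 1 ]
    eq : (X₂ [ hid d ↦ X₂ (hid d) + X₂ (hid (suc d)) ]) (hid d) ≡ hid x
    eq = trans (upd-same X₂ (hid d) _)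
         (trans (cong₂ _+_ (trans (kept (keep-hid {X₁} {suc d} {suc d} {1} ≤-refl) d ≤-refl) (upd-same X (hid d) _))
                           (upd-same X₁ (hid (suc d)) 1))
                (sym (hid-def x)))

  compE-correct : ∀ e {d p q a X is os} → 2 ≤ d → Seg p (compE d e) q → Sim a X →
                  ResultE (timeE e) p q d a (⟦ e ⟧e a) X is os
  compE-correct (con c) {d} {X = X} le (f , refl) s =
    resultE (step f done) (sim-hid le s) (keep-hid ≤-refl) (upd-same X (hid d) c)
  compE-correct N {d} {X = X} le (f , g , refl) s =
    resultE (step f (step g done)) (sim-hid le s₁) (keep-trans (keep-hid ≤-refl) (keep-hid ≤-refl))
      (trans (upd-same _ (hid d) _) (trans (cong₂ _+_ (sizeN s₁) (upd-same X (hid d) 0)) (+-identityʳ n)))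
    where s₁ = sim-hid {v = 0} le s
  compE-correct M {d} {X = X} le (f , g , refl) s =
    resultE (step f (step g done)) (sim-hid le s₁) (keep-trans (keep-hid ≤-refl) (keep-hid ≤-refl))
      (trans (upd-same _ (hid d) _) (trans (cong₂ _+_ (sizeM s₁) (upd-same X (hid d) 0)) (+-identityʳ m)))
    where s₁ = sim-hid {v = 0} le s
  compE-correct (rd t k e) {d} {p} le sg s with seg-split p (compE d e) sg
  ... | sg₁ , sg₂ with seg-split (p + length (compE d e)) (address d t k) sg₂
  ... | sg₃ , (f , refl) with compE-correct e le sg₁ s
  ... | resultE {X₁} w₁ s₁ k₁ v₁ with address-correct t k le sg₃ s₁
  ... | resultE {X₂} w₂ s₂ k₂ v₂ =
    resultE (w₁ ▸ weaken (≤-reflexive (+-assoc 3 (suc (code t k)) 1)) (w₂ ▸ step f done))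
      (sim-hid le s₂) (keep-trans k₁ (keep-trans k₂ (keep-hid ≤-refl)))
      (trans (upd-same X₂ (hid d) _) (trans (cong X₂ (trans v₂ (cong (cell t k) v₁))) (cells s₂ t k _)))
  compE-correct (e ⊕ e′) {d} {p} le sg s with seg-split p (compE d e) sg
  ... | sg₁ , sg₂ with seg-split (p + length (compE d e)) (compE (suc d) e′) sg₂
  ... | sg₃ , (f , refl) with compE-correct e le sg₁ s
  ... | resultE {X₁} w₁ s₁ k₁ v₁ with compE-correct e′ (m≤n⇒m≤1+n le) sg₃ s₁
  ... | resultE {X₂} w₂ s₂ k₂ v₂ =
    resultE (w₁ ▸ w₂ ▸ step f done) (sim-hid le s₂)
      (keep-trans k₁ (keep-trans (keep-weaken k₂) (keep-hid ≤-refl)))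
      (trans (upd-same X₂ (hid d) _) (cong₂ _+_ (trans (kept k₂ d ≤-refl) v₁) v₂))
  compE-correct (e ⊖ e′) {d} {p} le sg s with seg-split p (compE d e) sg
  ... | sg₁ , sg₂ with seg-split (p + length (compE d e)) (compE (suc d) e′) sg₂
  ... | sg₃ , (f , refl) with compE-correct e le sg₁ s
  ... | resultE {X₁} w₁ s₁ k₁ v₁ with compE-correct e′ (m≤n⇒m≤1+n le) sg₃ s₁
  ... | resultE {X₂} w₂ s₂ k₂ v₂ =
    resultE (w₁ ▸ w₂ ▸ step f done) (sim-hid le s₂)
      (keep-trans k₁ (keep-trans (keep-weaken k₂) (keep-hid ≤-refl)))
      (trans (upd-same X₂ (hid d) _) (cong₂ _∸_ (trans (kept k₂ d ≤-refl) v₁) v₂))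

  record ResultS (b p q d : ℕ) (σ : Store) (X : Memory) (is os : List ℕ) : Set where
    constructor resultS
    field
      {mem′} : Memory
      runs   : Within b (state p X is os) (state q mem′ (inp σ) (out σ))
      sim    : Sim (arr σ) mem′
      keep   : Keep d X mem′

  jpos-taken : ∀ {b p l j v X is os s} → fetch P p ≡ just (jpos l j) → X j ≡ suc v →
               Within b (state l X is os) s → Within (suc b) (state p X is os) s
  jpos-taken {b} {p} {l} {X = X} {is} {os} {s} f e w =
    step f (subst (λ x → Within b (state (jump l p x) X is os) s) (sym e) w)

  jpos-skipped : ∀ {b p l j X is os s} → fetch P p ≡ just (jpos l j) → X j ≡ 0 →
                 Within b (state (suc p) X is os) s → Within (suc b) (state p X is os) s
  jpos-skipped {b} {p} {l} {X = X} {is} {os} {s} f e w =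
    step f (subst (λ x → Within b (state (jump l p x) X is os) s) (sym e) w)

  goto : ∀ {b p l d X is os s} → fetch P p ≡ just (const (hid d) 1) → fetch P (suc p) ≡ just (jpos l (hid d)) →
         Within b (state l (X [ hid d ↦ 1 ]) is os) s → Within (2 + b) (state p X is os) s
  goto {d = d} {X = X} f g w = step f (jpos-taken {X = X [ hid d ↦ 1 ]} g (upd-same X (hid d) 1) w)

  sizeExp-value : ∀ z a → ⟦ sizeExp z ⟧e a ≡ sz z
  sizeExp-value byN a = refl
  sizeExp-value byM a = refl

  sizeExp-time : ∀ z → timeE (sizeExp z) ≡ 2
  sizeExp-time byN = refl
  sizeExp-time byM = refl

  at-pc : ∀ {b p q X is os} → p ≡ q → Within b (state p X is os) (state q X is os)
  at-pc refl = done

  printed : ∀ {b p X is os v v′} → v ≡ v′ → Within b (state p X is (os ++ v ∷ [])) (state p X is (os ++ v′ ∷ []))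
  printed refl = done

  seg-end : ∀ {c p q} → Seg p c q → p + length c ≡ q
  seg-end {[]} {p} refl = +-identityʳ p
  seg-end {I ∷ c} {p} (_ , r) = trans (+-suc p (length c)) (seg-end {c} r)

  comp-correct : ∀ s {d p q X σ} → 2 ≤ d → Seg p (comp d p s) q → Sim (arr σ) X →
                 ResultS (time s) p q d (run s σ) X (inp σ) (out σ)

  loop-correct : ∀ s k {d p q X σ} → 2 ≤ d →
    (let c = comp (suc d) (5 + p) s in
     Seg p (jpos (3 + p) (hid d) ∷ const (hid (suc d)) 1 ∷ jpos (2 + (5 + p + length c)) (hid (suc d)) ∷
            const (hid (suc d)) 1 ∷ sub (hid d) (hid d) (hid (suc d)) ∷
            (c ++ (const (hid (suc d)) 1 ∷ jpos p (hid (suc d)) ∷ []))) q) →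
    Sim (arr σ) X → X (hid d) ≡ k →
    ResultS (k * (3 + (time s + 2)) + 3) p q d (iter k (run s) σ) X (inp σ) (out σ)

  comp-correct (s ⨾ s′) {d} {p} le sg sm with seg-split p (comp d p s) sg
  ... | sg₁ , sg₂ with comp-correct s le sg₁ sm
  ... | resultS w₁ s₁ k₁ with comp-correct s′ le sg₂ s₁
  ... | resultS w₂ s₂ k₂ = resultS (w₁ ▸ w₂) s₂ (keep-trans k₁ k₂)
  comp-correct skip le refl sm = resultS done sm keep-refl
  comp-correct (put t k e f) {d} {p} le sg sm with seg-split p (compE d f) sg
  ... | sg₁ , sg₂ with seg-split (p + length (compE d f)) (compE (suc d) e) sg₂
  ... | sg₃ , sg₄ with seg-split (p + length (compE d f) + length (compE (suc d) e)) (address (suc d) t k) sg₄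
  ... | sg₅ , (g , refl) with compE-correct f le sg₁ sm
  ... | resultE {X₁} w₁ s₁ k₁ v₁ with compE-correct e (m≤n⇒m≤1+n le) sg₃ s₁
  ... | resultE {X₂} w₂ s₂ k₂ v₂ with address-correct t k (m≤n⇒m≤1+n le) sg₅ s₂
  ... | resultE {X₃} w₃ s₃ k₃ v₃ =
    resultS (w₁ ▸ w₂ ▸ weaken (≤-reflexive (+-assoc 3 (suc (code t k)) 1)) (w₃ ▸ step g done))
      (subst (Sim _) (sym eq) (sim-cell {t = t} {k} s₃))
      (subst (Keep d _) (sym eq)
        (keep-trans k₁ (keep-trans (keep-weaken k₂) (keep-trans (keep-weaken k₃) (keep-cell {t = t} {k})))))
    where
    eq : X₃ [ X₃ (hid (suc d)) ↦ X₃ (hid d) ] ≡ X₃ [ cell t k _ ↦ _ ]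
    eq = cong₂ (X₃ [_↦_]) (trans v₃ (cong (cell t k) v₂))
                          (trans (kept k₃ d ≤-refl) (trans (kept k₂ d ≤-refl) v₁))
  comp-correct (cond e s s′) {d} {p} {X = X} {σ} le sg sm with seg-split p (compE d e) sg
  ... | sg₁ , (f , sg₂) with seg-split (suc (p + length (compE d e))) (comp d (suc (p + length (compE d e))) s′) sg₂
  ... | sg₃ , (g , h , sg₄) with compE-correct e le sg₁ sm
  ... | resultE {X₁} w₁ s₁ k₁ v₁ with ⟦ e ⟧e (arr σ)
  ...   | zero with comp-correct s′ le sg₃ s₁
  ...     | resultS w₂ s₂ k₂ =
    resultS (w₁ ▸ jpos-skipped {X = X₁} f v₁ (weaken (+-monoˡ-≤ 2 (m≤n+m (time s′) (time s)))
              (w₂ ▸ goto {d = d} g h (at-pc (seg-end sg₄)))))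
      (sim-hid le s₂) (keep-trans k₁ (keep-trans k₂ (keep-hid ≤-refl)))
  comp-correct (cond e s s′) {d} {p} {X = X} {σ} le sg sm | sg₁ , (f , sg₂) | sg₃ , (g , h , sg₄)
    | resultE {X₁} w₁ s₁ k₁ v₁ | suc v with comp-correct s le sg₄ s₁
  ...     | resultS w₂ s₂ k₂ =
    resultS (w₁ ▸ jpos-taken {X = X₁} f v₁ (weaken (≤-trans (m≤m+n (time s) (time s′)) (m≤m+n _ 2)) w₂))
      s₂ (keep-trans k₁ k₂)
  comp-correct (loop z s) {d} {p} {σ = σ} le sg sm with seg-split p (compE d (sizeExp z)) sg
  ... | sg₁ , sg₂ with compE-correct (sizeExp z) le sg₁ sm
  ... | resultE w₁ s₁ k₁ v₁ with loop-correct s (sz z) le sg₂ s₁ (trans v₁ (sizeExp-value z (arr σ)))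
  ... | resultS w₂ s₂ k₂ = resultS (weaken (≤-reflexive (sizeExp-time z)) w₁ ▸ w₂) s₂ (keep-trans k₁ k₂)
  comp-correct (scan t) {σ = store′ a [] o} le (f , refl) sm =
    resultS (step f done) (sim-cell {t = t} {false} sm) (keep-cell {t = t} {false})
  comp-correct (scan t) {σ = store′ a (x ∷ i) o} le (f , refl) sm =
    resultS (step f done) (sim-cell {t = t} {false} sm) (keep-cell {t = t} {false})
  comp-correct (emit e) {d} {p} {σ = σ} le sg sm with seg-split p (compE d e) sg
  ... | sg₁ , (f , refl) with compE-correct e le sg₁ sm
  ... | resultE {X₁} w₁ s₁ k₁ v₁ =
    resultS (w₁ ▸ step f (printed v₁)) s₁ k₁

  loop-correct s zero {d} {p} {X = X} le (f , g , h , _ , _ , sg) sm e with seg-split (5 + p) (comp (suc d) (5 + p) s) sg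
  ... | _ , (_ , _ , refl) =
    resultS (jpos-skipped {X = X} f e (goto {d = suc d} g h done))
      (sim-hid (m≤n⇒m≤1+n le) sm) (keep-hid (n≤1+n d))
  loop-correct s (suc k) {d} {p} {X = X} le whole@(f , _ , _ , g , h , sg) sm e
    with seg-split (5 + p) (comp (suc d) (5 + p) s) sg
  ... | sg₁ , (u , v , _) with comp-correct s (m≤n⇒m≤1+n le) sg₁
                                 (sim-hid le (sim-hid {d = suc d} {v = 1} (m≤n⇒m≤1+n le) sm))
  ... | resultS {X₁} w₁ s₁ k₁ with loop-correct s k le whole (sim-hid {d = suc d} {v = 1} (m≤n⇒m≤1+n le) s₁)
      (trans (kept (keep-hid {X₁} {suc d} {suc d} {1} ≤-refl) d ≤-refl)
      (trans (kept k₁ d ≤-refl)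
      (trans (upd-same Y (hid d) _)
             (cong₂ _∸_ (trans (kept (keep-hid {X} {suc d} {suc d} {1} ≤-refl) d ≤-refl) e) (upd-same X (hid (suc d)) 1)))))
    where Y = X [ hid (suc d) ↦ 1 ]
  ... | resultS w₂ s₂ k₂ =
    resultS (weaken (≤-reflexive bound) (jpos-taken {X = X} f e (step g (step h (w₁ ▸ goto {d = suc d} u v w₂)))))
      s₂ (keep-trans (keep-hid (n≤1+n d)) (keep-trans (keep-hid ≤-refl)
         (keep-trans (keep-weaken k₁) (keep-trans (keep-hid (n≤1+n d)) k₂))))
    where
    r = k * (3 + (time s + 2)) + 3
    bound : 3 + (time s + (2 + r)) ≡ 3 + (time s + 2) + k * (3 + (time s + 2)) + 3
    bound = trans (cong (3 +_) (sym (+-assoc (time s) 2 r))) (sym (+-assoc (3 + (time s + 2)) (k * (3 + (time s + 2))) 3))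

-- A time bound from the nesting of loops.

LoopsWithin : Bool → Bool → Stmt → Bool
LoopsWithin u v (s ⨾ s′) = LoopsWithin u v s ∧ LoopsWithin u v s′
LoopsWithin u v (cond _ s s′) = LoopsWithin u v s ∧ LoopsWithin u v s′
LoopsWithin u v (loop byN s) = u ∧ LoopsWithin false v s
LoopsWithin u v (loop byM s) = v ∧ LoopsWithin u false s
LoopsWithin u v skip = true
LoopsWithin u v (put _ _ _ _) = true
LoopsWithin u v (scan _) = true
LoopsWithin u v (emit _) = true

module Bound (n m : ℕ) (0<n : 1 ≤ n) (0<m : 1 ≤ m) where
  open Semantics n m using (time)
  open Semantics 1 1 using () renaming (time to unit)

  weight : Bool → ℕ → ℕ
  weight true  k = k
  weight false k = 1

  W : Bool → Bool → ℕ
  W u v = weight u n * weight v m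

  weight≥1 : ∀ u {k} → 1 ≤ k → 1 ≤ weight u k
  weight≥1 true  p = p
  weight≥1 false p = s≤s z≤n

  W≥1 : ∀ u v → 1 ≤ W u v
  W≥1 u v = *-mono-≤ (weight≥1 u 0<n) (weight≥1 v 0<m)

  flat : ∀ k u v → k ≤ k * W u v
  flat k u v = ≤-trans (≤-reflexive (sym (*-identityʳ k))) (*-monoʳ-≤ k (W≥1 u v))

  plus : ∀ w j l {i k} → i ≤ j * w → k ≤ l * w → i + k ≤ (j + l) * w
  plus w j l p q = ≤-trans (+-mono-≤ p q) (≤-reflexive (sym (*-distribʳ-+ w j l)))

  ∧-true : ∀ {a b} → a ∧ b ≡ true → a ≡ true × b ≡ true
  ∧-true {true} e = refl , e

  looped : ∀ k t b w → t ≤ b * w → 1 ≤ k → 1 ≤ w →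
           2 + (k * (3 + (t + 2)) + 3) ≤ (2 + (1 * (3 + (b + 2)) + 3)) * (k * w)
  looped k t b w le 1≤k 1≤w = plus (k * w) 2 (1 * (3 + (b + 2)) + 3) (up 2) (plus (k * w) (1 * (3 + (b + 2))) 3 body (up 3))
    where
    up : ∀ j → j ≤ j * (k * w)
    up j = ≤-trans (≤-reflexive (sym (*-identityʳ j))) (*-monoʳ-≤ j (*-mono-≤ 1≤k 1≤w))
    up′ : ∀ j → j ≤ j * w
    up′ j = ≤-trans (≤-reflexive (sym (*-identityʳ j))) (*-monoʳ-≤ j 1≤w)
    body : k * (3 + (t + 2)) ≤ 1 * (3 + (b + 2)) * (k * w)
    body = ≤-trans (*-monoʳ-≤ k (plus w 3 (b + 2) (up′ 3) (plus w b 2 le (up′ 2))))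
      (≤-reflexive (trans (sym (*-assoc k (3 + (b + 2)) w))
        (trans (cong (_* w) (*-comm k (3 + (b + 2))))
        (trans (*-assoc (3 + (b + 2)) k w) (cong (_* (k * w)) (sym (*-identityˡ (3 + (b + 2)))))))))

  -- The flags `u` and `v` allow at most one loop of each size along every nesting. With both sizes
  -- set to 1 every body is counted once; a loop of length k then contributes a factor k, and since
  -- both sizes are positive the constant overheads are absorbed by the product.
  time-bound : ∀ u v s → LoopsWithin u v s ≡ true → time s ≤ unit s * W u v
  time-bound u v (s ⨾ s′) e = plus (W u v) (unit s) (unit s′) (time-bound u v s (proj₁ (∧-true e))) (time-bound u v s′ (proj₂ (∧-true e)))
  time-bound u v skip e = z≤n
  time-bound u v s@(put t k f g) e = flat (unit s) u v
  time-bound u v (cond f s s′) e =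
    plus (W u v) (timeE f) (1 + (unit s + unit s′ + 2)) (flat (timeE f) u v) (plus (W u v) 1 (unit s + unit s′ + 2) (flat 1 u v)
      (plus (W u v) (unit s + unit s′) 2
        (plus (W u v) (unit s) (unit s′) (time-bound u v s (proj₁ (∧-true e))) (time-bound u v s′ (proj₂ (∧-true e))))
        (flat 2 u v)))
  time-bound true v (loop byN s) e =
    ≤-trans (looped n (time s) (unit s) (W false v) (time-bound false v s e) 0<n (W≥1 false v))
            (≤-reflexive (cong (unit (loop byN s) *_) (cong (n *_) (*-identityˡ (weight v m)))))
  time-bound u true (loop byM s) e =
    ≤-trans (looped m (time s) (unit s) (W u false) (time-bound u false s e) 0<m (W≥1 u false))
            (≤-reflexive (cong (unit (loop byM s) *_) (trans (cong (m *_) (*-identityʳ (weight u n))) (*-comm m (weight u n)))))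
  time-bound u v s@(scan _) e = flat 1 u v
  time-bound u v s@(emit f) e = flat (unit s) u v

-- A graph without edges is accepted before anything of size n is touched.
prelude : ℕ → List Instr
prelude end =
  read (hid 0) ∷ read (hid 1) ∷ jpos 7 (hid 1) ∷
  const (hid 2) 1 ∷ print (hid 2) ∷ const (hid 2) 1 ∷ jpos end (hid 2) ∷ []

compile : Stmt → Program
compile s = prelude (7 + length c) ++ c
  where c = comp 2 7 s

empty : List ℕ → Store
empty xs = store′ (λ _ _ _ → 0) xs []

fetch-end : ∀ (P : Program) → fetch P (length P) ≡ nothing
fetch-end [] = refl
fetch-end (_ ∷ P) = fetch-end P

fetch-++ : ∀ (P : Program) I Q → fetch (P ++ I ∷ Q) (length P) ≡ just I
fetch-++ [] I Q = refl
fetch-++ (_ ∷ P) I Q = fetch-++ P I Q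

module Whole (s : Stmt) where
  P : Program
  P = compile s

  seg-suffix : ∀ {n m} Q c → P ≡ Q ++ c → Correct.Seg P n m (length Q) c (length P)
  seg-suffix Q [] e = sym (cong length (trans e (++-identityʳ Q)))
  seg-suffix {n} {m} Q (I ∷ c) e =
    trans (cong (λ R → fetch R (length Q)) e) (fetch-++ Q I c) ,
    subst (λ k → Correct.Seg P n m k c (length P)) (trans (length-++ Q) (+-comm (length Q) 1))
      (seg-suffix {n} {m} (Q ++ I ∷ []) c (trans e (sym (++-assoc Q (I ∷ []) c))))

  runs-empty : ∀ n → ∃[ t ] (P ⊢ start (n ∷ 0 ∷ []) ⇓⟨ t ⟩ (1 ∷ []) × t ≤ 7)
  runs-empty n = run-it
    where
    open Correct P n 0
    X₀ = (λ _ → 0) [ hid 0 ↦ n ] [ hid 1 ↦ 0 ]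
    X₁ = X₀ [ hid 2 ↦ 1 ]
    w : Within 7 (start (n ∷ 0 ∷ [])) (state (length P) (X₁ [ hid 2 ↦ 1 ]) [] (1 ∷ []))
    w = step refl (step refl (jpos-skipped {X = X₀} refl (upd-same ((λ _ → 0) [ hid 0 ↦ n ]) (hid 1) 0)
          (step refl (step refl (printed′ (upd-same X₀ (hid 2) 1)
            (goto {d = 2} {X = X₁} refl refl done))))))
      where
      printed′ : ∀ {b p X is v v′ s} → v ≡ v′ → Within b (state p X is (v′ ∷ [])) s → Within b (state p X is (v ∷ [])) s
      printed′ refl w = w
    run-it : ∃[ t ] (P ⊢ start (n ∷ 0 ∷ []) ⇓⟨ t ⟩ (1 ∷ []) × t ≤ 7)
    run-it = halts w (fetch-end P)

  -- The three additional steps read the two sizes and jump past the treatment of graphs without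
  -- edges.
  runs-nonempty : ∀ n m′ xs → let m = suc m′ in
    ∃[ t ] (P ⊢ start (n ∷ m ∷ xs) ⇓⟨ t ⟩ out (Semantics.run n m s (empty xs)) × t ≤ 3 + Semantics.time n m s)
  runs-nonempty n m′ xs
    with comp-correct s {2} {7} {length P} {X₀} {empty xs} ≤-refl (seg-suffix {n} {m} (prelude (7 + length (comp 2 7 s))) (comp 2 7 s) refl) sim₀
    where
    m = suc m′
    open Correct P n m
    X₀ = (λ _ → 0) [ hid 0 ↦ n ] [ hid 1 ↦ m ]
    sim₀ : Sim (λ _ _ _ → 0) X₀
    sim₀ = record
      { cells = λ t k i → trans (upd-diff _ (hid 1) m _ (λ e → cell≢hid {t} {k} {i} (sym e)))
                                (upd-diff _ (hid 0) n _ (λ e → cell≢hid {t} {k} {i} (sym e)))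
      ; sizeN = trans (upd-diff _ (hid 1) m _ (λ e → case hid-injective {1} {0} e of λ ())) (upd-same (λ _ → 0) (hid 0) n)
      ; sizeM = upd-same _ (hid 1) m }
  ... | Correct.resultS {X} w sm kp =
    halts (step refl (step refl (jpos-taken {X = X₀} refl (upd-same _ (hid 1) m) w))) (fetch-end P)
    where
    m = suc m′
    open Correct P n m
    X₀ = (λ _ → 0) [ hid 0 ↦ n ] [ hid 1 ↦ m ]

-- Growing a closure

module Growth {n : ℕ} (lab : Fin n → Fin n → ℕ) (lab-sym : ∀ a b → lab a b ≡ lab b a)
              (lab-loop : ∀ a → lab a a ≡ 0) where
  open Orient lab lab-sym public

  V² : Set
  V² = Fin n × Fin n

  ⟪_⟫ : List V² → Rel (Fin n) 0ℓ
  ⟪ xs ⟫ a b = (a , b) ∈ xs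

  -- The two arcs have different underlying edges. Lists of pairwise apart arcs are therefore
  -- antisymmetric up to loops, and they are no longer than the list of edges.
  Apart : V² → V² → Set
  Apart x y = x ≢ y × x ≢ swap y

  IsEdge : V² → Set
  IsEdge (a , b) = 0 < lab a b

  module _ (A : List V²) where

    Forced : List V² → V² → Set₁
    Forced l (a , b) = ∀ {T} → Closed T → (∀ {c d} → (c , d) ∈ l ++ A → T c d) → T a b

    -- The closure `l` of the seed `z` over `A` is described through all closed sets: each one that
    -- contains `A` and `z` contains `l`. A clash then shows that no closed set contains `A` and `z`
    -- at all, which is stronger than a failure of this particular search.
    record Good (z : V²) (l : List V²) (f : Bool) : Set₁ where
      field
        distinct : AllPairs Apart (l ++ A)
        edges    : All IsEdge (l ++ A)
        implied  : ∀ {T} → Closed T → (∀ {c d} → (c , d) ∈ A → T c d) → T (proj₁ z) (proj₂ z) →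
                   ∀ {c d} → (c , d) ∈ l ++ A → T c d
        refuted  : f ≡ true → ∀ {T} → Closed T → (∀ {c d} → (c , d) ∈ A → T c d) →
                   ¬ T (proj₁ z) (proj₂ z)

    data Push (x : V²) (l : List V²) (f : Bool) : List V² → Bool → Set where
      known : x ∈ l ++ A → Push x l f l f
      clash : swap x ∈ l ++ A → Push x l f l true
      fresh : x ∉ l ++ A → swap x ∉ l ++ A → Push x l f (x ∷ l) f

    -- After a failure the side will never be adopted, so all obligations about its list lapse.
    Handled : V² → List V² → Bool → Set
    Handled x l f = f ≡ true ⊎ x ∈ l ++ A

    record Grow (l : List V²) (f : Bool) (l′ : List V²) (f′ : Bool) : Set₁ where
      field
        extra  : List V²
        ext    : l′ ≡ extra ++ l
        stuck  : f ≡ true → f′ ≡ true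
        good   : ∀ {z} → Good z l f → Good z l′ f′

    open Grow

    grow-refl : ∀ {l f} → Grow l f l f
    grow-refl = record { extra = [] ; ext = refl ; stuck = λ e → e ; good = λ g → g }

    grow-trans : ∀ {l f l′ f′ l″ f″} → Grow l f l′ f′ → Grow l′ f′ l″ f″ → Grow l f l″ f″
    grow-trans {l} g h = record
      { extra = extra h ++ extra g
      ; ext = trans (ext h) (trans (cong (extra h ++_) (ext g)) (sym (++-assoc (extra h) (extra g) l)))
      ; stuck = λ e → stuck h (stuck g e) ; good = λ p → good h (good g p) }

    grow-∈ : ∀ {l f l′ f′ x} → Grow l f l′ f′ → x ∈ l ++ A → x ∈ l′ ++ A
    grow-∈ {l} g i rewrite ext g | ++-assoc (extra g) l A = ∈-++⁺ʳ (extra g) i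

    grow-∈ˡ : ∀ {l f l′ f′ x} → Grow l f l′ f′ → x ∈ l → x ∈ l′
    grow-∈ˡ g i rewrite ext g = ∈-++⁺ʳ (extra g) i

    grow-handled : ∀ {l f l′ f′ x} → Grow l f l′ f′ → Handled x l f → Handled x l′ f′
    grow-handled g (inj₁ e) = inj₁ (stuck g e)
    grow-handled g (inj₂ i) = inj₂ (grow-∈ g i)

    push-handled : ∀ {x l f l′ f′} → Push x l f l′ f′ → Handled x l′ f′
    push-handled (known i) = inj₂ i
    push-handled (clash i) = inj₁ refl
    push-handled (fresh _ _) = inj₂ (here refl)

    push-good : ∀ {x l f l′ f′ z} → IsEdge x →
                (∀ {T} → Closed T → (∀ {c d} → (c , d) ∈ A → T c d) → T (proj₁ z) (proj₂ z) → T (proj₁ x) (proj₂ x)) →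
                Push x l f l′ f′ → Good z l f → Good z l′ f′
    push-good _ _ (known _) g = g
    push-good _ j (clash i) g = record
      { Good g ; refuted = λ _ cl inc tz → Closed.asym cl (j cl inc tz) (Good.implied g cl inc tz i) }
    push-good {x} {l} e j (fresh p q) g = record
      { distinct = All.tabulate (λ {y} i → (λ { refl → p i }) , (λ { refl → q i })) ∷ Good.distinct g
      ; edges = e ∷ Good.edges g
      ; implied = λ { cl inc tz (here refl) → j cl inc tz ; cl inc tz (there i) → Good.implied g cl inc tz i }
      ; refuted = Good.refuted g }

    push-grow : ∀ {x l f l′ f′} → IsEdge x → Forced l x → Push x l f l′ f′ → Grow l f l′ f′
    push-grow {x} {l} {f} {l′} {f′} e j p = record
      { extra = proj₁ (ex p) ; ext = proj₂ (ex p) ; stuck = st p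
      ; good = λ g → push-good e (λ cl inc tz → j cl (Good.implied g cl inc tz)) p g }
      where
      ex : ∀ {l′ f′} → Push x l f l′ f′ → Σ[ e ∈ List V² ] l′ ≡ e ++ l
      ex (known _) = [] , refl
      ex (clash _) = [] , refl
      ex (fresh _ _) = x ∷ [] , refl
      st : ∀ {l′ f′} → Push x l f l′ f′ → f ≡ true → f′ ≡ true
      st (known _) e = e
      st (clash _) e = refl
      st (fresh _ _) e = e

    -- d is the processed part of the closure l; (a , b) has been confronted with c.
    record Swept (d l : List V²) (f : Bool) (a b c : Fin n) : Set where
      field
        by-head : lab a b ≤ lab b c → lab a c < lab b c → Handled (c , b) l f
        by-tail : 0 < lab a c → lab a c ≤ lab a b → lab c b < lab a b → Handled (a , c) l f
        monoʳ   : (b , c) ∈ d ++ A → lab a b ≡ lab b c → lab b c ≡ lab a c → Handled (a , c) l f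
        monoˡ   : (c , a) ∈ d ++ A → lab c a ≡ lab a b → lab a b ≡ lab c b → Handled (c , b) l f

    swept-grow : ∀ {d l f l′ f′ a b c} → Grow l f l′ f′ → Swept d l f a b c → Swept d l′ f′ a b c
    swept-grow g s = record
      { by-head = λ p q → grow-handled g (Swept.by-head s p q)
      ; by-tail = λ p q r → grow-handled g (Swept.by-tail s p q r)
      ; monoʳ = λ p q r → grow-handled g (Swept.monoʳ s p q r)
      ; monoˡ = λ p q r → grow-handled g (Swept.monoˡ s p q r) }

    swept-anti : ∀ {d d′ l f a b c} → (∀ {x} → x ∈ d ++ A → x ∈ d′ ++ A) → Swept d′ l f a b c → Swept d l f a b c
    swept-anti i s = record
      { by-head = Swept.by-head s ; by-tail = Swept.by-tail s
      ; monoʳ = λ p → Swept.monoʳ s (i p) ; monoˡ = λ p → Swept.monoˡ s (i p) }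

    Done : List V² → List V² → Bool → Set
    Done d l f = ∀ {a b} → (a , b) ∈ d → ∀ c → Swept d l f a b c

    -- Two consecutive arcs are confronted when the later of them is processed. For an older arc
    -- meeting the new one, the obligation `monoʳ` is thus the `monoˡ` of the new arc, and
    -- conversely.
    done-extend : ∀ {d l f l′ f′ a b} → (∀ {x} → x ∈ d → x ∈ l) → (a , b) ∈ l → Grow l f l′ f′ →
                  Done d l f → (∀ c → Swept l l′ f′ a b c) → Done ((a , b) ∷ d) l′ f′
    done-extend {d} {l} {a = a} {b} inside ab g dn sw (here refl) c = swept-anti incl (sw c)
      where
      incl : ∀ {x} → x ∈ ((a , b) ∷ d) ++ A → x ∈ l ++ A
      incl (here refl) = ∈-++⁺ˡ ab
      incl (there i) with ∈-++⁻ d i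
      ... | inj₁ j = ∈-++⁺ˡ (inside j)
      ... | inj₂ j = ∈-++⁺ʳ l j
    done-extend {d} {l} {f} {l′} {f′} {a} {b} inside ab g dn sw (there {xs = _} y) c = record
      { by-head = Swept.by-head old ; by-tail = Swept.by-tail old
      ; monoʳ = right ; monoˡ = left }
      where
      old = swept-grow g (dn y c)
      right : _
      right (here refl) e e′ = Swept.monoˡ (sw _) (∈-++⁺ˡ (inside y)) e e′
      right (there i) = Swept.monoʳ old i
      left : _
      left (here refl) e e′ = Swept.monoʳ (sw _) (∈-++⁺ˡ (inside y)) e e′
      left (there i) = Swept.monoˡ old i

    -- Two consecutive arcs of `A` are covered by the closedness of `A`; any other pair has a member
    -- in `l`, whose sweep treated it. Antisymmetry comes from the arcs having different edges and
    -- from the absence of loops.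
    finished : ∀ {z l} → Closed ⟪ A ⟫ → Good z l false → Done l l false → Closed ⟪ l ++ A ⟫
    finished {z} {l} cl g dn = record
      { sound = λ i → All.lookup (Good.edges g) i
      ; asym = λ i j → opposite (Good.distinct g) (All.lookup (Good.edges g) i) i j
      ; head = λ i p q → [ (λ j → un (Swept.by-head (dn j _) p q)) , (λ j → ∈-++⁺ʳ l (Closed.head cl j p q)) ]′ (∈-++⁻ l i)
      ; tail = λ i p q r → [ (λ j → un (Swept.by-tail (dn j _) p q r)) , (λ j → ∈-++⁺ʳ l (Closed.tail cl j p q r)) ]′ (∈-++⁻ l i)
      ; mono = λ i j p q → mn (∈-++⁻ l i) (∈-++⁻ l j) i j p q }
      where
      un : ∀ {x} → Handled x l false → x ∈ l ++ A
      un (inj₂ i) = i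
      opposite : ∀ {xs a b} → AllPairs Apart xs → 0 < lab a b → (a , b) ∈ xs → (b , a) ∈ xs → ⊥
      opposite (p ∷ ps) e (here refl) (here q) = loopless e q
        where loopless : ∀ {a b} → 0 < lab a b → (b , a) ≡ (a , b) → ⊥
              loopless {a} e refl = <-irrefl (sym (lab-loop a)) e
      opposite (p ∷ ps) e (here refl) (there j) = proj₂ (All.lookup p j) refl
      opposite (p ∷ ps) e (there i) (here refl) = proj₂ (All.lookup p i) refl
      opposite (p ∷ ps) e (there i) (there j) = opposite ps e i j
      mn : ∀ {a b c} → (a , b) ∈ l ⊎ (a , b) ∈ A → (b , c) ∈ l ⊎ (b , c) ∈ A →
           (a , b) ∈ l ++ A → (b , c) ∈ l ++ A → lab a b ≡ lab b c → lab b c ≡ lab a c → (a , c) ∈ l ++ A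
      mn (inj₁ i) _ _ j p q = un (Swept.monoʳ (dn i _) j p q)
      mn (inj₂ _) (inj₁ j) i _ p q = un (Swept.monoˡ (dn j _) i p q)
      mn (inj₂ i) (inj₂ j) _ _ p q = ∈-++⁺ʳ l (Closed.mono cl i j p q)

-- The program

pattern tRow   = 0
pattern tLab   = 1
pattern tSrc   = 2
pattern tTgt   = 3
pattern tSet   = 4
pattern tMark  = 5
pattern tTail  = 6
pattern tHead  = 7
pattern tDone  = 8
pattern tCount = 9
pattern tFail  = 10
pattern tI     = 11
pattern tMode  = 12
pattern tBad   = 13
pattern tC     = 14
pattern tA     = 15
pattern tB     = 16
pattern tX     = 17
pattern tY     = 18
pattern tAcc   = 19

v : ℕ → Exp
v t = rd t false (con 0)

infix 5 _:=_
_:=_ : ℕ → Exp → Stmt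
t := e = put t false (con 0) e

at : ℕ → ℕ → Exp
at x y = rd tRow false (v x) ⊕ v y

labE : ℕ → ℕ → Exp
labE x y = rd tLab false (at x y)

inSet : ℕ → ℕ → Exp
inSet x y = rd tSet false (at x y)

-- Side k of the current trial; a mark equals 1 + i exactly when it was made
-- during the trial for edge i, so that marks never have to be erased.
known? : Bool → ℕ → ℕ → Exp
known? k x y = inSet x y ⊕ (rd tMark k (at x y) ⊖ v tI)

mark° : Bool → Stmt
mark° k = put tMark k (at tX tY) (v tI ⊕ con 1)
        ⨾ put tTail k (rd tCount k (con 0)) (v tX)
        ⨾ put tHead k (rd tCount k (con 0)) (v tY)
        ⨾ put tCount k (con 0) (rd tCount k (con 0) ⊕ con 1)

-- Opacity keeps run of a piece of the program from unfolding into nested branches.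
opaque
  mark : Bool → Stmt
  mark = mark°

  mark≡ : ∀ k → mark k ≡ mark° k
  mark≡ k = refl

push° : Bool → Stmt
push° k = cond (known? k tX tY) skip
         (cond (known? k tY tX) (put tFail k (con 0) (con 1)) (mark k))

opaque
  push : Bool → Stmt
  push = push°

  push≡ : ∀ k → push k ≡ push° k
  push≡ k = refl

pushArc° : Bool → ℕ → ℕ → Stmt
pushArc° k x y = tX := v x ⨾ tY := v y ⨾ push k

opaque
  pushArc : Bool → ℕ → ℕ → Stmt
  pushArc = pushArc°

  pushArc≡ : ∀ k x y → pushArc k x y ≡ pushArc° k x y
  pushArc≡ k x y = refl

-- Comparisons are truncated differences: y ∸ x is positive when x < y, and 1 + y ∸ x when x ≤ y.
-- The sum tested in `byMono°` vanishes exactly when the three labels agree.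
byHead° byTail° byMono° : Bool → Stmt
byHead° k = cond (con 1 ⊕ labE tB tC ⊖ labE tA tB)
              (cond (labE tB tC ⊖ labE tA tC) (pushArc k tC tB) skip) skip
byTail° k = cond (labE tA tC)
              (cond (con 1 ⊕ labE tA tB ⊖ labE tA tC)
                (cond (labE tA tB ⊖ labE tB tC) (pushArc k tA tC) skip) skip) skip
byMono° k = cond ((labE tA tB ⊖ labE tB tC) ⊕ (labE tB tC ⊖ labE tA tB)
                ⊕ ((labE tB tC ⊖ labE tA tC) ⊕ (labE tA tC ⊖ labE tB tC)))
              skip
              (cond (known? k tB tC) (pushArc k tA tC) skip
              ⨾ cond (known? k tC tA) (pushArc k tC tB) skip)

opaque
  byHead : Bool → Stmt
  byHead = byHead°

  byHead≡ : ∀ k → byHead k ≡ byHead° k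
  byHead≡ k = refl

opaque
  byTail : Bool → Stmt
  byTail = byTail°

  byTail≡ : ∀ k → byTail k ≡ byTail° k
  byTail≡ k = refl

opaque
  byMono : Bool → Stmt
  byMono = byMono°

  byMono≡ : ∀ k → byMono k ≡ byMono° k
  byMono≡ k = refl

sweep° : Bool → Stmt
sweep° k = byHead k ⨾ byTail k ⨾ byMono k ⨾ tC := v tC ⊕ con 1

opaque
  sweep : Bool → Stmt
  sweep = sweep°

  sweep≡ : ∀ k → sweep k ≡ sweep° k
  sweep≡ k = refl

process° : Bool → Stmt
process° k = cond (rd tFail k (con 0)) skip
  (tA := rd tTail k (rd tDone k (con 0)) ⨾ tB := rd tHead k (rd tDone k (con 0)) ⨾ tC := con 0
  ⨾ loop byN (sweep k)
  ⨾ put tDone k (con 0) (rd tDone k (con 0) ⊕ con 1))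

opaque
  process : Bool → Stmt
  process = process°

  process≡ : ∀ k → process k ≡ process° k
  process≡ k = refl

reset : Bool → Stmt
reset k = put tDone k (con 0) (con 0) ⨾ put tCount k (con 0) (con 0) ⨾ put tFail k (con 0) (con 0)

-- A failed side counts as running, so that a side which no longer runs is complete and free of
-- conflict.
running : Bool → Exp
running k = rd tFail k (con 0) ⊕ (rd tCount k (con 0) ⊖ rd tDone k (con 0))

launch° : Stmt
launch° = reset false ⨾ reset true ⨾ pushArc false tA tB ⨾ pushArc true tB tA ⨾ tMode := con 1

opaque
  launch : Stmt
  launch = launch°

  launch≡ : launch ≡ launch°
  launch≡ = refl

idle° : Stmt
idle° = cond (M ⊖ v tI)
  (tA := rd tSrc false (v tI) ⨾ tB := rd tTgt false (v tI)
  ⨾ cond (inSet tA tB ⊕ inSet tB tA) (tI := v tI ⊕ con 1) launch)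
  skip

bothSides : Stmt
bothSides = process false ⨾ process true

trial° : Stmt
trial° = cond (running false)
           (cond (running true)
             (cond (rd tFail false (con 0))
               (cond (rd tFail true (con 0)) (tBad := con 1) bothSides)
               bothSides)
             (tMode := con 3))
           (tMode := con 2)

commit° : Bool → Stmt
commit° k = cond (rd tCount k (con 0))
  (put tCount k (con 0) (rd tCount k (con 0) ⊖ con 1)
  ⨾ tX := rd tTail k (rd tCount k (con 0)) ⨾ tY := rd tHead k (rd tCount k (con 0))
  ⨾ put tSet false (at tX tY) (con 1))
  (tMode := con 0 ⨾ tI := v tI ⊕ con 1)

opaque
  commit : Bool → Stmt
  commit = commit°

  commit≡ : ∀ k → commit k ≡ commit° k
  commit≡ k = refl

opaque
  idle : Stmt
  idle = idle°

  idle≡ : idle ≡ idle°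
  idle≡ = refl

opaque
  trial : Stmt
  trial = trial°

  trial≡ : trial ≡ trial°
  trial≡ = refl

-- One step of the state machine. Mode 0 examines the next edge, mode 1 makes a lockstep round or
-- ends the trial, and modes 2 and 3 move one arc of the closure of side `false` or `true` into the
-- committed set, or return to mode 0. After a rejection nothing happens any more.
step° : Stmt
step° = cond (v tBad) skip
       (cond (v tMode)
         (cond (v tMode ⊖ con 1) (cond (v tMode ⊖ con 2) (commit true) (commit false)) trial)
         idle)

opaque
  step : Stmt
  step = step°

  step≡ : step ≡ step°
  step≡ = refl

rows° readEdge° printEdge° : Stmt
rows° = loop byN (put tRow false (v tC) (v tAcc) ⨾ tAcc := v tAcc ⊕ N ⨾ tC := v tC ⊕ con 1)
readEdge° = scan tA ⨾ scan tB ⨾ scan tX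
  ⨾ put tSrc false (v tI) (v tA) ⨾ put tTgt false (v tI) (v tB)
  ⨾ put tLab false (at tA tB) (v tX ⊕ con 1) ⨾ put tLab false (at tB tA) (v tX ⊕ con 1)
  ⨾ tI := v tI ⊕ con 1
printEdge° = tA := rd tSrc false (v tC) ⨾ tB := rd tTgt false (v tC)
  ⨾ cond (inSet tA tB) (emit (v tA) ⨾ emit (v tB)) (emit (v tB) ⨾ emit (v tA))
  ⨾ tC := v tC ⊕ con 1

opaque
  printEdge : Stmt
  printEdge = printEdge°

  printEdge≡ : printEdge ≡ printEdge°
  printEdge≡ = refl

opaque
  readEdge : Stmt
  readEdge = readEdge°

  readEdge≡ : readEdge ≡ readEdge°
  readEdge≡ = refl

answer° : Stmt
answer° = cond (v tBad) (emit (con 0)) (emit (con 1) ⨾ tC := con 0 ⨾ loop byM printEdge)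

opaque
  rows : Stmt
  rows = rows°

  rows≡ : rows ≡ rows°
  rows≡ = refl

opaque
  answer : Stmt
  answer = answer°

  answer≡ : answer ≡ answer°
  answer≡ = refl

-- Loops have length n or m only, so the 6m repetitions of `step` are six loops in succession.
sixfold : Stmt → Stmt
sixfold s = s ⨾ s ⨾ s ⨾ s ⨾ s ⨾ s

main° : Stmt
main° = rows ⨾ loop byM readEdge ⨾ tI := con 0 ⨾ sixfold (loop byM step) ⨾ answer

opaque
  main : Stmt
  main = main°

  main≡ : main ≡ main°
  main≡ = refl

-- Frame conditions and numerical truth values.

writes : Stmt → ℕ → Bool → Bool
writes (s ⨾ s′) t k = writes s t k ∨ writes s′ t k
writes skip t k = false
writes (put t′ k′ _ _) t k = (t′ ≡ᵇ t) ∧ (k′ == k)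
writes (cond _ s s′) t k = writes s t k ∨ writes s′ t k
writes (loop _ s) t k = writes s t k
writes (scan t′) t k = (t′ ≡ᵇ t) ∧ (false == k)
writes (emit _) t k = false

∨-false : ∀ {a b} → a ∨ b ≡ false → a ≡ false × b ≡ false
∨-false {false} e = refl , e

Cells : Set
Cells = List (ℕ × Bool)

Agree : Cells → Arrays → Arrays → Set
Agree cs a a′ = All (λ c → a′ (proj₁ c) (proj₂ c) ≡ a (proj₁ c) (proj₂ c)) cs

untouched : Stmt → Cells → Bool
untouched s [] = true
untouched s ((t , k) ∷ cs) = not (writes s t k) ∧ untouched s cs

agree-trans : ∀ {cs a b c} → Agree cs a b → Agree cs b c → Agree cs a c
agree-trans [] [] = []
agree-trans (p ∷ ps) (q ∷ qs) = trans q p ∷ agree-trans ps qs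

sideCells : Bool → Cells
sideCells k = (tMark , k) ∷ (tTail , k) ∷ (tHead , k) ∷ (tCount , k) ∷ (tFail , k) ∷ []

tableCells baseCells ctxCells : Cells
tableCells = (tRow , false) ∷ (tLab , false) ∷ (tSrc , false) ∷ (tTgt , false) ∷ []
baseCells = (tSet , false) ∷ (tI , false) ∷ tableCells
ctxCells = (tA , false) ∷ (tB , false) ∷ (tC , false) ∷ baseCells

opaque
  unfolding sweep byHead byTail byMono pushArc push mark

  pushArc-untouched : ∀ k x y → untouched (pushArc k x y) ctxCells ≡ true
  pushArc-untouched k x y = refl

  byHead-untouched : ∀ k → untouched (byHead k) ctxCells ≡ true
  byHead-untouched k = refl

  byTail-untouched : ∀ k → untouched (byTail k) ctxCells ≡ true
  byTail-untouched k = refl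

  right-untouched : ∀ k → untouched (cond (known? k tB tC) (pushArc k tA tC) skip) ctxCells ≡ true
  right-untouched k = refl

  phases-untouched : ∀ k → untouched (byHead k ⨾ byTail k ⨾ byMono k) ctxCells ≡ true
  phases-untouched k = refl

  sweep-untouched : ∀ k → untouched (sweep k) ((tA , false) ∷ (tB , false) ∷ baseCells) ≡ true
  sweep-untouched k = refl

  pushArc-side : ∀ x y → untouched (pushArc false x y)
    ((tDone , true) ∷ (tDone , false) ∷ (tMode , false) ∷ (tBad , false) ∷ sideCells true) ≡ true
  pushArc-side x y = refl

  pushArc-side′ : ∀ x y → untouched (pushArc true x y)
    ((tDone , true) ∷ (tDone , false) ∷ (tMode , false) ∷ (tBad , false) ∷ sideCells false) ≡ true
  pushArc-side′ x y = refl

  sweep-keeps : ∀ k → writes (sweep k) tDone k ≡ false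
  sweep-keeps k = refl

opaque
  unfolding process sweep byHead byTail byMono pushArc push mark

  process-side : untouched (process false) ((tDone , true) ∷ (tMode , false) ∷ (tBad , false) ∷ sideCells true) ≡ true
  process-side = refl

  process-side′ : untouched (process true) ((tDone , false) ∷ (tMode , false) ∷ (tBad , false) ∷ sideCells false) ≡ true
  process-side′ = refl

-- The truth values of conditionals: every positive number means true, so that addition acts as
-- disjunction.
data Flag (P : Set) : ℕ → Set where
  off : ¬ P → Flag P 0
  on  : ∀ {x} → P → Flag P (suc x)

flag-+ : ∀ {P Q x y} → Flag P x → Flag Q y → Flag (P ⊎ Q) (x + y)
flag-+ (on p) _ = on (inj₁ p)
flag-+ (off ¬p) (on q) = on (inj₂ q)
flag-+ (off ¬p) (off ¬q) = off [ ¬p , ¬q ]′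

flag-map : ∀ {P Q x} → (P → Q) → (Q → P) → Flag P x → Flag Q x
flag-map f g (on p) = on (f p)
flag-map f g (off ¬p) = off (λ q → ¬p (g q))

flag-∸ : ∀ x y → Flag (y < x) (x ∸ y)
flag-∸ zero y = subst (Flag _) (sym (0∸n≡0 y)) (off λ ())
flag-∸ (suc x) zero = on (s≤s z≤n)
flag-∸ (suc x) (suc y) = flag-map s≤s ≤-pred (flag-∸ x y)

flag-pos : ∀ x → Flag (0 < x) x
flag-pos zero = off λ ()
flag-pos (suc x) = on (s≤s z≤n)

flag-≢ : ∀ x y → Flag (x ≢ y) ((x ∸ y) + (y ∸ x))
flag-≢ x y = flag-map to from (flag-+ (flag-∸ x y) (flag-∸ y x))
  where
  to : y < x ⊎ x < y → x ≢ y
  to (inj₁ p) refl = <-irrefl refl p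
  to (inj₂ p) refl = <-irrefl refl p
  from : x ≢ y → y < x ⊎ x < y
  from ne with <-cmp x y
  ... | tri< p _ _ = inj₂ p
  ... | tri≈ _ e _ = ⊥-elim (ne e)
  ... | tri> _ _ p = inj₁ p

write-hit : ∀ g i x → write g i x i ≡ x
write-hit g i x rewrite Correct.≡ᵇ-refl [] 0 0 i = refl

write-miss : ∀ g i x j → i ≢ j → write g i x j ≡ g j
write-miss g i x j ne with i ≡ᵇ j in eq
... | false = refl
... | true = ⊥-elim (ne (Correct.≡ᵇ-true [] 0 0 i j eq))

silent : Stmt → Bool
silent (s ⨾ s′) = silent s ∧ silent s′
silent (cond _ s s′) = silent s ∧ silent s′
silent (loop _ s) = silent s
silent (emit _) = false
silent skip = true
silent (put _ _ _ _) = true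
silent (scan _) = true

opaque
  unfolding step idle trial commit launch process sweep byHead byTail byMono pushArc push mark rows readEdge

  step-silent : silent step ≡ true
  step-silent = refl

  input-silent : silent (rows ⨾ loop byM readEdge) ≡ true
  input-silent = refl

  rows-untouched : untouched rows
    ((tLab , false) ∷ (tSrc , false) ∷ (tTgt , false) ∷ (tSet , false) ∷ (tMark , false) ∷ (tMark , true)
     ∷ (tI , false) ∷ (tMode , false) ∷ (tBad , false) ∷ []) ≡ true
  rows-untouched = refl

  readEdge-untouched : untouched readEdge
    ((tRow , false) ∷ (tSet , false) ∷ (tMark , false) ∷ (tMark , true) ∷ (tMode , false) ∷ (tBad , false) ∷ []) ≡ true
  readEdge-untouched = refl

opaque
  unfolding step idle trial commit launch process sweep byHead byTail byMono pushArc push mark rows readEdge answer printEdge main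

  printEdge-untouched : untouched printEdge baseCells ≡ true
  printEdge-untouched = refl

  main-loops : LoopsWithin true true main ≡ true
  main-loops = refl

module Frame (n m : ℕ) where
  open Semantics n m public

  frame : ∀ s {t k} σ → writes s t k ≡ false → arr (run s σ) t k ≡ arr σ t k
  frame (s ⨾ s′) σ e = trans (frame s′ (run s σ) (proj₂ (∨-false e))) (frame s σ (proj₁ (∨-false e)))
  frame skip σ e = refl
  frame (put t′ k′ x y) {t} {k} σ e with (t′ ≡ᵇ t) ∧ (k′ == k) | e
  ... | false | _ = refl
  frame (cond x s s′) {t} {k} σ e with ⟦ x ⟧e (arr σ)
  ... | zero = frame s′ σ (proj₂ (∨-false {writes s t k} e))
  ... | suc _ = frame s σ (proj₁ (∨-false e))
  frame (loop z s) {t} {k} σ e = go (sz z) σ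
    where
    go : ∀ c σ → arr (iter c (run s) σ) t k ≡ arr σ t k
    go zero σ = refl
    go (suc c) σ = trans (go c (run s σ)) (frame s σ e)
  frame (scan t′) {t} {k} σ e with (t′ ≡ᵇ t) ∧ (false == k) | e
  ... | false | _ = refl
  frame (emit x) σ e = refl

  agree : ∀ s cs σ → untouched s cs ≡ true → Agree cs (arr σ) (arr (run s σ))
  agree s [] σ e = []
  agree s ((t , k) ∷ cs) σ e with writes s t k in eq | e
  ... | false | e′ = frame s σ eq ∷ agree s cs σ e′

  cond-spec : ∀ {ℓ : Level} {P : Set} (Q : Store → Set ℓ) e s s′ σ → Flag P (⟦ e ⟧e (arr σ)) →
              (P → Q (run s σ)) → (¬ P → Q (run s′ σ)) → Q (run (cond e s s′) σ)
  cond-spec Q e s s′ σ fl yes-case no-case with ⟦ e ⟧e (arr σ) | fl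
  ... | _ | off ¬p = no-case ¬p
  ... | _ | on p = yes-case p

  silent-out : ∀ s σ → silent s ≡ true → out (run s σ) ≡ out σ
  silent-out (s ⨾ s′) σ e with silent s in e₁ | e
  ... | true | e₂ = trans (silent-out s′ (run s σ) e₂) (silent-out s σ e₁)
  silent-out skip σ e = refl
  silent-out (put _ _ _ _) σ e = refl
  silent-out (cond x s s′) σ e with silent s in e₁ | e
  ... | true | e₂ with ⟦ x ⟧e (arr σ)
  ...   | zero = silent-out s′ σ e₂
  ...   | suc _ = silent-out s σ e₁
  silent-out (loop z s) σ e = go (sz z) σ
    where
    go : ∀ c σ → out (iter c (run s) σ) ≡ out σ
    go zero σ = refl
    go (suc c) σ = trans (go c (run s σ)) (silent-out s σ e)
  silent-out (scan t) σ e = refl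

-- Effect of the program on its arrays

data Nth {A : Set} : List A → ℕ → A → Set where
  first : ∀ {x xs} → Nth (x ∷ xs) 0 x
  later : ∀ {x xs j y} → Nth xs j y → Nth (x ∷ xs) (suc j) y

module Simulation {n : ℕ} (lab : Fin n → Fin n → ℕ) (lab-sym : ∀ a b → lab a b ≡ lab b a)
            (lab-loop : ∀ a → lab a a ≡ 0) (es : List (Fin n × Fin n)) where
  open Growth lab lab-sym lab-loop public

  m : ℕ
  m = length es
  open Frame n m public

  idx : V² → ℕ
  idx (p , q) = toℕ p * n + toℕ q

  idx-injective : ∀ x y → idx x ≡ idx y → x ≡ y
  idx-injective (p , q) (p′ , q′) e with Fin.combine-injective p q p′ q′ (Fin.toℕ-injective
    (trans (Fin.toℕ-combine p q) (trans (cong (_+ toℕ q) (*-comm n (toℕ p)))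
    (trans e (trans (cong (_+ toℕ q′) (*-comm (toℕ p′) n)) (sym (Fin.toℕ-combine p′ q′)))))))
  ... | refl , refl = refl

  Member : (ℕ → ℕ) → List V² → Set
  Member g A = ∀ x → Flag (x ∈ A) (g (idx x))

  -- The list is in reverse order of insertion, its head being stored at the last occupied position.
  -- New arcs therefore go in front, and the processed arcs form a suffix.
  data Queue (gt gh : ℕ → ℕ) : List V² → Set where
    []  : Queue gt gh []
    _∷_ : ∀ {p q l} → gt (length l) ≡ toℕ p × gh (length l) ≡ toℕ q → Queue gt gh l → Queue gt gh ((p , q) ∷ l)

  queue-write : ∀ {gt gh l} j a b → length l ≤ j → Queue gt gh l → Queue (write gt j a) (write gh j b) l
  queue-write j a b le [] = []
  queue-write {gt} {gh} {x ∷ l} j a b le ((e , f) ∷ q) =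
    (trans (write-miss gt j a _ ne) e , trans (write-miss gh j b _ ne) f) ∷ queue-write j a b (≤-trans (n≤1+n _) le) q
    where ne = λ eq → <⇒≢ le (sym eq)

  record SideRep (gm gt gh : ℕ → ℕ) (c f : ℕ) (i : ℕ) (l : List V²) (b : Bool) : Set where
    field
      marks   : ∀ x → Flag (x ∈ l) (gm (idx x) ∸ i)
      -- When the edge index advances to `suc i`, this bound makes all existing marks stale:
      -- subtracting the new index from them gives 0.
      recent  : ∀ j → gm j ≤ suc i
      queue   : Queue gt gh l
      count   : c ≡ length l
      fail    : Flag (b ≡ true) f

  record Side (a : Arrays) (k : Bool) (i : ℕ) (l : List V²) (b : Bool) : Set where
    constructor side
    field rep : SideRep (a tMark k) (a tTail k) (a tHead k) (a tCount k 0) (a tFail k 0) i l b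
    open SideRep rep public

  side-fresh : ∀ {gm gt gh c f i l b} p q → SideRep gm gt gh c f i l b →
               SideRep (write gm (idx (p , q)) (suc i)) (write gt c (toℕ p)) (write gh c (toℕ q)) (suc c) f i ((p , q) ∷ l) b
  side-fresh {gm} {gt} {gh} {c} {f} {i} {l} p q s = record
    { marks = mk
    ; recent = rc
    ; queue = subst (λ c → Queue (write gt c (toℕ p)) (write gh c (toℕ q)) ((p , q) ∷ l)) (sym count)
        ((write-hit gt (length l) _ , write-hit gh (length l) _) ∷ queue-write (length l) _ _ ≤-refl queue)
    ; count = cong suc count
    ; fail = fail }
    where
    open SideRep s
    mk : ∀ x → Flag (x ∈ (p , q) ∷ l) (write gm (idx (p , q)) (suc i) (idx x) ∸ i)
    mk x with idx (p , q) ≟ idx x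
    ... | yes e with idx-injective (p , q) x e
    ...   | refl rewrite write-hit gm (idx (p , q)) (suc i) | m+n∸n≡m 1 i = on (here refl)
    mk x | no ne rewrite write-miss gm (idx (p , q)) (suc i) (idx x) ne =
      flag-map there (λ { (here refl) → ⊥-elim (ne refl) ; (there z) → z }) (marks x)
    rc : ∀ j → write gm (idx (p , q)) (suc i) j ≤ suc i
    rc j with idx (p , q) ≟ j
    ... | yes refl rewrite write-hit gm (idx (p , q)) (suc i) = ≤-refl
    ... | no ne rewrite write-miss gm (idx (p , q)) (suc i) j ne = recent j

  side-fail : ∀ {gm gt gh c f i l b x} → SideRep gm gt gh c f i l b → SideRep gm gt gh c (suc x) i l true
  side-fail s = record { SideRep s ; fail = on refl }

  side-frame : ∀ {a a′ k i l b} → Agree (sideCells k) a a′ → Side a k i l b → Side a′ k i l b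
  side-frame (e₁ ∷ e₂ ∷ e₃ ∷ e₄ ∷ e₅ ∷ []) (side s) = side (move e₁ e₂ e₃ (cong (λ g → g 0) e₄) (cong (λ g → g 0) e₅) s)
    where
    move : ∀ {gm gt gh c f gm′ gt′ gh′ c′ f′ i l b} → gm′ ≡ gm → gt′ ≡ gt → gh′ ≡ gh → c′ ≡ c → f′ ≡ f →
           SideRep gm gt gh c f i l b → SideRep gm′ gt′ gh′ c′ f′ i l b
    move refl refl refl refl refl s = s

  record Tables (a : Arrays) : Set where
    field
      rowOf  : ∀ (p : Fin n) → a tRow false (toℕ p) ≡ toℕ p * n
      labOf  : ∀ p q → a tLab false (idx (p , q)) ≡ lab p q
      edgeOf : ∀ {j x} → Nth es j x → a tSrc false j ≡ toℕ (proj₁ x) × a tTgt false j ≡ toℕ (proj₂ x)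

  tables-frame : ∀ {a a′} → Agree tableCells a a′ → Tables a → Tables a′
  tables-frame (e₁ ∷ e₂ ∷ e₃ ∷ e₄ ∷ []) t = record
    { rowOf = λ p → trans (cong (λ g → g (toℕ p)) e₁) (Tables.rowOf t p)
    ; labOf = λ p q → trans (cong (λ g → g (idx (p , q))) e₂) (Tables.labOf t p q)
    ; edgeOf = λ {j} x → trans (cong (λ g → g j) e₃) (proj₁ (Tables.edgeOf t x))
                       , trans (cong (λ g → g j) e₄) (proj₂ (Tables.edgeOf t x)) }

  record Base (a : Arrays) (A : List V²) (i : ℕ) : Set where
    field
      tables : Tables a
      member : Member (a tSet false) A
      index  : a tI false 0 ≡ i
    open Tables tables public

  base-frame : ∀ {a a′ A i} → Agree baseCells a a′ → Base a A i → Base a′ A i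
  base-frame (e₁ ∷ e₂ ∷ es) b = record
    { tables = tables-frame es (Base.tables b)
    ; member = λ x → subst (λ g → Flag (x ∈ _) (g (idx x))) (sym e₁) (Base.member b x)
    ; index = trans (cong (λ g → g 0) e₂) (Base.index b) }

  Holds : Arrays → ℕ → Fin n → Set
  Holds a t p = a t false 0 ≡ toℕ p

  at-value : ∀ {a A i tx ty p q} → Base a A i → Holds a tx p → Holds a ty q → ⟦ at tx ty ⟧e a ≡ idx (p , q)
  at-value {a} {p = p} b e f = cong₂ _+_ (trans (cong (a tRow false) e) (Base.rowOf b p)) f

  lab-value : ∀ {a A i tx ty p q} → Base a A i → Holds a tx p → Holds a ty q → ⟦ labE tx ty ⟧e a ≡ lab p q
  lab-value {a} {tx = tx} {ty} {p} {q} b e f =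
    trans (cong (a tLab false) (at-value {tx = tx} {ty} b e f)) (Base.labOf b p q)

  set-flag : ∀ {a A i tx ty p q} → Base a A i → Holds a tx p → Holds a ty q → Flag ((p , q) ∈ A) (⟦ inSet tx ty ⟧e a)
  set-flag {a} {A} {tx = tx} {ty} {p} {q} b e f =
    subst (λ j → Flag ((p , q) ∈ A) (a tSet false j)) (sym (at-value {tx = tx} {ty} b e f)) (Base.member b (p , q))

  known-flag : ∀ {a A i k l f tx ty p q} → Base a A i → Side a k i l f → Holds a tx p → Holds a ty q →
               Flag ((p , q) ∈ l ++ A) (⟦ known? k tx ty ⟧e a)
  known-flag {a} {A} {i} {k} {l} {f} {tx} {ty} {p} {q} b s e g =
    flag-map [ ∈-++⁺ʳ l , ∈-++⁺ˡ ]′ (λ x → [ inj₂ , inj₁ ]′ (∈-++⁻ l x))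
      (flag-+ (set-flag {tx = tx} {ty} b e g)
        (subst₂ (λ j i → Flag ((p , q) ∈ l) (a tMark k j ∸ i)) (sym (at-value {tx = tx} {ty} b e g)) (sym (Base.index b))
          (Side.marks s (p , q))))

  record Quad : Set where
    constructor quad
    field
      gm gt gh : ℕ → ℕ
      c        : ℕ

  mark-side° : ∀ k {σ A i l f p q} → Base (arr σ) A i → Side (arr σ) k i l f →
              Holds (arr σ) tX p → Holds (arr σ) tY q → Side (arr (run (mark° k) σ)) k i ((p , q) ∷ l) f
  mark-side° k {σ} {A} {i} {l} {f} {p} {q} b (side s) e g =
    side (subst (λ z → R z (arr (run (mark° k) σ) tFail k 0)) (sym effect) (subst (R target) (sym (fl k)) (side-fresh p q s)))
    where
    a = arr σ
    R : Quad → ℕ → Set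
    R (quad gm gt gh c) x = SideRep gm gt gh c x i ((p , q) ∷ l) f
    target : Quad
    target = quad (write (a tMark k) (idx (p , q)) (suc i)) (write (a tTail k) (a tCount k 0) (toℕ p))
                  (write (a tHead k) (a tCount k 0) (toℕ q)) (suc (a tCount k 0))
    after : Bool → Quad
    after k = quad (a′ tMark k) (a′ tTail k) (a′ tHead k) (a′ tCount k 0)
      where a′ = arr (run (mark° k) σ)
    fl : ∀ k → arr (run (mark° k) σ) tFail k 0 ≡ a tFail k 0
    fl false = refl
    fl true = refl
    raw : ∀ k → after k ≡
      quad (write (a tMark k) (⟦ at tX tY ⟧e a) (a tI false 0 + 1)) (write (a tTail k) (a tCount k 0) (a tX false 0))
           (write (a tHead k) (a tCount k 0) (a tY false 0)) (a tCount k 0 + 1)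
    raw false = refl
    raw true = refl
    same : ∀ {j j′ w w′ u u′ x x′ c c′ : ℕ} → j ≡ j′ → w ≡ w′ → u ≡ u′ → x ≡ x′ → c ≡ c′ →
      quad (write (a tMark k) j w) (write (a tTail k) (a tCount k 0) u) (write (a tHead k) (a tCount k 0) x) c ≡
      quad (write (a tMark k) j′ w′) (write (a tTail k) (a tCount k 0) u′) (write (a tHead k) (a tCount k 0) x′) c′
    same refl refl refl refl refl = refl
    effect : after k ≡ target
    effect = trans (raw k) (same (at-value {tx = tX} {tY} b e g) (trans (+-comm _ 1) (cong suc (Base.index b))) e g (+-comm _ 1))

  mark-side : ∀ k {σ A i l f p q} → Base (arr σ) A i → Side (arr σ) k i l f →
              Holds (arr σ) tX p → Holds (arr σ) tY q → Side (arr (run (mark k) σ)) k i ((p , q) ∷ l) f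
  mark-side k {σ} {A} {i} {l} {f} {p} {q} b s e g =
    subst (λ c → Side (arr (run c σ)) k i ((p , q) ∷ l) f) (sym (mark≡ k)) (mark-side° k {σ} b s e g)

  Pushed : Bool → List V² → ℕ → V² → List V² → Bool → Store → Set
  Pushed k A i x l f τ = Σ[ l′ ∈ List V² ] Σ[ f′ ∈ Bool ] (Side (arr τ) k i l′ f′ × Push A x l f l′ f′)

  push-spec : ∀ k {σ A i l f p q} → Base (arr σ) A i → Side (arr σ) k i l f →
              Holds (arr σ) tX p → Holds (arr σ) tY q → Pushed k A i (p , q) l f (run (push k) σ)
  push-spec k {σ} {A} {i} {l} {f} {p} {q} b s e g = subst (λ c → Q (run c σ)) (sym (push≡ k)) (
    cond-spec Q (known? k tX tY) skip (cond (known? k tY tX) bad (mark k)) σ (known-flag {tx = tX} {tY} b s e g) (λ z → l , f , s , known z)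
      λ ¬z → cond-spec Q (known? k tY tX) bad (mark k) σ (known-flag {tx = tY} {tX} b s g e)
        (λ z → l , true , failed k s , clash z)
        (λ ¬z′ → (p , q) ∷ l , f , mark-side k {σ} b s e g , fresh ¬z ¬z′))
    where
    Q = Pushed k A i (p , q) l f
    bad = put tFail k (con 0) (con 1)
    failed : ∀ k → Side (arr σ) k i l f → Side (arr (run (put tFail k (con 0) (con 1)) σ)) k i l true
    failed false (side s) = side (side-fail s)
    failed true (side s) = side (side-fail s)

  record Step (k : Bool) (A : List V²) (i : ℕ) (l : List V²) (f : Bool) (R : List V² → Bool → Set)
              (τ : Store) : Set₁ where
    constructor stepped
    field
      {l′}   : List V²
      {f′}   : Bool
      status  : Side (arr τ) k i l′ f′
      growth : Grow A l f l′ f′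
      result : R l′ f′

  stay : ∀ {k A i l f R} τ → Side (arr τ) k i l f → R l f → Step k A i l f R τ
  stay τ s r = stepped s (grow-refl _) r

  -- The first premise keeps the second end from being overwritten, since `tX` is assigned before
  -- `v ty` is read.
  pushArc-raw : ∀ k tx ty {σ A i l f p q} → (tX ≡ᵇ ty) ∧ true ≡ false →
                Base (arr σ) A i → Side (arr σ) k i l f →
                Holds (arr σ) tx p → Holds (arr σ) ty q → Pushed k A i (p , q) l f (run (pushArc k tx ty) σ)
  pushArc-raw k tx ty {σ} {A} {i} {l} {f} {p} {q} e b s hx hy =
    subst (λ c → Pushed k A i (p , q) l f (run c σ)) (sym (pushArc≡ k tx ty))
      (push-spec k {σ₂} {p = p} {q} b₂ s₂ hx (trans (cong (λ g → g 0) (frame setX {ty} {false} σ e)) hy))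
    where
    setX = tX := v tx
    setY = tY := v ty
    σ₁ = run setX σ
    σ₂ = run setY σ₁
    b₂ = base-frame (agree setY baseCells σ₁ refl) (base-frame (agree setX baseCells σ refl) b)
    s₂ = side-frame {k = k} (agree setY (sideCells k) σ₁ refl) (side-frame {k = k} (agree setX (sideCells k) σ refl) s)

  pushArc-spec : ∀ k tx ty {σ A i l f p q} → (tX ≡ᵇ ty) ∧ true ≡ false →
                 Base (arr σ) A i → Side (arr σ) k i l f →
                 Holds (arr σ) tx p → Holds (arr σ) ty q → IsEdge (p , q) → Forced A l (p , q) →
                 Step k A i l f (Handled A (p , q)) (run (pushArc k tx ty) σ)
  pushArc-spec k tx ty {σ} {A} e b s hx hy ed fo with pushArc-raw k tx ty {σ} e b s hx hy
  ... | l′ , f′ , s′ , ps = stepped s′ (push-grow A ed fo ps) (push-handled A ps)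

  record Ctx (a : Arrays) (A : List V²) (i : ℕ) (p q r : Fin n) : Set where
    field
      base : Base a A i
      isA  : Holds a tA p
      isB  : Holds a tB q
      isC  : Holds a tC r

  ctx-frame : ∀ {a a′ A i p q r} → Agree ctxCells a a′ → Ctx a A i p q r → Ctx a′ A i p q r
  ctx-frame (e₁ ∷ e₂ ∷ e₃ ∷ es) c = record
    { base = base-frame es (Ctx.base c)
    ; isA = trans (cong (λ g → g 0) e₁) (Ctx.isA c)
    ; isB = trans (cong (λ g → g 0) e₂) (Ctx.isB c)
    ; isC = trans (cong (λ g → g 0) e₃) (Ctx.isC c) }

  module Sweep (k : Bool) {A : List V²} {i : ℕ} {p q r : Fin n} (pos : 0 < lab p q) where

    byHead-spec : ∀ {σ l f} → Ctx (arr σ) A i p q r → Side (arr σ) k i l f → (p , q) ∈ l ++ A →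
      Step k A i l f (λ l′ f′ → lab p q ≤ lab q r → lab p r < lab q r → Handled A (r , q) l′ f′) (run (byHead k) σ)
    byHead-spec {σ} {l} {f} c s pq = subst (λ c → Q (run c σ)) (sym (byHead≡ k)) (
      cond-spec Q (con 1 ⊕ labE tB tC ⊖ labE tA tB) inner skip σ
        (subst₂ (λ x y → Flag (lab p q < suc (lab q r)) (suc x ∸ y)) (sym bc) (sym ab) (flag-∸ (suc (lab q r)) (lab p q)))
        (λ le → cond-spec Q (labE tB tC ⊖ labE tA tC) (pushArc k tC tB) skip σ
          (subst₂ (λ x y → Flag (lab p r < lab q r) (x ∸ y)) (sym bc) (sym ac) (flag-∸ (lab q r) (lab p r)))
          (λ lt → widen (pushArc-spec k tC tB {σ} refl base s isC isB
                           (subst (0 <_) (lab-sym q r) (≤-<-trans z≤n lt))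
                           (λ cl inc → Closed.head cl (inc pq) (≤-pred le) lt)))
          (λ ¬lt → stay σ s λ _ lt → ⊥-elim (¬lt lt)))
        (λ ¬le → stay σ s λ le _ → ⊥-elim (¬le (s≤s le))))
      where
      open Ctx c
      inner = cond (labE tB tC ⊖ labE tA tC) (pushArc k tC tB) skip
      Q : Store → Set₁
      Q = Step k A i l f (λ l′ f′ → lab p q ≤ lab q r → lab p r < lab q r → Handled A (r , q) l′ f′)
      widen : ∀ {τ} → Step k A i l f (Handled A (r , q)) τ → Q τ
      widen (stepped s g h) = stepped s g λ _ _ → h
      ab = lab-value {tx = tA} {tB} base isA isB
      bc = lab-value {tx = tB} {tC} base isB isC
      ac = lab-value {tx = tA} {tC} base isA isC

    byTail-spec : ∀ {σ l f} → Ctx (arr σ) A i p q r → Side (arr σ) k i l f → (p , q) ∈ l ++ A →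
      Step k A i l f (λ l′ f′ → 0 < lab p r → lab p r ≤ lab p q → lab r q < lab p q → Handled A (p , r) l′ f′)
        (run (byTail k) σ)
    byTail-spec {σ} {l} {f} c s pq = subst (λ c → Q (run c σ)) (sym (byTail≡ k)) (
      cond-spec Q (labE tA tC) inner skip σ
        (subst (Flag (0 < lab p r)) (sym ac) (flag-pos (lab p r)))
        (λ 0< → cond-spec Q (con 1 ⊕ labE tA tB ⊖ labE tA tC) inner′ skip σ
          (subst₂ (λ x y → Flag (lab p r < suc (lab p q)) (suc x ∸ y)) (sym ab) (sym ac) (flag-∸ (suc (lab p q)) (lab p r)))
          (λ le → cond-spec Q (labE tA tB ⊖ labE tB tC) (pushArc k tA tC) skip σ
            (subst₂ (λ x y → Flag (lab q r < lab p q) (x ∸ y)) (sym ab) (sym bc) (flag-∸ (lab p q) (lab q r)))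
            (λ lt → widen (pushArc-spec k tA tC {σ} refl base s isA isC 0<
                             (λ cl inc → Closed.tail cl (inc pq) 0< (≤-pred le) (subst (_< lab p q) (lab-sym q r) lt))))
            (λ ¬lt → stay σ s λ _ _ lt → ⊥-elim (¬lt (subst (_< lab p q) (lab-sym r q) lt))))
          (λ ¬le → stay σ s λ _ le _ → ⊥-elim (¬le (s≤s le))))
        (λ ¬0< → stay σ s λ 0< _ _ → ⊥-elim (¬0< 0<)))
      where
      open Ctx c
      inner′ = cond (labE tA tB ⊖ labE tB tC) (pushArc k tA tC) skip
      inner = cond (con 1 ⊕ labE tA tB ⊖ labE tA tC) inner′ skip
      Q : Store → Set₁
      Q = Step k A i l f (λ l′ f′ → 0 < lab p r → lab p r ≤ lab p q → lab r q < lab p q → Handled A (p , r) l′ f′)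
      widen : ∀ {τ} → Step k A i l f (Handled A (p , r)) τ → Q τ
      widen (stepped s g h) = stepped s g λ _ _ _ → h
      ab = lab-value {tx = tA} {tB} base isA isB
      bc = lab-value {tx = tB} {tC} base isB isC
      ac = lab-value {tx = tA} {tC} base isA isC

    MonoDone : List V² → List V² → Bool → Set
    MonoDone d l f = ((q , r) ∈ d ++ A → lab p q ≡ lab q r → lab q r ≡ lab p r → Handled A (p , r) l f)
                   × ((r , p) ∈ d ++ A → lab r p ≡ lab p q → lab p q ≡ lab r q → Handled A (r , q) l f)

    byMono-spec : ∀ {σ l f} → Ctx (arr σ) A i p q r → Side (arr σ) k i l f → (p , q) ∈ l ++ A →
                  Step k A i l f (MonoDone l) (run (byMono k) σ)
    byMono-spec {σ} {l} {f} c s pq = subst (λ c → Step k A i l f (MonoDone l) (run c σ)) (sym (byMono≡ k)) (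
      cond-spec (Step k A i l f (MonoDone l)) test skip (right ⨾ left) σ
        (subst (Flag (lab p q ≢ lab q r ⊎ lab q r ≢ lab p r)) (sym value) (flag-+ (flag-≢ (lab p q) (lab q r)) (flag-≢ (lab q r) (lab p r))))
        (λ ne → stay σ s ( (λ _ e e′ → ⊥-elim (differ ne e e′))
                         , (λ _ e e′ → ⊥-elim (differ ne (trans e′ (lab-sym r q)) (trans (lab-sym q r) (trans (sym e′) (trans (sym e) (lab-sym r p))))))))
        (λ same → both same (first-part same)))
      where
      open Ctx c
      test = (labE tA tB ⊖ labE tB tC) ⊕ (labE tB tC ⊖ labE tA tB) ⊕ ((labE tB tC ⊖ labE tA tC) ⊕ (labE tA tC ⊖ labE tB tC))
      right = cond (known? k tB tC) (pushArc k tA tC) skip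
      left = cond (known? k tC tA) (pushArc k tC tB) skip
      ab = lab-value {tx = tA} {tB} base isA isB
      bc = lab-value {tx = tB} {tC} base isB isC
      ac = lab-value {tx = tA} {tC} base isA isC
      value : ⟦ test ⟧e (arr σ) ≡ (lab p q ∸ lab q r) + (lab q r ∸ lab p q) + ((lab q r ∸ lab p r) + (lab p r ∸ lab q r))
      value = cong₂ _+_ (cong₂ _+_ (cong₂ _∸_ ab bc) (cong₂ _∸_ bc ab)) (cong₂ _+_ (cong₂ _∸_ bc ac) (cong₂ _∸_ ac bc))
      differ : lab p q ≢ lab q r ⊎ lab q r ≢ lab p r → lab p q ≡ lab q r → lab q r ≡ lab p r → ⊥
      differ (inj₁ ne) e _ = ne e
      differ (inj₂ ne) _ e = ne e
      Same = ¬ (lab p q ≢ lab q r ⊎ lab q r ≢ lab p r)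
      eqs : Same → lab p q ≡ lab q r × lab q r ≡ lab p r
      eqs same with lab p q ≟ lab q r | lab q r ≟ lab p r
      ... | yes e | yes e′ = e , e′
      ... | no ne | _ = ⊥-elim (same (inj₁ ne))
      ... | yes _ | no ne = ⊥-elim (same (inj₂ ne))
      RightDone : List V² → Bool → Set
      RightDone l′ f′ = (q , r) ∈ l ++ A → Handled A (p , r) l′ f′
      first-part : Same → Step k A i l f RightDone (run right σ)
      first-part same =
        cond-spec (Step k A i l f RightDone) (known? k tB tC) (pushArc k tA tC) skip σ
          (known-flag {k = k} {tx = tB} {tC} base s isB isC)
          (λ z → widenʳ (pushArc-spec k tA tC {σ} refl base s isA isC (subst (0 <_) (trans e e′) pos)
                           (λ cl inc → Closed.mono cl (inc pq) (inc z) e e′)))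
          (λ ¬z → stay σ s λ z → ⊥-elim (¬z z))
        where
        e = proj₁ (eqs same)
        e′ = proj₂ (eqs same)
        widenʳ : ∀ {τ} → Step k A i l f (Handled A (p , r)) τ → Step k A i l f RightDone τ
        widenʳ (stepped s g h) = stepped s g λ _ → h
      both : Same → Step k A i l f RightDone (run right σ) → Step k A i l f (MonoDone l) (run left (run right σ))
      both same (stepped {l₁} {f₁} s₁ g₁ h₁) =
        cond-spec (Step k A i l f (MonoDone l)) (known? k tC tA) (pushArc k tC tB) skip σ₁
          (known-flag {k = k} {tx = tC} {tA} (Ctx.base c₁) s₁ (Ctx.isC c₁) (Ctx.isA c₁))
          (λ z → widenˡ (pushArc-spec k tC tB {σ₁} refl (Ctx.base c₁) s₁ (Ctx.isC c₁) (Ctx.isB c₁)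
                           (subst (0 <_) (trans e (lab-sym q r)) pos)
                           (λ cl inc → Closed.mono cl (inc z) (inc (grow-∈ A g₁ pq))
                              (trans (lab-sym r p) (trans (sym e′) (sym e))) (trans e (lab-sym q r)))))
          (λ ¬z → stepped s₁ g₁ ((λ z _ _ → h₁ z) , (λ z _ _ → ⊥-elim (¬z (grow-∈ A g₁ z)))))
        where
        e = proj₁ (eqs same)
        e′ = proj₂ (eqs same)
        widenˡ : ∀ {τ} → Step k A i l₁ f₁ (Handled A (r , q)) τ → Step k A i l f (MonoDone l) τ
        widenˡ (stepped s₂ g₂ h₂) =
          stepped s₂ (grow-trans A g₁ g₂) ((λ z′ _ _ → grow-handled A g₂ (h₁ z′)) , (λ _ _ _ → h₂))
        σ₁ = run right σ
        c₁ : Ctx (arr σ₁) A i p q r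
        c₁ = ctx-frame (agree right ctxCells σ (right-untouched k)) c

    -- The list `l₀` is the closure as it was before the whole loop over the vertices. Arcs pushed
    -- during the loop may come too late for vertices already passed; they are confronted with this
    -- arc when their own turn comes.
    sweep-spec : ∀ {σ l₀ l f} → Ctx (arr σ) A i p q r → Side (arr σ) k i l f → (p , q) ∈ l ++ A →
                 (∀ {x} → x ∈ l₀ ++ A → x ∈ l ++ A) →
                 Step k A i l f (λ l′ f′ → Swept A l₀ l′ f′ p q r) (run (sweep k) σ)
    sweep-spec {σ} {l₀} {l} {f} c s pq incl =
      subst (λ c → Q (run c σ)) (sym (sweep≡ k)) (combine (byHead-spec {σ} c s pq))
      where
      σ₁ = run (byHead k) σ
      σ₂ = run (byTail k) σ₁
      σ₃ = run (byMono k) σ₂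
      last = tC := v tC ⊕ con 1
      Q : Store → Set₁
      Q = Step k A i l f (λ l′ f′ → Swept A l₀ l′ f′ p q r)
      c₁ : Ctx (arr σ₁) A i p q r
      c₁ = ctx-frame (agree (byHead k) ctxCells σ (byHead-untouched k)) c
      c₂ : Ctx (arr σ₂) A i p q r
      c₂ = ctx-frame (agree (byTail k) ctxCells σ₁ (byTail-untouched k)) c₁
      combine : Step k A i l f (λ l′ f′ → lab p q ≤ lab q r → lab p r < lab q r → Handled A (r , q) l′ f′) σ₁ →
                Q (run last σ₃)
      combine (stepped {l₁} {f₁} s₁ g₁ h₁) = combine₂ (byTail-spec {σ₁} c₁ s₁ (grow-∈ A g₁ pq))
        where
        combine₂ : Step k A i l₁ f₁ (λ l′ f′ → 0 < lab p r → lab p r ≤ lab p q → lab r q < lab p q → Handled A (p , r) l′ f′) σ₂ →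
                   Q (run last σ₃)
        combine₂ (stepped {l₂} {f₂} s₂ g₂ h₂) = combine₃ (byMono-spec {σ₂} c₂ s₂ (grow-∈ A g₁₂ pq))
          where
          g₁₂ = grow-trans A g₁ g₂
          combine₃ : Step k A i l₂ f₂ (MonoDone l₂) σ₃ → Q (run last σ₃)
          combine₃ (stepped {l₃} {f₃} s₃ g₃ (h₃ , h₄)) =
            stepped (side-frame {k = k} (agree last (sideCells k) σ₃ refl) s₃) (grow-trans A g₁₂ g₃) record
              { by-head = λ x y → grow-handled A (grow-trans A g₂ g₃) (h₁ x y)
              ; by-tail = λ x y z → grow-handled A g₃ (h₂ x y z)
              ; monoʳ = λ z → h₃ (grow-∈ A g₁₂ (incl z))
              ; monoˡ = λ z → h₄ (grow-∈ A g₁₂ (incl z)) }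

  queue-lookup : ∀ {gt gh p q} u d → Queue gt gh (u ++ (p , q) ∷ d) → gt (length d) ≡ toℕ p × gh (length d) ≡ toℕ q
  queue-lookup [] d (e ∷ _) = e
  queue-lookup (_ ∷ u) d (_ ∷ es) = queue-lookup u d es

  counter-sweep : ∀ k σ → arr (run (sweep k) σ) tC false 0 ≡ suc (arr σ tC false 0)
  counter-sweep k σ = trans (cong (λ c → arr (run c σ) tC false 0) (sweep≡ k))
    (trans (+-comm _ 1) (cong suc (kept (agree phases ctxCells σ (phases-untouched k)))))
    where
    phases = byHead k ⨾ byTail k ⨾ byMono k
    kept : ∀ {a a′} → Agree ctxCells a a′ → a′ tC false 0 ≡ a tC false 0
    kept (_ ∷ _ ∷ e ∷ _) = cong (λ g → g 0) e

  module Process (k : Bool) {A : List V²} {i : ℕ} {p q : Fin n} (pos : 0 < lab p q) where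

    record Swept< (j : ℕ) (l₀ : List V²) (f₀ : Bool) (τ : Store) : Set₁ where
      field
        {l}    : List V²
        {f}    : Bool
        base   : Base (arr τ) A i
        isA    : Holds (arr τ) tA p
        isB    : Holds (arr τ) tB q
        isC    : arr τ tC false 0 ≡ j
        status  : Side (arr τ) k i l f
        growth : Grow A l₀ f₀ l f
        swept  : ∀ r → toℕ r < j → Swept A l₀ l f p q r

    sweep-one : ∀ {j l₀ f₀ σ} → (p , q) ∈ l₀ ++ A → j < n → Swept< j l₀ f₀ σ → Swept< (suc j) l₀ f₀ (run (sweep k) σ)
    sweep-one {j} {l₀} {f₀} {σ} pq j<n w = onward (Sweep.sweep-spec k {r = r} pos {σ} c status (grow-∈ A growth pq) (grow-∈ A growth))
      where
      open Swept< w
      r = fromℕ< j<n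
      c : Ctx (arr σ) A i p q r
      c = record { base = base ; isA = isA ; isB = isB ; isC = trans isC (sym (Fin.toℕ-fromℕ< j<n)) }
      onward : Step k A i l f (λ l′ f′ → Swept A l₀ l′ f′ p q r) (run (sweep k) σ) → Swept< (suc j) l₀ f₀ (run (sweep k) σ)
      onward (stepped {l′} {f′} s g h) with agree (sweep k) ((tA , false) ∷ (tB , false) ∷ baseCells) σ (sweep-untouched k)
      ... | eA ∷ eB ∷ eBase = record
        { base = base-frame eBase base
        ; isA = trans (cong (λ g → g 0) eA) isA
        ; isB = trans (cong (λ g → g 0) eB) isB
        ; isC = trans (counter-sweep k σ) (cong suc isC)
        ; status = s ; growth = grow-trans A growth g ; swept = all }
        where
        all : ∀ r → toℕ r < suc j → Swept A l₀ l′ f′ p q r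
        all r′ lt with m≤n⇒m<n∨m≡n (≤-pred lt)
        ... | inj₁ lt′ = swept-grow A g (swept r′ lt′)
        ... | inj₂ e rewrite Fin.toℕ-injective {i = r′} {j = r} (trans e (sym (Fin.toℕ-fromℕ< j<n))) = h

    sweeps : ∀ c {j l₀ f₀ σ} → (p , q) ∈ l₀ ++ A → c + j ≡ n → Swept< j l₀ f₀ σ → Swept< n l₀ f₀ (iter c (run (sweep k)) σ)
    sweeps zero pq refl w = w
    sweeps (suc c) {j} {σ = σ} pq e w =
      sweeps c {σ = run (sweep k) σ} pq (trans (+-suc c j) e) (sweep-one {σ = σ} pq (≤-trans (s≤s (m≤n+m j c)) (≤-reflexive e)) w)

  record Trial (a : Arrays) (k : Bool) (A : List V²) (i : ℕ) (z : V²) (l d : List V²) (f : Bool) : Set₁ where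
    field
      status   : Side a k i l f
      good    : Good A z l f
      swept   : Done A d l f
      pending : Σ[ u ∈ List V² ] l ≡ u ++ d
      counted : a tDone k 0 ≡ length d
      seeded  : z ∈ l

  record Processed (k : Bool) (A : List V²) (i : ℕ) (z : V²) (d : List V²) (f : Bool) (τ : Store) : Set₁ where
    field
      {l′ d′} : List V²
      {f′}    : Bool
      base    : Base (arr τ) A i
      onTrial : Trial (arr τ) k A i z l′ d′ f′
      advance : f ≡ false → length d′ ≡ suc (length d)
      failed  : f ≡ true → f′ ≡ true

  -- Because of the reversed order, the arc stored at position `length d`, which is processed next,
  -- is the last one of the unprocessed part.
  last-pending : ∀ {l d} → Σ[ u ∈ List V² ] l ≡ u ++ d → length d < length l →
                 Σ[ u ∈ List V² ] Σ[ x ∈ V² ] l ≡ u ++ x ∷ d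
  last-pending {d = d} (u , e) lt with initLast u
  last-pending {d = d} (.[] , refl) lt | [] = ⊥-elim (<-irrefl refl lt)
  last-pending {d = d} (.(u ∷ʳ x) , e) lt | u ∷ʳ′ x = u , x , trans e (++-assoc u (x ∷ []) d)

  process-spec : ∀ k {σ A i z l d f} → Base (arr σ) A i → Trial (arr σ) k A i z l d f →
                 (f ≡ false → length d < length l) → Processed k A i z d f (run (process k) σ)
  process-spec k {σ} {A} {i} {z} {l} {d} {f} b t more =
    subst (λ c → Processed k A i z d f (run c σ)) (sym (process≡ k)) (
    cond-spec (Processed k A i z d f) (rd tFail k (con 0)) skip body σ (Side.fail status)
      (λ { refl → record { base = b ; onTrial = t ; advance = λ () ; failed = λ _ → refl } })
      (λ ¬f → work (notTrue ¬f) (last-pending pending (more (notTrue ¬f)))))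
    where
    open Trial t
    setA = tA := rd tTail k (rd tDone k (con 0))
    setB = tB := rd tHead k (rd tDone k (con 0))
    setC = tC := con 0
    sweepAll = loop byN (sweep k)
    bump = put tDone k (con 0) (rd tDone k (con 0) ⊕ con 1)
    body = setA ⨾ setB ⨾ setC ⨾ sweepAll ⨾ bump
    setABC = setA ⨾ setB ⨾ setC
    σ₁ = run setABC σ
    σ₂ = run sweepAll σ₁
    σ₃ = run bump σ₂
    notTrue : ∀ {f} → ¬ f ≡ true → f ≡ false
    notTrue {false} _ = refl
    notTrue {true} ¬e = ⊥-elim (¬e refl)
    bumped : ∀ k τ → arr (run (put tDone k (con 0) (rd tDone k (con 0) ⊕ con 1)) τ) tDone k 0 ≡ arr τ tDone k 0 + 1
    bumped false τ = refl
    bumped true τ = refl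
    work : f ≡ false → Σ[ u ∈ List V² ] Σ[ x ∈ V² ] l ≡ u ++ x ∷ d → Processed k A i z d f (run body σ)
    work f≡ (u , (p , q) , refl) = finish (Process.sweeps k {A} {i} {p} {q} pos n {0} {l} {f} {σ₁} pq∈ (+-identityʳ n) initial)
      where
      pq∈l : (p , q) ∈ u ++ (p , q) ∷ d
      pq∈l = ∈-++⁺ʳ u (here refl)
      pq∈ = ∈-++⁺ˡ {ys = A} pq∈l
      pos : 0 < lab p q
      pos = All.lookup (Good.edges good) pq∈
      entry = queue-lookup u d (Side.queue status)
      initial : Process.Swept< k {A} {i} {p} {q} pos 0 l f σ₁
      initial = record
        { base = base-frame (agree setABC baseCells σ refl) b
        ; isA = trans (cong (arr σ tTail k) counted) (proj₁ entry)
        ; isB = trans (cong (arr σ tHead k) counted) (proj₂ entry)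
        ; isC = refl
        ; status = side-frame {k = k} (agree setABC (sideCells k) σ refl) status
        ; growth = grow-refl A
        ; swept = λ _ () }
      finish : Process.Swept< k {A} {i} {p} {q} pos n l f σ₂ → Processed k A i z d f σ₃
      finish w = record
        { d′ = (p , q) ∷ d
        ; base = base-frame (agree bump baseCells σ₂ refl) base
        ; onTrial = record
            { status = side-frame {k = k} (agree bump (sideCells k) σ₂ refl) status′
            ; good = Grow.good growth good
            ; swept = done-extend A (λ x → ∈-++⁺ʳ u (there x)) pq∈l growth swept (λ r → swept′ r (Fin.toℕ<n r))
            ; pending = Grow.extra growth ++ u , trans (Grow.ext growth) (sym (++-assoc (Grow.extra growth) u _))
            ; counted = trans (bumped k σ₂) (trans (+-comm _ 1) (cong suc (trans kept counted)))
            ; seeded = grow-∈ˡ A growth seeded }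
        ; advance = λ _ → refl
        ; failed = λ e → ⊥-elim (contra (trans (sym e) f≡)) }
        where
        open Process.Swept< w renaming (status to status′; swept to swept′)
        contra : true ≡ false → ⊥
        contra ()
        kept : arr σ₂ tDone k 0 ≡ arr σ tDone k 0
        kept = cong (λ g → g 0) (frame (setABC ⨾ sweepAll) {tDone} {k} σ (sweep-keeps k))

-- The state machine and its invariant.

module Machine {n : ℕ} (lab : Fin n → Fin n → ℕ) (lab-sym : ∀ a b → lab a b ≡ lab b a)
            (lab-loop : ∀ a → lab a a ≡ 0) (es : List (Fin n × Fin n))
            (es-edges : ∀ {x} → x ∈ es → 0 < lab (proj₁ x) (proj₂ x))
            (es-covers : ∀ {a b} → 0 < lab a b → (a , b) ∈ es ⊎ (b , a) ∈ es) where
  open Simulation lab lab-sym lab-loop es public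

  apart-sym : ∀ {x y} → Apart x y → Apart y x
  apart-sym (p , q) = (λ e → p (sym e)) , (λ e → q (sym (cong swap e)))

  apart-lookup : ∀ {xs} → AllPairs Apart xs → ∀ i j → i ≢ j → Apart (lookup xs i) (lookup xs j)
  apart-lookup (p ∷ ps) Fin.zero Fin.zero ne = ⊥-elim (ne refl)
  apart-lookup (p ∷ ps) Fin.zero (Fin.suc j) ne = All.lookup p (∈-lookup j)
  apart-lookup (p ∷ ps) (Fin.suc i) Fin.zero ne = apart-sym (All.lookup p (∈-lookup i))
  apart-lookup (p ∷ ps) (Fin.suc i) (Fin.suc j) ne = apart-lookup ps i j (λ e → ne (cong Fin.suc e))

  -- Each arc chooses the position of its edge in `es`; arcs that are apart cannot choose the same
  -- position.
  apart-length : ∀ {xs} → AllPairs Apart xs → All IsEdge xs → length xs ≤ m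
  apart-length {xs} ap ed = Fin.injective⇒≤ {f = λ i → proj₁ (cover i)} inj
    where
    cover : ∀ i → Σ[ e ∈ Fin m ] (lookup es e ≡ lookup xs i ⊎ lookup es e ≡ swap (lookup xs i))
    cover i with es-covers (All.lookup ed (∈-lookup i))
    ... | inj₁ x = Any.index x , inj₁ (sym (lookup-index x))
    ... | inj₂ x = Any.index x , inj₂ (sym (lookup-index x))
    disjoint : ∀ {x y e : V²} → Apart x y → e ≡ x ⊎ e ≡ swap x → e ≡ y ⊎ e ≡ swap y → ⊥
    disjoint (p , q) (inj₁ refl) (inj₁ e) = p e
    disjoint (p , q) (inj₁ refl) (inj₂ e) = q e
    disjoint (p , q) (inj₂ refl) (inj₁ e) = q (cong swap e)
    disjoint (p , q) (inj₂ refl) (inj₂ e) = p (cong swap e)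
    inj : ∀ {i j} → proj₁ (cover i) ≡ proj₁ (cover j) → i ≡ j
    inj {i} {j} e with i Fin.≟ j
    ... | yes eq = eq
    ... | no ne = ⊥-elim (disjoint (apart-lookup ap i j ne) (proj₂ (cover i))
                    (subst (λ z → lookup es z ≡ _ ⊎ lookup es z ≡ _) (sym e) (proj₂ (cover j))))

  allPairs-↭ : ∀ {xs ys} → xs ↭ ys → AllPairs Apart xs → AllPairs Apart ys
  allPairs-↭ _↭_.refl ps = ps
  allPairs-↭ (_↭_.prep _ s) (p ∷ ps) = All-resp-↭ s p ∷ allPairs-↭ s ps
  allPairs-↭ (_↭_.swap _ _ s) ((q ∷ p) ∷ r ∷ ps) = (apart-sym q ∷ All-resp-↭ s r) ∷ All-resp-↭ s p ∷ allPairs-↭ s ps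
  allPairs-↭ (_↭_.trans s t) ps = allPairs-↭ t (allPairs-↭ s ps)

  closed-resp : ∀ {xs ys} → (∀ {x} → x ∈ xs → x ∈ ys) → (∀ {x} → x ∈ ys → x ∈ xs) → Closed ⟪ xs ⟫ → Closed ⟪ ys ⟫
  closed-resp f g c = record
    { sound = λ x → Closed.sound c (g x)
    ; asym = λ x y → Closed.asym c (g x) (g y)
    ; head = λ x p q → f (Closed.head c (g x) p q)
    ; tail = λ x p q r → f (Closed.tail c (g x) p q r)
    ; mono = λ x y p q → f (Closed.mono c (g x) (g y) p q) }

  closed-edges : ∀ {xs} → Closed ⟪ xs ⟫ → All IsEdge xs
  closed-edges c = All.tabulate (Closed.sound c)

  nth : ∀ {A : Set} (xs : List A) {j} → j < length xs → Σ[ x ∈ A ] Nth xs j x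
  nth (x ∷ xs) {zero} _ = x , first
  nth (x ∷ xs) {suc j} (s≤s lt) with nth xs lt
  ... | y , p = y , later p

  nth-∈ : ∀ {A : Set} {xs : List A} {j x} → Nth xs j x → x ∈ xs
  nth-∈ first = here refl
  nth-∈ (later p) = there (nth-∈ p)

  nth-< : ∀ {A : Set} {xs : List A} {j x} → Nth xs j x → j < length xs
  nth-< first = s≤s z≤n
  nth-< (later p) = s≤s (nth-< p)

  nth-unique : ∀ {A : Set} {xs : List A} {j x y} → Nth xs j x → Nth xs j y → x ≡ y
  nth-unique first first = refl
  nth-unique (later p) (later q) = nth-unique p q

  _∈?_ : ∀ (x : V²) xs → Dec (x ∈ xs)
  _∈?_ = member? (≡-dec Fin._≟_ Fin._≟_)

  Assigned : List V² → V² → Set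
  Assigned A x = x ∈ A ⊎ swap x ∈ A

  record Core (A : List V²) (i : ℕ) : Set where
    field
      closed   : Closed ⟪ A ⟫
      distinct : AllPairs Apart A
      before   : ∀ {j x} → j < i → Nth es j x → Assigned A x

    size : length A ≤ m
    size = apart-length distinct (closed-edges closed)

  NoTTO : Set₁
  NoTTO = ∀ {T} → Decidable T → Closed T → Total T → ⊥

  record Control (a : Arrays) (mode : ℕ) : Set where
    field
      mode-is : a tMode false 0 ≡ mode
      not-bad : a tBad false 0 ≡ 0

  Stale : Arrays → ℕ → Set
  Stale a i = ∀ k p → a tMark k p ≤ i

  -- j counts the steps made so far: the bound in the field elapsed grows by at
  -- least one in every step, and it stays below 6 m as long as work is left.
  record Idle (j : ℕ) (a : Arrays) : Set where
    field
      {A}     : List V²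
      {i}     : ℕ
      base    : Base a A i
      control : Control a 0
      core    : Core A i
      stale   : Stale a i
      elapsed : i < m → j ≤ 2 * length A + 3 * i

  record Trying (j : ℕ) (a : Arrays) : Set₁ where
    field
      {A}     : List V²
      {i s}   : ℕ
      {z}     : V²
      {l₀ l₁ d₀ d₁} : List V²
      {f₀ f₁} : Bool
      base    : Base a A i
      control : Control a 1
      core    : Core A i
      edge    : Nth es i z
      try₀    : Trial a false A i z l₀ d₀ f₀
      try₁    : Trial a true A i (swap z) l₁ d₁ f₁
      pace₀   : f₀ ≡ false → length d₀ ≡ s
      pace₁   : f₁ ≡ false → length d₁ ≡ s
      -- The number `s` of rounds is charged to a closure even while it is unknown which side will
      -- be adopted, so it needs a bound of its own, valid also if the trial ends in a rejection.
      room    : s + length A ≤ m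
      elapsed : j ≤ 2 * length A + 3 * i + (1 + s)

  modeOf : Bool → ℕ
  modeOf false = 2
  modeOf true = 3

  -- During the transfer the committed part `A` alone need not be closed. Only `l ++ A` is, and
  -- moving an arc from `l` to `A` merely permutes it; `Core` is restored once `l` is empty.
  record Committing (k : Bool) (j : ℕ) (a : Arrays) : Set where
    field
      {A l}    : List V²
      {i}      : ℕ
      {z}      : V²
      base     : Base a A i
      control  : Control a (modeOf k)
      closed   : Closed ⟪ l ++ A ⟫
      distinct : AllPairs Apart (l ++ A)
      before   : ∀ {j x} → j < i → Nth es j x → Assigned A x
      edge     : Nth es i z
      chosen   : Assigned (l ++ A) z
      below    : i < m
      queue    : Queue (a tTail k) (a tHead k) l
      count    : a tCount k 0 ≡ length l
      recent   : Stale a (suc i)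
      elapsed  : j ≤ 2 * length A + 3 * i + (2 + length l)

  record Refuted (a : Arrays) : Set₁ where
    field
      bad   : a tBad false 0 ≡ 1
      noTTO : NoTTO

  data Inv (j : ℕ) (a : Arrays) : Set₁ where
    idling     : Idle j a → Inv j a
    trying     : Trying j a → Inv j a
    committing : ∀ k → Committing k j a → Inv j a
    refuted    : Refuted a → Inv j a

  cond-then : ∀ e s s′ σ {x} → ⟦ e ⟧e (arr σ) ≡ suc x → run (cond e s s′) σ ≡ run s σ
  cond-then e s s′ σ eq with ⟦ e ⟧e (arr σ) | eq
  ... | suc _ | _ = refl

  cond-else : ∀ e s s′ σ → ⟦ e ⟧e (arr σ) ≡ 0 → run (cond e s s′) σ ≡ run s′ σ
  cond-else e s s′ σ eq with ⟦ e ⟧e (arr σ) | eq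
  ... | zero | _ = refl

  afterwards : ∀ {A i x j} → Core A i → Nth es i x → Assigned A x → ∀ {y} → j < suc i → Nth es j y → Assigned A y
  afterwards {j = j} c e a lt y with m≤n⇒m<n∨m≡n (≤-pred lt)
  ... | inj₁ lt′ = Core.before c lt′ y
  ... | inj₂ refl rewrite nth-unique y e = a

  skip-bound : ∀ {j w i} → j ≤ w + 3 * i → suc j ≤ w + 3 * suc i
  skip-bound {j} {w} {i} le = ≤-trans (≤-trans (s≤s le) (m≤n+m _ 2)) (≤-reflexive (sym (skip-arith w i)))

  module _ {j : ℕ} where

    launch-spec : ∀ {σ A i z} → Base (arr σ) A i → Control (arr σ) 0 → Core A i → Stale (arr σ) i → i < m →
                 j ≤ 2 * length A + 3 * i → Nth es i z → z ∉ A → swap z ∉ A →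
                 Holds (arr σ) tA (proj₁ z) → Holds (arr σ) tB (proj₂ z) → Inv (suc j) (arr (run launch σ))
    launch-spec {σ} {A} {i} {z@(p , q)} b ct core st i<m el e z∉ z∉′ hA hB =
      subst (λ c → Inv (suc j) (arr (run c σ))) (sym launch≡) (first-push (pushArc-raw false tA tB {σ₁} refl b₁ (fresh-side false refl refl (λ _ → refl)) hA hB))
      where
      resets = reset false ⨾ reset true
      σ₁ = run resets σ
      σ₂ = run (pushArc false tA tB) σ₁
      σ₃ = run (pushArc true tB tA) σ₂
      σ₄ = run (tMode := con 1) σ₃
      b₁ : Base (arr σ₁) A i
      b₁ = base-frame (agree resets baseCells σ refl) b
      pos : 0 < lab p q
      pos = es-edges (nth-∈ e)
      fresh-side : ∀ k → arr σ₁ tCount k 0 ≡ 0 → arr σ₁ tFail k 0 ≡ 0 →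
                   (∀ x → arr σ₁ tMark k x ≡ arr σ tMark k x) → Side (arr σ₁) k i [] false
      fresh-side k c f mk = side record
        { marks = λ x → subst (Flag (x ∈ [])) (sym (m≤n⇒m∸n≡0 (subst (_≤ i) (sym (mk (idx x))) (st k (idx x))))) (off λ ())
        ; recent = λ x → m≤n⇒m≤1+n (subst (_≤ i) (sym (mk x)) (st k x))
        ; queue = [] ; count = c ; fail = subst (Flag (false ≡ true)) (sym f) (off λ ()) }
      initial : ∀ {x} → Good A x [] false
      initial = record { distinct = Core.distinct core ; edges = closed-edges (Core.closed core)
                     ; implied = λ _ inc _ → inc ; refuted = λ () }
      ag = agree (pushArc false tA tB) ((tDone , true) ∷ (tDone , false) ∷ (tMode , false) ∷ (tBad , false) ∷ sideCells true) σ₁ (pushArc-side tA tB)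
      ag′ = agree (pushArc true tB tA) ((tDone , true) ∷ (tDone , false) ∷ (tMode , false) ∷ (tBad , false) ∷ sideCells false) σ₂ (pushArc-side′ tB tA)
      ctx = agree (pushArc false tA tB) ctxCells σ₁ (pushArc-untouched false tA tB)
      ctx′ = agree (pushArc true tB tA) ctxCells σ₂ (pushArc-untouched true tB tA)
      tailOf : ∀ {c cs a a′} → Agree (c ∷ cs) a a′ → Agree cs a a′
      tailOf (_ ∷ x) = x
      cellOf : ∀ {c cs a a′} → Agree (c ∷ cs) a a′ → a′ (proj₁ c) (proj₂ c) 0 ≡ a (proj₁ c) (proj₂ c) 0
      cellOf (x ∷ _) = cong (λ g → g 0) x
      tail³ : ∀ {c c′ c″ cs a a′} → Agree (c ∷ c′ ∷ c″ ∷ cs) a a′ → Agree cs a a′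
      tail³ x = tailOf (tailOf (tailOf x))
      first-push : Pushed false A i z [] false σ₂ → Inv (suc j) (arr σ₄)
      first-push (_ , _ , _ , known x) = ⊥-elim (z∉ x)
      first-push (_ , _ , _ , clash x) = ⊥-elim (z∉′ x)
      first-push (_ , _ , s₀ , ps@(fresh _ _)) =
        second-push (pushArc-raw true tB tA {σ₂} refl b₂
          (side-frame {k = true} (tailOf (tail³ ag)) (fresh-side true refl refl (λ _ → refl)))
          (trans (cellOf (tailOf ctx)) hB) (trans (cellOf ctx) hA))
        where
        b₂ : Base (arr σ₂) A i
        b₂ = base-frame (tail³ ctx) b₁
        b₄ : Base (arr σ₄) A i
        b₄ = base-frame (agree (tMode := con 1) baseCells σ₃ refl) (base-frame (tail³ ctx′) b₂)
        g₀ : Good A z (z ∷ []) false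
        g₀ = push-good A pos (λ _ _ tz → tz) ps initial
        second-push : Pushed true A i (swap z) [] false σ₃ → Inv (suc j) (arr σ₄)
        second-push (_ , _ , _ , known x) = ⊥-elim (z∉′ x)
        second-push (_ , _ , _ , clash x) = ⊥-elim (z∉ x)
        second-push (_ , _ , s₁ , ps′@(fresh _ _)) = trying record
          { d₀ = [] ; d₁ = [] ; base = b₄
          ; control = record { mode-is = refl ; not-bad = trans (cellOf (tail³ ag′)) (trans (cellOf (tail³ ag)) (Control.not-bad ct)) }
          ; core = core ; edge = e
          ; try₀ = record { status = side-frame {k = false} (agree (tMode := con 1) (sideCells false) σ₃ refl)
                                      (side-frame {k = false} (tailOf (tail³ ag′)) s₀)
                          ; good = g₀ ; swept = λ () ; pending = _ , refl
                          ; counted = trans (cellOf (tailOf ag′)) (cellOf (tailOf ag)) ; seeded = here refl }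
          ; try₁ = record { status = side-frame {k = true} (agree (tMode := con 1) (sideCells true) σ₃ refl) s₁
                          ; good = push-good A (subst (0 <_) (lab-sym p q) pos) (λ _ _ tz → tz) ps′ initial
                          ; swept = λ () ; pending = _ , refl
                          ; counted = trans (cellOf ag′) (cellOf ag) ; seeded = here refl }
          ; pace₀ = λ _ → refl ; pace₁ = λ _ → refl ; room = Core.size core
          ; elapsed = ≤-trans (s≤s el) (≤-reflexive (+-comm 1 _)) }

    idle-step : ∀ {σ} → Idle j (arr σ) → Inv (suc j) (arr (run idle σ))
    idle-step {σ} w = subst (λ c → Q (run c σ)) (sym idle≡)
      (cond-spec Q (M ⊖ v tI) body skip σ
        (subst (λ x → Flag (i < m) (m ∸ x)) (sym (Base.index base)) (flag-∸ m i))
        (λ i<m → go i<m (nth es i<m))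
        (λ i≮m → idling record { Idle w ; elapsed = λ i<m → ⊥-elim (i≮m i<m) }))
      where
      open Idle w
      Q : Store → Set₁
      Q τ = Inv (suc j) (arr τ)
      setAB = tA := rd tSrc false (v tI) ⨾ tB := rd tTgt false (v tI)
      onward = tI := v tI ⊕ con 1
      pick = cond (inSet tA tB ⊕ inSet tB tA) onward launch
      body = tA := rd tSrc false (v tI) ⨾ tB := rd tTgt false (v tI) ⨾ pick
      σ₁ = run setAB σ
      go : i < m → Σ[ z ∈ V² ] Nth es i z → Q (run pick σ₁)
      go i<m (z@(p , q) , e) =
        cond-spec Q (inSet tA tB ⊕ inSet tB tA) onward launch σ₁
          (flag-+ (set-flag {tx = tA} {tB} {p} {q} b₁ hA hB) (set-flag {tx = tB} {tA} {q} {p} b₁ hB hA))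
          (λ asg → idling record
            { base = record { tables = tables-frame (agree onward tableCells σ₁ refl) (Base.tables b₁)
                            ; member = Base.member b₁ ; index = trans (+-comm _ 1) (cong suc (Base.index b₁)) }
            ; control = record { Control control }
            ; core = record { Core core ; before = afterwards core e asg }
            ; stale = λ k x → m≤n⇒m≤1+n (stale k x)
            ; elapsed = λ _ → skip-bound {w = 2 * length A} (elapsed i<m) })
          (λ ¬asg → launch-spec {σ₁} b₁ (record { Control control }) core (λ k x → stale k x) i<m (elapsed i<m) e
                      (λ x → ¬asg (inj₁ x)) (λ x → ¬asg (inj₂ x)) hA hB)
        where
        b₁ : Base (arr σ₁) A i
        b₁ = base-frame (agree setAB baseCells σ refl) base
        hA : Holds (arr σ₁) tA p
        hA = trans (cong (arr σ tSrc false) (Base.index base)) (proj₁ (Base.edgeOf base e))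
        hB : Holds (arr σ₁) tB q
        hB = trans (cong (arr σ tTgt false) (Base.index base)) (proj₂ (Base.edgeOf base e))

  trialCells : Bool → Cells
  trialCells k = (tDone , k) ∷ sideCells k

  trial-frame : ∀ {a a′ k A i z l d f} → Agree (trialCells k) a a′ → Trial a k A i z l d f → Trial a′ k A i z l d f
  trial-frame {k = k} (e ∷ es) t = record
    { Trial t ; status = side-frame {k = k} es (Trial.status t) ; counted = trans (cong (λ g → g 0) e) (Trial.counted t) }

  all-processed : ∀ {l d : List V²} → Σ[ u ∈ List V² ] l ≡ u ++ d → ¬ length d < length l → l ≡ d
  all-processed ([] , e) _ = e
  all-processed {d = d} (x ∷ u , refl) ¬lt = ⊥-elim (¬lt (s≤s (subst (length d ≤_) (sym (length-++ u)) (m≤n+m _ (length u)))))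

  seedOf : Bool → V² → V²
  seedOf false z = z
  seedOf true  z = swap z

  module _ {j : ℕ} where

    -- A side that does not run has not failed and has processed its whole list, so its length
    -- equals the number `s` of rounds. This converts the time spent on both sides into a charge to
    -- the arcs about to be committed.
    adopt : ∀ k {σ A i s z l d f} → Base (arr σ) A i → Control (arr σ) 1 → Core A i → Nth es i z → i < m →
            Trial (arr σ) k A i (seedOf k z) l d f → ¬ (f ≡ true ⊎ length d < length l) →
            (f ≡ false → length d ≡ s) → Stale (arr σ) (suc i) →
            j ≤ 2 * length A + 3 * i + (1 + s) → Inv (suc j) (arr (run (tMode := con (modeOf k)) σ))
    adopt k {f = true} b ct core e i<m t ¬r _ _ _ = ⊥-elim (¬r (inj₁ refl))
    adopt k {σ} {A} {i} {s} {z} {l} {d} {f = false} b ct core e i<m t ¬r pace st el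
      with all-processed (Trial.pending t) (λ lt → ¬r (inj₂ lt))
    ... | refl = committing k record
      { base = base-frame (agree (tMode := con (modeOf k)) baseCells σ refl) b
      ; control = record { mode-is = refl ; not-bad = Control.not-bad ct }
      ; closed = finished A (Core.closed core) (Trial.good t) (Trial.swept t)
      ; distinct = Good.distinct (Trial.good t)
      ; before = Core.before core
      ; edge = e ; chosen = chosen k (Trial.seeded t) ; below = i<m
      ; queue = Side.queue (Trial.status t) ; count = Side.count (Trial.status t)
      ; recent = st
      ; elapsed = ≤-trans (s≤s (subst (λ s → j ≤ 2 * length A + 3 * i + (1 + s)) (sym (pace refl)) el))
                          (≤-reflexive (sym (+-suc (2 * length A + 3 * i) (1 + length l)))) }
      where
      chosen : ∀ k → seedOf k z ∈ l → Assigned (l ++ A) z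
      chosen false x = inj₁ (∈-++⁺ˡ x)
      chosen true  x = inj₂ (∈-++⁺ˡ x)

    -- Any `T` would extend the closed set `A` to a closed and total one. That extension orients the
    -- edge `z` in one of the two ways, and both have been refuted over `A`.
    no-orientation : ∀ {A i z l₀ l₁} → Core A i → Nth es i z → Good A z l₀ true → Good A (swap z) l₁ true → NoTTO
    no-orientation {A} {z = z} core e g₀ g₁ {T} T? cl tot with X.X′-total (es-edges (nth-∈ e))
      where module X = Extend {⟪ A ⟫} {T} (λ a b → (a , b) ∈? A) T? (Core.closed core) cl tot
    ... | inj₁ x = Good.refuted g₀ refl X.X′-closed X.old x
      where module X = Extend {⟪ A ⟫} {T} (λ a b → (a , b) ∈? A) T? (Core.closed core) cl tot
    ... | inj₂ x = Good.refuted g₁ refl X.X′-closed X.old x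
      where module X = Extend {⟪ A ⟫} {T} (λ a b → (a , b) ∈? A) T? (Core.closed core) cl tot

    -- A single side without failure is enough: it has processed `s` arcs and still has another one,
    -- and these together with `A` lie on distinct edges.
    grow-room : ∀ {a k A i z l d f s} → Trial a k A i z l d f → f ≡ true ⊎ length d < length l →
                (f ≡ false → length d ≡ s) → ¬ f ≡ true → suc s + length A ≤ m
    grow-room t (inj₁ e) pace ¬f = ⊥-elim (¬f e)
    grow-room {A = A} {l = l} {f = true} t (inj₂ lt) pace ¬f = ⊥-elim (¬f refl)
    grow-room {A = A} {l = l} {f = false} t (inj₂ lt) pace ¬f =
      ≤-trans (+-monoˡ-≤ (length A) (subst (_< length l) (pace refl) lt))
        (≤-trans (≤-reflexive (sym (length-++ l))) (apart-length (Good.distinct (Trial.good t)) (Good.edges (Trial.good t))))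

    recent-both : ∀ {a A i z z′ l₀ l₁ d₀ d₁ f₀ f₁} → Trial a false A i z l₀ d₀ f₀ → Trial a true A i z′ l₁ d₁ f₁ → Stale a (suc i)
    recent-both t₀ t₁ false = Side.recent (Trial.status t₀)
    recent-both t₀ t₁ true = Side.recent (Trial.status t₁)

    running-flag : ∀ k {a A i z l d f} → Trial a k A i z l d f → Flag (f ≡ true ⊎ length d < length l) (⟦ running k ⟧e a)
    running-flag k {a} {l = l} {d} t = flag-+ (Side.fail (Trial.status t))
      (subst₂ (λ x y → Flag (length d < length l) (x ∸ y)) (sym (Side.count (Trial.status t))) (sym (Trial.counted t))
        (flag-∸ (length l) (length d)))

    both-spec : ∀ {σ} (w : Trying j (arr σ)) → let open Trying w in
                (f₀ ≡ false → length d₀ < length l₀) → (f₁ ≡ false → length d₁ < length l₁) →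
                suc s + length A ≤ m → Inv (suc j) (arr (run bothSides σ))
    both-spec {σ} w more₀ more₁ room′ = go (process-spec false {σ} base try₀ more₀)
      where
      open Trying w
      σ₁ = run (process false) σ
      σ₂ = run (process true) σ₁
      ag = agree (process false) ((tDone , true) ∷ (tMode , false) ∷ (tBad , false) ∷ sideCells true) σ process-side
      ag′ = agree (process true) ((tDone , false) ∷ (tMode , false) ∷ (tBad , false) ∷ sideCells false) σ₁ process-side′
      pick : ∀ {c c₁ c₂ cs a a′} → Agree (c ∷ c₁ ∷ c₂ ∷ cs) a a′ → Agree (c ∷ cs) a a′
      pick (x ∷ _ ∷ _ ∷ y) = x ∷ y
      control-frame : ∀ {c cs a a′ v} → Agree (c ∷ (tMode , false) ∷ (tBad , false) ∷ cs) a a′ → Control a v → Control a′ v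
      control-frame (_ ∷ x ∷ y ∷ _) ct = record { mode-is = trans (cong (λ g → g 0) x) (Control.mode-is ct)
                                              ; not-bad = trans (cong (λ g → g 0) y) (Control.not-bad ct) }
      -- Failures are permanent, so a side free of failure after this round was so before it and has
      -- advanced by exactly one arc.
      pace : ∀ {k A i z d f τ} (p : Processed k A i z d f τ) → (f ≡ false → length d ≡ s) →
             Processed.f′ p ≡ false → length (Processed.d′ p) ≡ suc s
      pace {f = false} p h e = trans (Processed.advance p refl) (cong suc (h refl))
      pace {f = true} p h e with trans (sym (Processed.failed p refl)) e
      ... | ()
      go : Processed false A i z d₀ f₀ σ₁ → Inv (suc j) (arr σ₂)
      go p₀ = go′ (process-spec true {σ₁} (Processed.base p₀) (trial-frame {k = true} (pick ag) try₁) more₁)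
        where
        go′ : Processed true A i (swap z) d₁ f₁ σ₂ → Inv (suc j) (arr σ₂)
        go′ p₁ = trying record
          { base = Processed.base p₁
          ; control = control-frame ag′ (control-frame ag control)
          ; core = core ; edge = edge
          ; try₀ = trial-frame {k = false} (pick ag′) (Processed.onTrial p₀)
          ; try₁ = Processed.onTrial p₁
          ; pace₀ = pace p₀ pace₀ ; pace₁ = pace p₁ pace₁
          ; room = room′
          ; elapsed = ≤-trans (s≤s elapsed) (≤-reflexive (sym (+-suc (2 * length A + 3 * i) (1 + s)))) }

    trial-step : ∀ {σ} → Trying j (arr σ) → Inv (suc j) (arr (run trial σ))
    trial-step {σ} w = subst (λ c → Q (run c σ)) (sym trial≡)
      (cond-spec Q (running false) rest₀ (tMode := con 2) σ (running-flag false try₀)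
        (λ r₀ → cond-spec Q (running true) rest₁ (tMode := con 3) σ (running-flag true try₁)
          (λ r₁ → cond-spec Q (rd tFail false (con 0)) rest₂ bothSides σ (Side.fail (Trial.status try₀))
            (λ e₀ → cond-spec Q (rd tFail true (con 0)) (tBad := con 1) bothSides σ (Side.fail (Trial.status try₁))
              (λ e₁ → refuted record { bad = refl ; noTTO = no-orientation core edge (failing e₀ (Trial.good try₀)) (failing e₁ (Trial.good try₁)) })
              (λ ¬e₁ → both-spec {σ} w (more r₀) (more r₁) (grow-room try₁ r₁ pace₁ ¬e₁)))
            (λ ¬e₀ → both-spec {σ} w (more r₀) (more r₁) (grow-room try₀ r₀ pace₀ ¬e₀)))
          (λ ¬r₁ → adopt true {σ} base control core edge below try₁ ¬r₁ pace₁ (recent-both try₀ try₁) elapsed))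
        (λ ¬r₀ → adopt false {σ} base control core edge below try₀ ¬r₀ pace₀ (recent-both try₀ try₁) elapsed))
      where
      open Trying w
      Q : Store → Set₁
      Q τ = Inv (suc j) (arr τ)
      rest₂ = cond (rd tFail true (con 0)) (tBad := con 1) bothSides
      rest₁ = cond (rd tFail false (con 0)) rest₂ bothSides
      rest₀ = cond (running true) rest₁ (tMode := con 3)
      failing : ∀ {z l f} → f ≡ true → Good A z l f → Good A z l true
      failing refl g = g
      more : ∀ {f d l} → f ≡ true ⊎ d < l → f ≡ false → d < l
      more (inj₁ refl) ()
      more (inj₂ lt) _ = lt
      below : i < m
      below = nth-< edge

    commit-step : ∀ k {σ} → Committing k j (arr σ) → Inv (suc j) (arr (run (commit k) σ))
    commit-step k {σ} w = subst (λ c → Q (run c σ)) (sym (commit≡ k)) (go k w (view k w))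
      where
      Q : Store → Set₁
      Q τ = Inv (suc j) (arr τ)
      view : ∀ k (w : Committing k j (arr σ)) → Flag (0 < length (Committing.l w)) (⟦ rd tCount k (con 0) ⟧e (arr σ))
      view k w = subst (Flag (0 < length (Committing.l w))) (sym (Committing.count w)) (flag-pos (length (Committing.l w)))
      leave : Stmt
      leave = tMode := con 0 ⨾ tI := v tI ⊕ con 1
      go : ∀ k (w : Committing k j (arr σ)) → Flag (0 < length (Committing.l w)) (⟦ rd tCount k (con 0) ⟧e (arr σ)) → Q (run (commit° k) σ)
      go k w fl = cond-spec Q (rd tCount k (con 0)) pop leave σ fl (popped w) (left w)
        where
        shrink = put tCount k (con 0) (rd tCount k (con 0) ⊖ con 1)
        setX = tX := rd tTail k (rd tCount k (con 0))
        setY = tY := rd tHead k (rd tCount k (con 0))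
        insert = put tSet false (at tX tY) (con 1)
        pop = shrink ⨾ setX ⨾ setY ⨾ insert
        σ₁ = run shrink σ
        σ₂ = run (setX ⨾ setY) σ₁
        σ₃ = run insert σ₂
        left : (w : Committing k j (arr σ)) → ¬ 0 < length (Committing.l w) → Q (run leave σ)
        left record { l = _ ∷ _ } ¬p = ⊥-elim (¬p (s≤s z≤n))
        left w@record { A = A ; l = [] ; i = i } _ = idling record
          { base = record { tables = tables-frame (agree leave tableCells σ refl) (Base.tables base)
                          ; member = Base.member base ; index = trans (+-comm _ 1) (cong suc (Base.index base)) }
          ; control = record { mode-is = refl ; not-bad = Control.not-bad control }
          ; core = core′
          ; stale = λ k x → recent k x
          ; elapsed = λ _ → ≤-trans (s≤s elapsed) (≤-reflexive bound) }
          where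
          open Committing w hiding (A; l; i)
          core : Core A i
          core = record { closed = closed ; distinct = distinct ; before = before }
          core′ : Core A (suc i)
          core′ = record { Core core ; before = afterwards core edge chosen }
          bound : suc (2 * length A + 3 * i + 2) ≡ 2 * length A + 3 * suc i
          bound = leave-arith (length A) i
        popped : (w : Committing k j (arr σ)) → 0 < length (Committing.l w) → Q (run pop σ)
        popped w@record { A = A ; l = (p , q) ∷ l ; i = i ; z = z } _ = committing k record
          { base = base₃
          ; control = record { mode-is = Control.mode-is control′ ; not-bad = Control.not-bad control′ }
          ; closed = closed-resp (∈-resp-↭ (↭-sym moved)) (∈-resp-↭ moved) closed
          ; distinct = allPairs-↭ (↭-sym moved) distinct
          ; before = λ lt e → [ (λ x → inj₁ (there x)) , (λ x → inj₂ (there x)) ]′ (before lt e)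
          ; edge = edge
          ; chosen = [ (λ x → inj₁ (∈-resp-↭ (↭-sym moved) x)) , (λ x → inj₂ (∈-resp-↭ (↭-sym moved) x)) ]′ chosen
          ; below = below
          ; queue = rest queue
          ; count = count₃
          ; recent = recent′
          ; elapsed = ≤-trans (s≤s elapsed) (≤-reflexive bound) }
          where
          open Committing w hiding (A; l; i; z)
          moved : l ++ (p , q) ∷ A ↭ (p , q) ∷ l ++ A
          moved = shift (p , q) l A
          a = arr σ
          front : ∀ {gt gh} → Queue gt gh ((p , q) ∷ l) → gt (length l) ≡ toℕ p × gh (length l) ≡ toℕ q
          front (e ∷ _) = e
          rest : ∀ {gt gh} → Queue gt gh ((p , q) ∷ l) → Queue gt gh l
          rest (_ ∷ r) = r
          shrunk : ∀ k → arr (run (put tCount k (con 0) (rd tCount k (con 0) ⊖ con 1)) σ) tCount k 0 ≡ a tCount k 0 ∸ 1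
          shrunk false = refl
          shrunk true = refl
          count₁ : arr σ₁ tCount k 0 ≡ length l
          count₁ = trans (shrunk k) (cong (_∸ 1) count)
          count₃ : arr σ₃ tCount k 0 ≡ length l
          count₃ = count₁
          hX : Holds (arr σ₂) tX p
          hX = trans (cong (a tTail k) count₁) (proj₁ (front queue))
          hY : Holds (arr σ₂) tY q
          hY = trans (cong (a tHead k) count₁) (proj₂ (front queue))
          base₂ : Base (arr σ₂) A i
          base₂ = base-frame (agree (shrink ⨾ setX ⨾ setY) baseCells σ refl) base
          where-to : ⟦ at tX tY ⟧e (arr σ₂) ≡ idx (p , q)
          where-to = at-value {tx = tX} {tY} base₂ hX hY
          base₃ : Base (arr σ₃) ((p , q) ∷ A) i
          base₃ = record { tables = tables-frame (agree insert tableCells σ₂ refl) (Base.tables base₂)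
                         ; member = member₃ ; index = Base.index base₂ }
            where
            inserted : ∀ x → Flag (x ∈ (p , q) ∷ A) (write (arr σ₂ tSet false) (idx (p , q)) 1 (idx x))
            inserted x with idx (p , q) ≟ idx x
            ... | yes e with idx-injective (p , q) x e
            ...   | refl = subst (Flag _) (sym (write-hit (arr σ₂ tSet false) (idx (p , q)) 1)) (on (here refl))
            inserted x | no ne = subst (Flag _) (sym (write-miss (arr σ₂ tSet false) (idx (p , q)) 1 (idx x) ne))
              (flag-map there (λ { (here refl) → ⊥-elim (ne refl) ; (there z) → z }) (Base.member base₂ x))
            member₃ : Member (arr σ₃ tSet false) ((p , q) ∷ A)
            member₃ x = subst (λ y → Flag (x ∈ (p , q) ∷ A) (write (arr σ₂ tSet false) y 1 (idx x))) (sym where-to) (inserted x)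
          control′ : Control (arr σ₃) (modeOf k)
          control′ = record { mode-is = Control.mode-is control ; not-bad = Control.not-bad control }
          recent′ : Stale (arr σ₃) (suc i)
          recent′ k′ x = recent k′ x
          bound : suc (2 * length A + 3 * i + (2 + suc (length l))) ≡ 2 * suc (length A) + 3 * i + (2 + length l)
          bound = commit-arith (length A) i (length l)

  step-spec : ∀ {j σ} → Inv j (arr σ) → Inv (suc j) (arr (run step σ))
  step-spec {j} {σ} inv = subst (λ c → Q (run c σ)) (sym step≡) (go inv)
    where
    Q : Store → Set₁
    Q τ = Inv (suc j) (arr τ)
    commits = cond (v tMode ⊖ con 2) (commit true) (commit false)
    busy = cond (v tMode ⊖ con 1) commits trial
    alive = cond (v tMode) busy idle
    modes : arr σ tBad false 0 ≡ 0 → Q (run alive σ) → Q (run step° σ)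
    modes e q = subst Q (sym (cond-else (v tBad) skip alive σ e)) q
    working : ∀ {x} → arr σ tMode false 0 ≡ suc x → Q (run busy σ) → Q (run alive σ)
    working e q = subst Q (sym (cond-then (v tMode) busy idle σ e)) q
    closing : ∀ {x} → arr σ tMode false 0 ≡ suc (suc x) → Q (run commits σ) → Q (run busy σ)
    closing e q = subst Q (sym (cond-then (v tMode ⊖ con 1) commits trial σ (cong (_∸ 1) e))) q
    go : Inv j (arr σ) → Q (run step° σ)
    go (refuted r) = subst Q (sym (cond-then (v tBad) skip alive σ (Refuted.bad r))) (refuted r)
    go (idling w) = modes (Control.not-bad (Idle.control w))
      (subst Q (sym (cond-else (v tMode) busy idle σ (Control.mode-is (Idle.control w)))) (idle-step {σ = σ} w))
    go (trying w) = modes (Control.not-bad (Trying.control w)) (working mode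
      (subst Q (sym (cond-else (v tMode ⊖ con 1) commits trial σ (cong (_∸ 1) mode))) (trial-step {σ = σ} w)))
      where mode = Control.mode-is (Trying.control w)
    go (committing false w) = modes (Control.not-bad (Committing.control w)) (working mode (closing mode
      (subst Q (sym (cond-else (v tMode ⊖ con 2) (commit true) (commit false) σ (cong (_∸ 2) mode))) (commit-step false {σ} w))))
      where mode = Control.mode-is (Committing.control w)
    go (committing true w) = modes (Control.not-bad (Committing.control w)) (working mode (closing mode
      (subst Q (sym (cond-then (v tMode ⊖ con 2) (commit true) (commit false) σ (cong (_∸ 2) mode))) (commit-step true {σ} w))))
      where mode = Control.mode-is (Committing.control w)

  steps : ∀ c {j σ} → Inv j (arr σ) → Inv (c + j) (arr (iter c (run step) σ))
  steps zero w = w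
  steps (suc c) {j} {σ} w = subst (λ x → Inv x (arr (iter c (run step) (run step σ)))) (+-suc c j) (steps c {σ = run step σ} (step-spec {σ = σ} w))

  sixfold-spec : ∀ {σ} → Inv 0 (arr σ) → Inv (6 * m) (arr (run (sixfold (loop byM step)) σ))
  sixfold-spec {σ} w = subst (λ x → Inv x (arr (at-end σ))) total
    (steps m {σ = s⁵} (steps m {σ = s⁴} (steps m {σ = s³} (steps m {σ = s²} (steps m {σ = s¹} (steps m {σ = σ} w))))))
    where
    at-end : Store → Store
    at-end = run (sixfold (loop byM step))
    s¹ = iter m (run step) σ
    s² = iter m (run step) s¹
    s³ = iter m (run step) s²
    s⁴ = iter m (run step) s³
    s⁵ = iter m (run step) s⁴
    total : m + (m + (m + (m + (m + (m + 0))))) ≡ 6 * m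
    total = refl

  -- The end of the search and the printed answer.

  record Accepted (a : Arrays) : Set where
    field
      {A}     : List V²
      {i}     : ℕ
      base    : Base a A i
      not-bad : a tBad false 0 ≡ 0
      closed  : Closed ⟪ A ⟫
      total   : ∀ {x} → x ∈ es → Assigned A x

  -- Here `w` counts committed arcs and `x` rounds or pending arcs. The charge to arcs is 2w + x ≤
  -- 2m and the charge to edges is 2 + 3i ≤ 3m, while `i < m` makes m positive and hence 5m < 6m.
  overtime : ∀ {i w x} → i < m → x + w ≤ m → 6 * m ≤ 2 * w + 3 * i + (2 + x) → ⊥
  overtime {i} {w} {x} i<m room le = <⇒≱ (≤-<-trans bound 5m<6m) le
    where
    bound : 2 * w + 3 * i + (2 + x) ≤ 5 * m
    bound = ≤-trans (≤-reflexive (overtime-arith w i x)) (≤-trans (+-mono-≤ (double-arith w x) (≤-trans (n≤1+n _) (≤-reflexive (sym (*-suc 3 i)))))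
              (≤-trans (+-mono-≤ (*-monoʳ-≤ 2 room) (*-monoʳ-≤ 3 i<m)) (≤-reflexive (budget-arith m))))
    5m<6m : 5 * m < 6 * m
    5m<6m = +-monoˡ-≤ (5 * m) (≤-trans (s≤s z≤n) i<m)

  nth-of : ∀ {A : Set} {xs : List A} {x} → x ∈ xs → Σ[ j ∈ ℕ ] (j < length xs × Nth xs j x)
  nth-of (here refl) = 0 , s≤s z≤n , first
  nth-of (there x) with nth-of x
  ... | j , lt , p = suc j , s≤s lt , later p

  finish : ∀ {a} → Inv (6 * m) a → Accepted a ⊎ Refuted a
  finish (refuted r) = inj₂ r
  finish (idling w) with Idle.i w <? m
  ... | yes lt = ⊥-elim (overtime {x = 0} lt (Core.size (Idle.core w)) (≤-trans (Idle.elapsed w lt) (m≤m+n _ 2)))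
  ... | no ¬lt = inj₁ record
    { base = Idle.base w ; not-bad = Control.not-bad (Idle.control w) ; closed = Core.closed (Idle.core w)
    ; total = λ x → let (j , lt , p) = nth-of x in Core.before (Idle.core w) (<-≤-trans lt (≮⇒≥ ¬lt)) p }
  finish (trying w) = ⊥-elim (overtime (nth-< edge) room (≤-trans elapsed (+-monoʳ-≤ _ (n≤1+n (1 + s)))))
    where
    open Trying w
  finish (committing k w) = ⊥-elim (overtime below
    (≤-trans (≤-reflexive (sym (length-++ l))) (apart-length distinct (closed-edges closed))) elapsed)
    where open Committing w

  encode : List V² → List ℕ
  encode = concatMap (λ (p , q) → toℕ p ∷ toℕ q ∷ [])

  orient : List V² → V² → V²
  orient A x with x ∈? A
  ... | yes _ = x
  ... | no _  = swap x

  orient-in : ∀ {A x} → x ∈ A → orient A x ≡ x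
  orient-in {A} {x} i with x ∈? A
  ... | yes _ = refl
  ... | no ¬i = ⊥-elim (¬i i)

  orient-out : ∀ {A x} → x ∉ A → orient A x ≡ swap x
  orient-out {A} {x} ¬i with x ∈? A
  ... | yes i = ⊥-elim (¬i i)
  ... | no _ = refl

  printEdge-spec : ∀ {σ A i c z} → Base (arr σ) A i → arr σ tC false 0 ≡ c → Nth es c z →
    out (run printEdge σ) ≡ out σ ++ toℕ (proj₁ (orient A z)) ∷ toℕ (proj₂ (orient A z)) ∷ [] ×
    arr (run printEdge σ) tC false 0 ≡ suc c
  printEdge-spec {σ} {A} {i} {c} {z@(p , q)} b hc e =
    subst (λ s → out (run s σ) ≡ goal × arr (run s σ) tC false 0 ≡ suc c) (sym printEdge≡)
      ( cond-spec (λ τ → out τ ≡ goal) (inSet tA tB) forth back σ₁ (set-flag {tx = tA} {tB} {p} {q} b₁ hA hB)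
          (λ x → trans (++-assoc (out σ) _ _) (cong₂ (λ y w → out σ ++ y ∷ w ∷ [])
            (trans hA (cong (λ y → toℕ (proj₁ y)) (sym (orient-in x)))) (trans hB (cong (λ y → toℕ (proj₂ y)) (sym (orient-in x))))))
          (λ ¬x → trans (++-assoc (out σ) _ _) (cong₂ (λ y w → out σ ++ y ∷ w ∷ [])
            (trans hB (cong (λ y → toℕ (proj₁ y)) (sym (orient-out ¬x)))) (trans hA (cong (λ y → toℕ (proj₂ y)) (sym (orient-out ¬x))))))
      , trans (+-comm _ 1) (cong suc (trans (cong (λ g → g 0) (frame choose {tC} {false} σ₁ refl)) hc)) )
    where
    goal = out σ ++ toℕ (proj₁ (orient A z)) ∷ toℕ (proj₂ (orient A z)) ∷ []
    setAB = tA := rd tSrc false (v tC) ⨾ tB := rd tTgt false (v tC)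
    forth = emit (v tA) ⨾ emit (v tB)
    back = emit (v tB) ⨾ emit (v tA)
    choose = cond (inSet tA tB) forth back
    σ₁ = run setAB σ
    b₁ : Base (arr σ₁) A i
    b₁ = base-frame (agree setAB baseCells σ refl) b
    hA : Holds (arr σ₁) tA p
    hA = trans (cong (arr σ tSrc false) hc) (proj₁ (Base.edgeOf b e))
    hB : Holds (arr σ₁) tB q
    hB = trans (cong (arr σ tTgt false) hc) (proj₂ (Base.edgeOf b e))

  print-spec : ∀ rest {c σ A i} → Base (arr σ) A i → arr σ tC false 0 ≡ c → (∀ {j x} → Nth rest j x → Nth es (j + c) x) →
               out (iter (length rest) (run printEdge) σ) ≡ out σ ++ encode (map (orient A) rest)
  print-spec [] b hc _ = sym (++-identityʳ _)
  print-spec (z ∷ rest) {c} {σ} {A} b hc inside with printEdge-spec {σ} b hc (inside first)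
  ... | e , hc′ = trans (print-spec rest {suc c} {run printEdge σ} (base-frame (agree printEdge baseCells σ printEdge-untouched) b) hc′
                          (λ {j} {x} p → subst (λ y → Nth es y x) (sym (+-suc j c)) (inside (later p))))
                        (trans (cong (_++ _) e) (++-assoc (out σ) _ _))

  answer-accept : ∀ {σ} (w : Accepted (arr σ)) → out σ ≡ [] →
                  out (run answer σ) ≡ 1 ∷ encode (map (orient (Accepted.A w)) es)
  answer-accept {σ} w e = trans (cong (λ s → out (run s σ)) answer≡)
    (trans (cong out (cond-else (v tBad) (emit (con 0)) accept σ (Accepted.not-bad w)))
    (trans (print-spec es {0} {σ₁} (base-frame (agree prefix baseCells σ refl) (Accepted.base w)) refl
              (λ {j} {x} p → subst (λ y → Nth es y x) (sym (+-identityʳ j)) p))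
           (cong (λ o → (o ++ 1 ∷ []) ++ encode (map (orient (Accepted.A w)) es)) e)))
    where
    prefix = emit (con 1) ⨾ tC := con 0
    accept = emit (con 1) ⨾ tC := con 0 ⨾ loop byM printEdge
    σ₁ = run prefix σ

  answer-refute : ∀ {σ} → Refuted (arr σ) → out σ ≡ [] → out (run answer σ) ≡ 0 ∷ []
  answer-refute {σ} r e = trans (cong (λ s → out (run s σ)) answer≡)
    (trans (cong out (cond-then (v tBad) (emit (con 0)) (emit (con 1) ⨾ tC := con 0 ⨾ loop byM printEdge) σ (Refuted.bad r)))
           (cong (_++ 0 ∷ []) e))

  -- Loading the input.

  Zero : Cells → Arrays → Set
  Zero cs a = All (λ c → ∀ i → a (proj₁ c) (proj₂ c) i ≡ 0) cs

  zero-frame : ∀ {cs a a′} → Agree cs a a′ → Zero cs a → Zero cs a′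
  zero-frame [] [] = []
  zero-frame (e ∷ es) (z ∷ zs) = (λ i → trans (cong (λ g → g i) e) (z i)) ∷ zero-frame es zs

  record Rows (c : ℕ) (a : Arrays) : Set where
    field
      counter : a tC false 0 ≡ c
      sum     : a tAcc false 0 ≡ c * n
      rows<   : ∀ p → p < c → a tRow false p ≡ p * n

  rowStep : Stmt
  rowStep = put tRow false (v tC) (v tAcc) ⨾ tAcc := v tAcc ⊕ N ⨾ tC := v tC ⊕ con 1

  rows-loop : ∀ k {c σ} → Rows c (arr σ) → Rows (k + c) (arr (iter k (run rowStep) σ))
  rows-loop zero r = r
  rows-loop (suc k) {c} {σ} r =
    subst (λ x → Rows x (arr (iter k (run rowStep) (run rowStep σ)))) (+-suc k c) (rows-loop k {suc c} {run rowStep σ} record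
      { counter = trans (+-comm _ 1) (cong suc counter)
      ; sum = trans (cong (_+ n) sum) (+-comm (c * n) n)
      ; rows< = λ p lt → trans (cong₂ (λ x y → write (arr σ tRow false) x y p) counter sum) (onward p (m≤n⇒m<n∨m≡n (≤-pred lt))) })
    where
    open Rows r
    onward : ∀ p → p < c ⊎ p ≡ c → write (arr σ tRow false) c (c * n) p ≡ p * n
    onward p (inj₁ lt) = trans (write-miss (arr σ tRow false) c (c * n) p (λ e → <⇒≢ lt (sym e))) (rows< p lt)
    onward p (inj₂ refl) = write-hit (arr σ tRow false) p (p * n)

  inputOf : List V² → List ℕ
  inputOf = concatMap (λ (p , q) → toℕ p ∷ toℕ q ∷ pred (lab p q) ∷ [])

  Right : (ℕ → ℕ) → V² → Set
  Right g (p , q) = g (idx (p , q)) ≡ lab p q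

  record Reading (c : ℕ) (rest : List V²) (σ : Store) : Set where
    field
      rowOf   : ∀ (p : Fin n) → arr σ tRow false (toℕ p) ≡ toℕ p * n
      counter : arr σ tI false 0 ≡ c
      pending : inp σ ≡ inputOf rest
      suffix  : ∀ {j x} → Nth rest j x → Nth es (j + c) x
      edges   : ∀ {j x} → j < c → Nth es j x → arr σ tSrc false j ≡ toℕ (proj₁ x) × arr σ tTgt false j ≡ toℕ (proj₂ x)
      seen    : ∀ {j x} → j < c → Nth es j x → Right (arr σ tLab false) x × Right (arr σ tLab false) (swap x)
      -- Entries of nonedges are never visited by the input; they keep their initial 0, which is the
      -- label that stands for a nonedge.
      partial : ∀ x → Right (arr σ tLab false) x ⊎ arr σ tLab false (idx x) ≡ 0

  read-one : ∀ {c z rest σ} → Reading c (z ∷ rest) σ → Reading (suc c) rest (run readEdge σ)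
  read-one {c} {z@(p , q)} {rest} {store′ a is os} r = subst (λ s → Reading (suc c) rest (run s σ)) (sym readEdge≡) (go pending)
    where
    open Reading r
    σ = store′ a is os
    pos : 0 < lab p q
    pos = es-edges (nth-∈ (suffix first))
    label : pred (lab p q) + 1 ≡ lab p q
    label = trans (+-comm _ 1) (suc-pred (lab p q) {{>-nonZero pos}})
    go : is ≡ inputOf (z ∷ rest) → Reading (suc c) rest (run readEdge° (store′ a is os))
    go refl = record
      { rowOf = rowOf
      ; counter = trans (+-comm _ 1) (cong suc counter)
      ; pending = refl
      ; suffix = λ {j} {x} e → subst (λ y → Nth es y x) (sym (+-suc j c)) (suffix (later e))
      ; edges = λ {j} {x} lt e → subst (λ i → write (a tSrc false) i (toℕ p) j ≡ toℕ (proj₁ x) × write (a tTgt false) i (toℕ q) j ≡ toℕ (proj₂ x)) (sym counter)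
                  (stored (m≤n⇒m<n∨m≡n (≤-pred lt)) e)
      ; seen = λ {j} {x} lt e → subst (λ g → Right g x × Right g (swap x)) (sym table) (labelled (m≤n⇒m<n∨m≡n (≤-pred lt)) e)
      ; partial = λ x → subst (λ g → Right g x ⊎ g (idx x) ≡ 0) (sym table) (mixed x (change x)) }
      where
      old = a tLab false
      new = write (write old (idx z) (lab p q)) (idx (swap z)) (lab q p)
      same : ∀ {i i′ j j′ w w′ u u′ : ℕ} → i ≡ i′ → j ≡ j′ → w ≡ w′ → u ≡ u′ →
             write (write old i w) j u ≡ write (write old i′ w′) j′ u′
      same refl refl refl refl = refl
      table : write (write old (a tRow false (toℕ p) + toℕ q) (pred (lab p q) + 1)) (a tRow false (toℕ q) + toℕ p) (pred (lab p q) + 1) ≡ new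
      table = same (cong (_+ toℕ q) (rowOf p)) (cong (_+ toℕ p) (rowOf q)) label (trans label (lab-sym p q))
      change : ∀ x → Right new x ⊎ new (idx x) ≡ old (idx x)
      change x with idx (swap z) ≟ idx x
      ... | yes e with idx-injective (swap z) x e
      ...   | refl = inj₁ (write-hit (write old (idx z) (lab p q)) (idx (swap z)) (lab q p))
      change x | no ne with idx z ≟ idx x
      ...   | no ne′ = inj₂ (trans (write-miss (write old (idx z) (lab p q)) (idx (swap z)) (lab q p) (idx x) ne)
                                   (write-miss old (idx z) (lab p q) (idx x) ne′))
      ...   | yes e with idx-injective z x e
      ...     | refl = inj₁ (trans (write-miss (write old (idx z) (lab p q)) (idx (swap z)) (lab q p) (idx z) ne)
                                   (write-hit old (idx z) (lab p q)))
      kept : ∀ x → Right old x → Right new x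
      kept x e with change x
      ... | inj₁ e′ = e′
      ... | inj₂ e′ = trans e′ e
      mixed : ∀ x → Right new x ⊎ new (idx x) ≡ old (idx x) → Right new x ⊎ new (idx x) ≡ 0
      mixed x (inj₁ e) = inj₁ e
      mixed x (inj₂ e) with partial x
      ... | inj₁ e′ = inj₁ (trans e e′)
      ... | inj₂ e′ = inj₂ (trans e e′)
      stored : ∀ {j x} → j < c ⊎ j ≡ c → Nth es j x →
               write (a tSrc false) c (toℕ p) j ≡ toℕ (proj₁ x) × write (a tTgt false) c (toℕ q) j ≡ toℕ (proj₂ x)
      stored {j} (inj₁ lt) e = trans (write-miss (a tSrc false) c (toℕ p) j (λ e → <⇒≢ lt (sym e))) (proj₁ (edges lt e))
                             , trans (write-miss (a tTgt false) c (toℕ q) j (λ e → <⇒≢ lt (sym e))) (proj₂ (edges lt e))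
      stored (inj₂ refl) e with nth-unique e (suffix first)
      ... | refl = write-hit (a tSrc false) c (toℕ p) , write-hit (a tTgt false) c (toℕ q)
      labelled : ∀ {j x} → j < c ⊎ j ≡ c → Nth es j x → Right new x × Right new (swap x)
      labelled {x = x} (inj₁ lt) e = kept x (proj₁ (seen lt e)) , kept (swap x) (proj₂ (seen lt e))
      labelled (inj₂ refl) e with nth-unique e (suffix first)
      ... | refl = forward (change z) , write-hit (write old (idx z) (lab p q)) (idx (swap z)) (lab q p)
        where
        forward : Right new z ⊎ new (idx z) ≡ old (idx z) → Right new z
        forward _ with idx (swap z) ≟ idx z
        ... | yes e with idx-injective (swap z) z e
        ...   | refl = write-hit (write old (idx z) (lab p q)) (idx z) (lab q p)
        forward _ | no ne = trans (write-miss (write old (idx z) (lab p q)) (idx (swap z)) (lab q p) (idx z) ne)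
                                  (write-hit old (idx z) (lab p q))

  read-all : ∀ rest {c σ} → Reading c rest σ → Reading (length rest + c) [] (iter (length rest) (run readEdge) σ)
  read-all [] r = r
  read-all (z ∷ rest) {c} {σ} r =
    subst (λ x → Reading x [] (iter (length rest) (run readEdge) (run readEdge σ))) (+-suc (length rest) c)
      (read-all rest {suc c} {run readEdge σ} (read-one {σ = σ} r))

  init-spec : Inv 0 (arr (run (rows ⨾ loop byM readEdge ⨾ tI := con 0) (empty (inputOf es))))
  init-spec = idling record
    { A = [] ; base = record { tables = tables ; member = λ x → subst (Flag (x ∈ [])) (sym (zeroAt tSet′ (idx x))) (off λ ()) ; index = refl }
    ; control = record { mode-is = zeroAt mode′ 0 ; not-bad = zeroAt bad′ 0 }
    ; core = record { closed = record { sound = λ () ; asym = λ () ; head = λ () ; tail = λ () ; mono = λ () }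
                    ; distinct = [] ; before = λ () }
    ; stale = stale ; elapsed = λ _ → z≤n }
    where
    σ₀ = empty (inputOf es)
    σ₁ = run rows σ₀
    σ₂ = run (loop byM readEdge) σ₁
    σ₃ = run (tI := con 0) σ₂
    rowCells keepCells : Cells
    rowCells = (tLab , false) ∷ (tSrc , false) ∷ (tTgt , false) ∷ (tSet , false) ∷ (tMark , false) ∷ (tMark , true)
             ∷ (tI , false) ∷ (tMode , false) ∷ (tBad , false) ∷ []
    keepCells = (tSet , false) ∷ (tMark , false) ∷ (tMark , true) ∷ (tMode , false) ∷ (tBad , false) ∷ []
    zero₁ : Zero rowCells (arr σ₁)
    zero₁ = zero-frame (agree rows rowCells σ₀ rows-untouched)
      ((λ _ → refl) ∷ (λ _ → refl) ∷ (λ _ → refl) ∷ (λ _ → refl) ∷ (λ _ → refl) ∷ (λ _ → refl) ∷ (λ _ → refl) ∷ (λ _ → refl) ∷ (λ _ → refl) ∷ [])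
    row-spec : Rows n (arr σ₁)
    row-spec = subst (λ s → Rows n (arr (run s σ₀))) (sym rows≡)
      (subst (λ x → Rows x (arr (iter n (run rowStep) σ₀))) (+-identityʳ n)
        (rows-loop n {0} {σ₀} record { counter = refl ; sum = refl ; rows< = λ _ () }))
    row-input : ∀ {τ} → inp (run rows τ) ≡ inp τ
    row-input {τ} = trans (cong (λ s → inp (run s τ)) rows≡) (same n τ)
      where
      same : ∀ k τ → inp (iter k (run rowStep) τ) ≡ inp τ
      same zero τ = refl
      same (suc k) τ = same k (run rowStep τ)
    reading : Reading m [] σ₂
    reading = subst (λ x → Reading x [] σ₂) (+-identityʳ m) (read-all es {0} {σ₁} (initial zero₁))
      where
      initial : Zero rowCells (arr σ₁) → Reading 0 es σ₁
      initial (zl ∷ _ ∷ _ ∷ _ ∷ _ ∷ _ ∷ zi ∷ _) = record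
        { rowOf = λ p → Rows.rows< row-spec (toℕ p) (Fin.toℕ<n p)
        ; counter = zi 0
        ; pending = row-input {σ₀}
        ; suffix = λ {j} {x} e → subst (λ y → Nth es y x) (sym (+-identityʳ j)) e
        ; edges = λ () ; seen = λ () ; partial = λ x → inj₂ (zl (idx x)) }
    open Reading reading
    zero₂ : Zero keepCells (arr σ₂)
    zero₂ = zero-frame (loop-agree zero₁) (dropped zero₁)
      where
      dropped : ∀ {a} → Zero rowCells a → Zero keepCells a
      dropped (_ ∷ _ ∷ _ ∷ s ∷ m₀ ∷ m₁ ∷ _ ∷ md ∷ bd ∷ []) = s ∷ m₀ ∷ m₁ ∷ md ∷ bd ∷ []
      loop-agree : Zero rowCells (arr σ₁) → Agree keepCells (arr σ₁) (arr σ₂)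
      loop-agree _ with agree (loop byM readEdge)
        ((tRow , false) ∷ (tSet , false) ∷ (tMark , false) ∷ (tMark , true) ∷ (tMode , false) ∷ (tBad , false) ∷ []) σ₁ loop-untouched
        where
        loop-untouched : untouched (loop byM readEdge)
          ((tRow , false) ∷ (tSet , false) ∷ (tMark , false) ∷ (tMark , true) ∷ (tMode , false) ∷ (tBad , false) ∷ []) ≡ true
        loop-untouched = readEdge-untouched
      ... | _ ∷ rest = rest
    data Cell : ℕ → Bool → Set where
      tSet′  : Cell tSet false
      mark₀  : Cell tMark false
      mark₁  : Cell tMark true
      mode′  : Cell tMode false
      bad′   : Cell tBad false
    zeroAt : ∀ {t k} → Cell t k → ∀ i → arr σ₃ t k i ≡ 0
    zeroAt c i with zero₂ | c
    ... | s ∷ m₀ ∷ m₁ ∷ md ∷ bd ∷ [] | tSet′ = s i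
    ... | s ∷ m₀ ∷ m₁ ∷ md ∷ bd ∷ [] | mark₀ = m₀ i
    ... | s ∷ m₀ ∷ m₁ ∷ md ∷ bd ∷ [] | mark₁ = m₁ i
    ... | s ∷ m₀ ∷ m₁ ∷ md ∷ bd ∷ [] | mode′ = md i
    ... | s ∷ m₀ ∷ m₁ ∷ md ∷ bd ∷ [] | bad′ = bd i
    stale : Stale (arr σ₃) 0
    stale false p = ≤-reflexive (zeroAt mark₀ p)
    stale true p = ≤-reflexive (zeroAt mark₁ p)
    tables : Tables (arr σ₃)
    tables = record
      { rowOf = rowOf
      ; labOf = λ p q → labelOf p q (0 <? lab p q) (partial (p , q))
      ; edgeOf = λ e → edges (nth-< e) e }
      where
      labelOf : ∀ p q → Dec (0 < lab p q) → Right (arr σ₂ tLab false) (p , q) ⊎ arr σ₂ tLab false (idx (p , q)) ≡ 0 →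
                arr σ₂ tLab false (idx (p , q)) ≡ lab p q
      labelOf p q (yes pos) _ with es-covers pos
      ... | inj₁ x = let (j , lt , e) = nth-of x in proj₁ (seen lt e)
      ... | inj₂ x = let (j , lt , e) = nth-of x in proj₂ (seen lt e)
      labelOf p q (no ¬pos) (inj₁ e) = e
      labelOf p q (no ¬pos) (inj₂ e) = trans e (sym (n≮0⇒n≡0 ¬pos))
        where
        n≮0⇒n≡0 : ∀ {k} → ¬ 0 < k → k ≡ 0
        n≮0⇒n≡0 {zero} _ = refl
        n≮0⇒n≡0 {suc k} ¬p = ⊥-elim (¬p (s≤s z≤n))

  data Verdict (os : List ℕ) : Set₁ where
    accept : ∀ A → Closed ⟪ A ⟫ → (∀ {x} → x ∈ es → Assigned A x) → os ≡ 1 ∷ encode (map (orient A) es) → Verdict os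
    reject : NoTTO → os ≡ 0 ∷ [] → Verdict os

  main-spec : Verdict (out (run main (empty (inputOf es))))
  main-spec = subst (λ s → Verdict (out (run s σ₀))) (sym main≡) (verdict (finish (sixfold-spec {σ₁} init-spec)))
    where
    loading : Stmt
    loading = rows ⨾ loop byM readEdge ⨾ tI := con 0
    σ₀ = empty (inputOf es)
    σ₁ = run loading σ₀
    σ₂ = run (sixfold (loop byM step)) σ₁
    quiet₁ : out σ₁ ≡ []
    quiet₁ = silent-out (rows ⨾ loop byM readEdge) σ₀ input-silent
    loops : ∀ k τ → out (iter k (run step) τ) ≡ out τ
    loops zero τ = refl
    loops (suc k) τ = trans (loops k (run step τ)) (silent-out step τ step-silent)
    quiet : out σ₂ ≡ []
    quiet = trans (loops m _) (trans (loops m _) (trans (loops m _) (trans (loops m _) (trans (loops m _) (trans (loops m σ₁) quiet₁)))))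
    verdict : Accepted (arr σ₂) ⊎ Refuted (arr σ₂) → Verdict (out (run answer σ₂))
    verdict (inj₁ w) = accept (Accepted.A w) (Accepted.closed w) (Accepted.total w) (answer-accept {σ₂} w quiet)
    verdict (inj₂ r) = reject (Refuted.noTTO r) (answer-refute {σ₂} r quiet)

-- The constants of the running time.

opaque
  unitCost : ℕ
  unitCost = Semantics.time 1 1 main

  main-time : ∀ n m → 1 ≤ n → 1 ≤ m → Semantics.time n m main ≤ unitCost * (n * m)
  main-time n m 1≤n 1≤m = Bound.time-bound n m 1≤n 1≤m true true main main-loops

-- The 7 bounds the whole run on a graph without edges; it also absorbs the three initial steps of
-- all other runs.
constant-bound : ∀ {t} u x → t ≤ 7 → t ≤ (7 + u) * (1 + x)
constant-bound u x le = ≤-trans le (≤-trans (m≤m+n 7 u) (m≤m*n (7 + u) (1 + x)))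

linear-bound : ∀ {t} u x y → t ≤ 3 + u * x → t ≤ (7 + u) * (1 + (x + y))
linear-bound u x y le = ≤-trans le (≤-trans
  (+-mono-≤ (≤-trans (m≤m+n 3 4) (m≤m*n 7 (1 + (x + y)))) (*-monoʳ-≤ u (≤-trans (m≤m+n x y) (n≤1+n (x + y)))))
  (≤-reflexive (sym (*-distribʳ-+ (1 + (x + y)) 7 u))))

-- Temporal graphs

module _ {n : ℕ} (G : TemporalGraph n) where
  open TemporalGraph G

  labOf : Fin n → Fin n → ℕ
  labOf a b with T? (adj a b)
  ... | yes p = suc (label p)
  ... | no _  = 0

  labOf-edge : ∀ {a b} (p : a ~ b) → labOf a b ≡ suc (label p)
  labOf-edge {a} {b} p with T? (adj a b)
  ... | yes q = cong (λ r → suc (label r)) (T-irrelevant q p)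
  ... | no ¬p = ⊥-elim (¬p p)

  labOf-nonedge : ∀ {a b} → ¬ a ~ b → labOf a b ≡ 0
  labOf-nonedge {a} {b} ¬p with T? (adj a b)
  ... | yes p = ⊥-elim (¬p p)
  ... | no _  = refl

  edge-of : ∀ {a b} → 0 < labOf a b → a ~ b
  edge-of {a} {b} pos with T? (adj a b)
  ... | yes p = p

  labOf-pos : ∀ {a b} → a ~ b → 0 < labOf a b
  labOf-pos p = subst (0 <_) (sym (labOf-edge p)) (s≤s z≤n)

  labOf-sym : ∀ a b → labOf a b ≡ labOf b a
  labOf-sym a b with T? (adj a b)
  ... | yes p = trans (cong suc (label-sym p (~-sym p))) (sym (labOf-edge (~-sym p)))
  ... | no ¬p = sym (labOf-nonedge (λ q → ¬p (~-sym q)))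

  labOf-loop : ∀ a → labOf a a ≡ 0
  labOf-loop a = labOf-nonedge ~-irrefl

  module _ where
    open Orient labOf labOf-sym

    labOf-≤ : ∀ {a b c d} (p : a ~ b) (q : c ~ d) → label p ≤ label q → labOf a b ≤ labOf c d
    labOf-≤ p q le = subst₂ _≤_ (sym (labOf-edge p)) (sym (labOf-edge q)) (s≤s le)

    label-≤ : ∀ {a b c d} (p : a ~ b) (q : c ~ d) → labOf a b ≤ labOf c d → label p ≤ label q
    label-≤ p q le = ≤-pred (subst₂ _≤_ (labOf-edge p) (labOf-edge q) le)

    tto⇒closed : ∀ {O} → IsTTO G O → Closed O
    tto⇒closed t = transitive⇒closed (λ o → labOf-pos (sound o)) asym (λ pos → total (edge-of pos)) ltrans
      where
      open IsTTO t
      open IsOrientation isOrientation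
      ltrans : LTransitive _
      ltrans ab bc le with transitive (sound ab) (sound bc) ab bc (label-≤ (sound ab) (sound bc) le)
      ... | r , ac , le′ = ac , labOf-≤ (sound bc) r le′

    -- The extension argument searches finite sets with respect to `T` and so needs it decidable.
    -- For an orientation this follows from adjacency, totality and asymmetry, hence the refutation
    -- covers arbitrary relations.
    tto-dec : ∀ {O} → IsTTO G O → Decidable O
    tto-dec t a b with T? (adj a b)
    ... | no ¬p = no λ o → ¬p (sound o)
      where open IsOrientation (IsTTO.isOrientation t)
    ... | yes p with IsOrientation.total (IsTTO.isOrientation t) p
    ...   | inj₁ o = yes o
    ...   | inj₂ o = no λ o′ → IsOrientation.asym (IsTTO.isOrientation t) o o′

    closed⇒tto : ∀ {O} → Closed O → Total O → IsTTO G O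
    closed⇒tto {O} cl tot = record
      { isOrientation = record { sound = λ o → edge-of (Closed.sound cl o) ; total = λ p → tot (labOf-pos p) ; asym = Closed.asym cl }
      ; transitive = tr }
      where
      tr : ∀ {a b c} (p : a ~ b) (q : b ~ c) → O a b → O b c → label p ≤ label q → Σ[ r ∈ a ~ c ] (O a c × label q ≤ label r)
      tr p q ab bc le with closed⇒transitive cl tot ab bc (labOf-≤ p q le)
      ... | ac , le′ = edge-of (Closed.sound cl ac) , ac , label-≤ q (edge-of (Closed.sound cl ac)) le′

  -- From the verdict of the machine to a correct output.

  module _ (es : List (Arc G)) (el : IsEdgeList G es) where
    open Arc
    open IsOrientation (proj₂ el)

    ends : Arc G → Fin n × Fin n
    ends e = src e , tgt e

    pairs : List (Fin n × Fin n)
    pairs = map ends es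

    ends-injective : ∀ {e e′} → ends e ≡ ends e′ → e ≡ e′
    ends-injective {arc a b p} {arc .a .b q} refl = cong (arc a b) (T-irrelevant p q)

    listed : ∀ {a b} → ⟦ G ⟧ es a b → (a , b) ∈ pairs
    listed o = map⁺ (Any.map (λ (x , y) → sym (cong₂ _,_ x y)) o)

    unlisted : ∀ {e} → e ∈ es → ⟦ G ⟧ es (src e) (tgt e)
    unlisted i = Any.map (λ { refl → refl , refl }) i

    pairs-edges : ∀ {x} → x ∈ pairs → 0 < labOf (proj₁ x) (proj₂ x)
    pairs-edges i with ∈-map⁻ ends i
    ... | e , _ , refl = labOf-pos (edge e)

    pairs-cover : ∀ {a b} → 0 < labOf a b → (a , b) ∈ pairs ⊎ (b , a) ∈ pairs
    pairs-cover pos with total (edge-of pos)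
    ... | inj₁ o = inj₁ (listed o)
    ... | inj₂ o = inj₂ (listed o)

    open Machine labOf labOf-sym labOf-loop pairs pairs-edges pairs-cover hiding (m)

    input-pairs : ∀ es → concatMap (λ (arc a b p) → toℕ a ∷ toℕ b ∷ label p ∷ []) es ≡ inputOf (map ends es)
    input-pairs [] = refl
    input-pairs (arc a b p ∷ es) =
      cong₂ (λ x xs → toℕ a ∷ toℕ b ∷ x ∷ xs) (cong pred (sym (labOf-edge p))) (input-pairs es)

    input≡ : encodeInput G es ≡ n ∷ length pairs ∷ inputOf pairs
    input≡ = cong₂ (λ x xs → n ∷ x ∷ xs) (sym (length-map ends es)) (input-pairs es)

    module _ {A : List (Fin n × Fin n)} (cl : Closed ⟪ A ⟫) (asg : ∀ {x} → x ∈ pairs → Assigned A x) where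

      flip : Arc G → Arc G
      flip e with ends e ∈? A
      ... | yes _ = e
      ... | no _  = arc (tgt e) (src e) (~-sym (edge e))

      ends-flip : ∀ e → ends (flip e) ≡ orient A (ends e)
      ends-flip e with ends e ∈? A
      ... | yes _ = refl
      ... | no _  = refl

      chosen : List (Arc G)
      chosen = map flip es

      output≡ : ∀ es → encodeOrientation G (map flip es) ≡ encode (map (orient A) (map ends es))
      output≡ [] = refl
      output≡ (e ∷ es) = cong₂ (λ (a , b) xs → toℕ a ∷ toℕ b ∷ xs) (ends-flip e) (output≡ es)

      orient-∈ : ∀ {x} → x ∈ pairs → orient A x ∈ A
      orient-∈ {x} i with x ∈? A | asg i
      ... | yes j | _ = j
      ... | no ¬j | inj₁ j = ⊥-elim (¬j j)
      ... | no _  | inj₂ j = j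

      to-A : ∀ {a b} → ⟦ G ⟧ chosen a b → (a , b) ∈ A
      to-A o = go es (λ i → i) o
        where
        go : ∀ fs → (∀ {e} → e ∈ fs → e ∈ es) → ∀ {a b} → ⟦ G ⟧ (map flip fs) a b → (a , b) ∈ A
        go (e ∷ fs) inc (here (refl , refl)) = subst (_∈ A) (sym (ends-flip e)) (orient-∈ (∈-map⁺ ends (inc (here refl))))
        go (e ∷ fs) inc (there o) = go fs (λ i → inc (there i)) o

      -- The edge of an arc in `A` is listed in one of its two directions; by the antisymmetry of
      -- `A` that entry is turned exactly when it is listed against the arc.
      from-A : ∀ {a b} → (a , b) ∈ A → ⟦ G ⟧ chosen a b
      from-A {a} {b} i with pairs-cover (Closed.sound cl i)
      ... | inj₁ j with ∈-map⁻ ends j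
      ...   | e , k , refl = map⁺ (Any.map (λ { refl → kept }) k)
        where
        kept : src (flip e) ≡ src e × tgt (flip e) ≡ tgt e
        kept with ends e ∈? A
        ... | yes _ = refl , refl
        ... | no ¬i = ⊥-elim (¬i i)
      from-A {a} {b} i | inj₂ j with ∈-map⁻ ends j
      ...   | e , k , refl = map⁺ (Any.map (λ { refl → turned }) k)
        where
        turned : src (flip e) ≡ tgt e × tgt (flip e) ≡ src e
        turned with ends e ∈? A
        ... | yes i′ = ⊥-elim (Closed.asym cl i i′)
        ... | no _ = refl , refl

      -- If only one of the two arcs were reversed, the edge list would contain both directions of
      -- the same edge.
      flip-injective : ∀ {e e′} → e ∈ es → e′ ∈ es → flip e ≡ flip e′ → e ≡ e′
      flip-injective {e} {e′} i i′ eq with ends e ∈? A | ends e′ ∈? A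
      ... | yes _ | yes _ = eq
      ... | no _  | no _  = ends-injective (cong swap (cong ends eq))
      ... | yes _ | no _  = ⊥-elim (asym (unlisted i) (subst (λ (a , b) → ⟦ G ⟧ es b a) (sym (cong ends eq)) (unlisted i′)))
      ... | no _  | yes _ = ⊥-elim (asym (unlisted i′) (subst (λ (a , b) → ⟦ G ⟧ es b a) (cong ends eq) (unlisted i)))

      unique-map : ∀ {fs} → (∀ {e} → e ∈ fs → e ∈ es) → Unique fs → Unique (map flip fs)
      unique-map inc [] = []
      unique-map {e ∷ fs} inc (p ∷ ps) = All.tabulate (λ i → separate (∈-map⁻ flip i)) ∷ unique-map (λ i → inc (there i)) ps
        where
        separate : ∀ {f} → Σ[ e′ ∈ Arc G ] (e′ ∈ fs × f ≡ flip e′) → flip e ≢ f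
        separate (e′ , i , refl) eq = All.lookup p i (flip-injective (inc (here refl)) (inc (there i)) eq)

      chosen-closed : Closed (⟦ G ⟧ chosen)
      chosen-closed = record
        { sound = λ o → Closed.sound cl (to-A o)
        ; asym = λ o o′ → Closed.asym cl (to-A o) (to-A o′)
        ; head = λ o p q → from-A (Closed.head cl (to-A o) p q)
        ; tail = λ o p q r → from-A (Closed.tail cl (to-A o) p q r)
        ; mono = λ o o′ p q → from-A (Closed.mono cl (to-A o) (to-A o′) p q) }

      chosen-total : Total (⟦ G ⟧ chosen)
      chosen-total pos with pairs-cover pos
      ... | inj₁ i = [ (λ j → inj₁ (from-A j)) , (λ j → inj₂ (from-A j)) ]′ (asg i)
      ... | inj₂ i = [ (λ j → inj₂ (from-A j)) , (λ j → inj₁ (from-A j)) ]′ (asg i)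

      accepted : CorrectOutput G (1 ∷ encode (map (orient A) pairs))
      accepted = subst (λ xs → CorrectOutput G (1 ∷ xs)) (output≡ es)
        (YES chosen (unique-map (λ i → i) (proj₁ el) , IsTTO.isOrientation tto) tto)
        where
        tto : IsTTO G (⟦ G ⟧ chosen)
        tto = closed⇒tto chosen-closed chosen-total

    correct : ∀ {os} → Verdict os → CorrectOutput G os
    correct (accept A cl asg refl) = accepted cl asg
    correct (reject none refl) = NO λ (O , t) →
      none (tto-dec t) (tto⇒closed t) (λ pos → IsOrientation.total (IsTTO.isOrientation t) (edge-of pos))

    nonempty : ∀ k → length pairs ≡ suc k → 1 ≤ n →
      ∃[ t ] ∃[ o ] (compile main ⊢ start (encodeInput G es) ⇓⟨ t ⟩ o × CorrectOutput G o ×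
                     t ≤ 3 + unitCost * (n * length es))
    nonempty k eq 1≤n = t , o , subst (λ xs → compile main ⊢ start xs ⇓⟨ t ⟩ o) (sym input≡) runs , correct main-spec ,
      ≤-trans le (+-monoʳ-≤ 3 (≤-trans (main-time n (length pairs) 1≤n (subst (1 ≤_) (sym eq) (s≤s z≤n)))
        (≤-reflexive (cong (λ x → unitCost * (n * x)) (length-map ends es)))))
      where
      o = out (Semantics.run n (length pairs) main (empty (inputOf pairs)))
      result : ∃[ t ] (compile main ⊢ start (n ∷ length pairs ∷ inputOf pairs) ⇓⟨ t ⟩ o × t ≤ 3 + Semantics.time n (length pairs) main)
      result = subst (λ m → ∃[ t ] (compile main ⊢ start (n ∷ m ∷ inputOf pairs) ⇓⟨ t ⟩ out (Semantics.run n m main (empty (inputOf pairs)))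
                                    × t ≤ 3 + Semantics.time n m main)) (sym eq) (Whole.runs-nonempty main n k (inputOf pairs))
      t = proj₁ result
      runs = proj₁ (proj₂ result)
      le = proj₂ (proj₂ result)

theorem3 : Σ[ P ∈ Program ] Σ[ C ∈ ℕ ]
    (∀ (n : ℕ) (G : TemporalGraph n) (es : List (Arc G)) → IsEdgeList G es →
    let m = length es
        k = #monolabelTriangles G
    in ∃[ t ] ∃[ o ]
    (P ⊢ start (encodeInput G es) ⇓⟨ t ⟩ o
    × CorrectOutput G o
    × t ≤ C * (1 + (n * m + (k * n) ⊓ (m ^ 2)))))
theorem3 = compile main , 7 + unitCost , solve
  where
  Claim : ∀ n (G : TemporalGraph n) (es : List (Arc G)) → Set₁
  Claim n G es = ∃[ t ] ∃[ o ] (compile main ⊢ start (encodeInput G es) ⇓⟨ t ⟩ o × CorrectOutput G o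
    × t ≤ (7 + unitCost) * (1 + (n * length es + (#monolabelTriangles G * n) ⊓ (length es ^ 2))))
  inhabited : ∀ {n} → Fin n → 1 ≤ n
  inhabited Fin.zero = s≤s z≤n
  inhabited (Fin.suc _) = s≤s z≤n
  solve-empty : ∀ n (G : TemporalGraph n) → IsEdgeList G [] →
                ∃[ t ] (compile main ⊢ start (n ∷ 0 ∷ []) ⇓⟨ t ⟩ (1 ∷ []) × t ≤ 7) → Claim n G []
  solve-empty n G el (t , runs , le) = t , 1 ∷ [] , runs ,
    YES [] el (record { isOrientation = proj₂ el ; transitive = λ _ _ () }) ,
    constant-bound unitCost (n * 0 + (#monolabelTriangles G * n) ⊓ 0) le
  solve : ∀ n (G : TemporalGraph n) (es : List (Arc G)) → IsEdgeList G es → Claim n G es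
  solve n G [] el = solve-empty n G el (Whole.runs-empty main n)
  solve n G es@(e ∷ es′) el =
    -- The source of an edge witnesses 1 ≤ n, which the multiplicative time bound requires.
    let (t , o , runs , ok , le) = nonempty G es el (length (map (ends G es el) es′)) refl (inhabited (Arc.src e))
    in t , o , runs , ok , linear-bound unitCost (n * length es) ((#monolabelTriangles G * n) ⊓ (length es ^ 2)) le
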